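{- Let $d,n>1$ be integers with $n\equiv 1 \pmod{2d}$. Then, modulo $\Phi_{n}(q)^3$, \[ \sum_{k=0}^{(n-1)/d}[3dk+1]\frac{(q;q^{2d})_{k}(q^{d-1};q^{d})_{k}(q;q^{d})_{k}^2}{(q^{d};q^{d})_{k}(q^{d+2};q^{2d})_{k}(q^{2d};q^{2d})_{k}^2}q^{d(k^{2}+k)/2} \equiv \frac{(q^{d};q^{2d})_{(n-1)/(2d)}}{(q^{d+2};q^{2d})_{(n-1)/(2d)}}[n]\,q^{ -(n-1)(d-1)/(2d)}, \] and, modulo $\Phi_{n}(q)^3$, \[ \sum_{k=0}^{n-1}[3dk+1]\frac{(q;q^{2d})_{k}(q^{d-1};q^{d})_{k}(q;q^{d})_{k}^2}{(q^{d};q^{d})_{k}(q^{d+2};q^{2d})_{k}(q^{2d};q^{2d})_{k}^2}q^{d(k^{2}+k)/2} \equiv \frac{(q^{d};q^{2d})_{(n-1)/(2d)}}{(q^{d+2};q^{2d})_{(n-1)/(2d)}}[n]\,q^{ -(n-1)(d-1)/(2d)}. \]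
   Context: For an indeterminate $q$, $(x;q)_k=(1-x)(1-xq)\cdots(1-xq^{k-1})$ (with $(x;q)_0=1$). $[m]=(1-q^m)/(1-q)$ is the $q$-integer and $\Phi_n(q)$ is the $n$-th cyclotomic polynomial. A congruence between rational functions in $q$ modulo a polynomial $P(q)$ means that the difference is $P(q)$ times a rational function whose denominator is coprime to $P(q)$. -}

module Defs where

open import Data.Nat as ℕ using (ℕ; zero; suc; _∸_; _<ᵇ_)
open import Data.Nat.DivMod using (_/_)
open import Data.Nat.Divisibility using (_∣?_)
open import Data.Integer as ℤ using (ℤ; +_; -[1+_])
open import Data.List using (List; []; _∷_; length; foldr; filter; upTo; map; replicate; _++_)
open import Data.Product using (_×_; _,_; ∃)
open import Data.Bool using (if_then_else_)
open import Relation.Binary.PropositionalEquality using (_≡_; _≢_; refl)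
open import Relation.Nullary.Decidable using (⌊_⌋)

-- Natural-number division, total (m div 0 = 0). Only used with nonzero divisors.

_div_ : ℕ → ℕ → ℕ
m div zero = 0
m div suc k = m / suc k

-- Polynomials in q with integer coefficients: coefficient lists, constant term first.
-- Trailing zeros are allowed; equality is coefficientwise (_≈P_).

Poly : Set
Poly = List ℤ

coeff : Poly → ℕ → ℤ
coeff []      _       = + 0
coeff (a ∷ p) zero    = a
coeff (a ∷ p) (suc i) = coeff p i

_≈P_ : Poly → Poly → Set
p ≈P r = ∀ i → coeff p i ≡ coeff r i

infix 4 _≈P_
infixl 6 _+P_ _-P_
infixl 7 _*P_

constP : ℤ → Poly
constP c = c ∷ []

zeroP oneP : Poly
zeroP = []
oneP  = constP (+ 1)

_+P_ : Poly → Poly → Poly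
[]      +P r       = r
(a ∷ p) +P []      = a ∷ p
(a ∷ p) +P (b ∷ r) = (a ℤ.+ b) ∷ (p +P r)

scaleP : ℤ → Poly → Poly
scaleP c = map (c ℤ.*_)

negP : Poly → Poly
negP = scaleP (ℤ.- (+ 1))

_-P_ : Poly → Poly → Poly
p -P r = p +P negP r

_*P_ : Poly → Poly → Poly
[]      *P r = []
(a ∷ p) *P r = scaleP a r +P (+ 0 ∷ (p *P r))

qpow : ℕ → Poly
qpow e = replicate e (+ 0) ++ (+ 1 ∷ [])

_^P_ : Poly → ℕ → Poly
p ^P zero  = oneP
p ^P suc k = (p ^P k) *P p

prodP : List Poly → Poly
prodP = foldr _*P_ oneP

qint : ℕ → Poly
qint zero    = zeroP
qint (suc m) = qint m +P qpow m

poch : ℕ → ℕ → ℕ → Poly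
poch a b zero    = oneP
poch a b (suc k) = poch a b k *P (oneP -P qpow (a ℕ.+ b ℕ.* k))

-- Cyclotomic polynomials, via  Φ_n = (q^n - 1) / ∏_{d ∣ n, d < n} Φ_d
-- (exact division by a monic polynomial, implemented as long division).

norm : Poly → Poly
norm []      = []
norm (a ∷ p) with norm p
... | []    = if ⌊ a ℤ.≟ + 0 ⌋ then [] else (a ∷ [])
... | b ∷ r = a ∷ b ∷ r

lastC : Poly → ℤ
lastC []           = + 0
lastC (a ∷ [])     = a
lastC (a ∷ b ∷ p)  = lastC (b ∷ p)

divMonicF : ℕ → Poly → Poly → Poly × Poly
divMonicF zero    p g = [] , p
divMonicF (suc f) p g with norm p | norm g
... | p' | g' =
  if length p' <ᵇ length g'
  then ([] , p')
  else (let s = length p' ∸ length g'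
            t = scaleP (lastC p') (qpow s)
        in step t (divMonicF f (p' -P (t *P g')) g))
  where
  step : Poly → Poly × Poly → Poly × Poly
  step t (qu , r) = (qu +P t , r)

quotMonic : Poly → Poly → Poly
quotMonic p g with divMonicF (suc (length p)) p g
... | qu , _ = qu

cycloF : ℕ → ℕ → Poly
cycloF zero    n = zeroP
cycloF (suc f) n =
  quotMonic (qpow n -P oneP)
            (prodP (map (cycloF f) (filter (_∣? n) (upTo n))))

Φ : ℕ → Poly
Φ n = cycloF n n

private
  Φ1 : Φ 1 ≡ (-[1+ 0 ] ∷ + 1 ∷ [])
  Φ1 = refl
  Φ6 : Φ 6 ≡ (+ 1 ∷ -[1+ 0 ] ∷ + 1 ∷ [])
  Φ6 = refl
  Φ9 : Φ 9 ≡ (+ 1 ∷ + 0 ∷ + 0 ∷ + 1 ∷ + 0 ∷ + 0 ∷ + 1 ∷ [])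
  Φ9 = refl
  Φ12 : Φ 12 ≡ (+ 1 ∷ + 0 ∷ -[1+ 0 ] ∷ + 0 ∷ + 1 ∷ [])
  Φ12 = refl
  Φ15 : Φ 15 ≡ (+ 1 ∷ -[1+ 0 ] ∷ + 0 ∷ + 1 ∷ -[1+ 0 ] ∷ + 1 ∷ + 0 ∷ -[1+ 0 ] ∷ + 1 ∷ [])
  Φ15 = refl

-- Rational functions in q, represented as (numerator , denominator).
-- All denominators used below are nonzero products of factors (1 - q^e), e ≥ 1.

Frac : Set
Frac = Poly × Poly

_+F_ : Frac → Frac → Frac
(n₁ , d₁) +F (n₂ , d₂) = (n₁ *P d₂ +P n₂ *P d₁ , d₁ *P d₂)

sumF : (ℕ → Frac) → ℕ → Frac
sumF f zero    = (zeroP , oneP)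
sumF f (suc N) = sumF f N +F f N

-- Coprimality of polynomials in ℚ[q] (gcd 1), via Bézout with integer coefficients
-- after clearing denominators:  a f + b g = c  for a nonzero integer c.
CoprimeP : Poly → Poly → Set
CoprimeP f g = ∃ λ a → ∃ λ b → ∃ λ c → (c ≢ + 0) × (a *P f +P b *P g ≈P constP c)

-- A ≡ B (mod M): A - B = M · (P/Q) with Q coprime to M.
_≡F_[mod_] : Frac → Frac → Poly → Set
(n₁ , d₁) ≡F (n₂ , d₂) [mod M ] =
  ∃ λ P → ∃ λ Q → CoprimeP Q M ×
    ((n₁ *P d₂ -P n₂ *P d₁) *P Q ≈P M *P P *P d₁ *P d₂)

term : ℕ → ℕ → Frac
term d k =
  ( qint (3 ℕ.* d ℕ.* k ℕ.+ 1) *P poch 1 (2 ℕ.* d) k *P poch (d ∸ 1) d k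
      *P poch 1 d k *P poch 1 d k *P qpow ((d ℕ.* (k ℕ.* k ℕ.+ k)) div 2)
  , poch d d k *P poch (d ℕ.+ 2) (2 ℕ.* d) k
      *P poch (2 ℕ.* d) (2 ℕ.* d) k *P poch (2 ℕ.* d) (2 ℕ.* d) k )

lhs : ℕ → ℕ → Frac
lhs d M = sumF (term d) (suc M)

rhs : ℕ → ℕ → Frac
rhs d n =
  ( poch d (2 ℕ.* d) m *P qint n
  , poch (d ℕ.+ 2) (2 ℕ.* d) m *P qpow (((n ∸ 1) ℕ.* (d ∸ 1)) div (2 ℕ.* d)) )
  where m = (n ∸ 1) div (2 ℕ.* d)

{-# OPTIONS --safe #-}
-- Put Q = q^d, n = 2dm + 1 and t = 1 - q^n, and replace the base point q of the summand by a variable x: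
--   U_k(x) = (1 - xQ^{3k}) (x;Q)_k² (Q/x;Q)_k (x;Q²)_k Q^{k(k+1)/2} / ((Q²;Q²)_k² (x²Q;Q²)_k (Q;Q)_k).
-- A Gosper-type certificate G gives, up to units, U_k(x) - r(x) U_k(xQ²) = G_{k+1}(x) - G_k(x) with
--   r(x) = -x (1 - xQ)² / ((1 - x²Q) (1 - x²Q³)).
-- Summing over k ≤ 2m and iterating from x = q to x = qQ^{2m} = q^n, every boundary term carries three
-- factors divisible by t, while at x = q^n only the summand k = 0, which is t, survives modulo t³.  Hence the
-- first sum is t ∏ r(qQ^{2j}), and modulo t² this product is the stated quotient of q-shifted factorials.
--
-- In the second sum the summands with k > 2m are divisible by t³, except that for d > 4 the factor
-- (x²Q;Q²)_k of the denominator costs one t before the numerator (Q/x;Q)_k regains it.  Iterating the same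
-- relation towards x = qQ^{-2j} moves the pole up and this zero down until they have crossed; then each
-- summand of the tail vanishes modulo t³, and so does the tail of the original sum.
--
-- All of this happens in the local ring of fractions with denominator coprime to Φ_n; that q^e - 1 is
-- coprime to Φ_n for n ∤ e follows from q^n - 1 = ∏_{i ∣ n} Φ_i, i.e. from the exactness of the long
-- divisions that define Φ.
module Submission where

open import Defs
open import Algebra.Bundles using (CommutativeRing)
import Algebra.Properties.AbelianGroup
import Algebra.Properties.Ring
import Algebra.Properties.Semiring.Exp
import Algebra.Solver.Ring
open import Algebra.Solver.Ring.AlmostCommutativeRing using (fromCommutativeRing; _-Raw-AlmostCommutative⟶_)
open import Data.Empty using (⊥-elim)
open import Data.Fin using (#_)
open import Data.Integer.Base as ℤ using (ℤ; +_; -[1+_])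
import Data.Integer.Divisibility.Signed as Signed
import Data.Integer.Properties as ℤ
open import Data.Integer.Tactic.RingSolver using (solve-∀)
open import Data.List.Base using (List; []; _∷_; _++_; length; map; filter; upTo)
open import Data.List.Membership.Propositional.Properties using (∈-filter⁻; ∈-upTo⁻)
open import Data.List.Properties using (map-++; filter-++; upTo-∷ʳ; map-cong-local)
import Data.List.Relation.Unary.All as All
open import Data.Maybe.Base using (Maybe; just; nothing)
open import Data.Nat.Base as ℕ using (ℕ; zero; suc; z≤n; s≤s; _<ᵇ_)
open import Data.Nat.Divisibility as ℕ using (_∣?_)
import Data.Nat.DivMod as ℕ
open import Data.Nat.GCD using (gcd; gcd[m,n]∣m; gcd[m,n]∣n; gcd-GCD; module Bézout)
import Data.Nat.Induction as ℕ
import Data.Nat.Properties as ℕ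
import Data.Nat.Tactic.RingSolver as ℕ using (solve-∀)
open import Data.Product.Base using (∃; _×_; _,_; proj₁; proj₂)
open import Data.Sum.Base using (_⊎_; inj₁; inj₂)
open import Data.Unit.Base using (tt)
open import Data.Vec.Base using (Vec; []; _∷_)
open import Induction.WellFounded using (Acc; acc)
open import Level as Level using (Level; 0ℓ)
open import Relation.Binary.Definitions using (tri<; tri≈; tri>)
open import Relation.Binary.PropositionalEquality as ≡ using (_≡_; _≢_)
import Relation.Binary.Reasoning.Setoid
open import Relation.Nullary using (¬_; yes; no; contradiction)

-- Orders are counted in powers of t = 1 - q^n rather than of Φ_n, inside a ring K of all fractions,
-- so that poles exist there. A factor 1 - q^e is a unit of the local ring if n ∤ e; if n ∣ e, it is
-- a multiple of t and its inverse costs at most one t. Every order is thus read off from the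
-- divisibility of exponents by n. Only at the end does t³ become Φ_n³, through Φ_n ∣ t.
--
-- From n = 1 + 2dm, both d and 2d are invertible modulo n, so each q-shifted factorial has exactly
-- one such exponent among n consecutive indices. At x = q^{n-2di} these indices are 2i for (x;Q), i
-- for (x;Q²), dm + 2i for (x²Q;Q²) and 2dm - 2i for (Q/x;Q). All estimates compare k with these
-- four numbers.
--
-- The product of the r is needed only modulo t², because the sum at x = q^n supplies one t. Half of
-- its denominators form (q^{d+2};q^{2d})_m. The others pair with the squares (1 - xQ)²: with u =
-- q^n, each quotient (1 - uz)²/(1 - u²z) agrees with 1 - z modulo t².

module IntegerSolver {c ℓ} (R : CommutativeRing c ℓ) where
  open CommutativeRing R
  open Algebra.Properties.Ring ring using (-‿distribˡ-*; -‿distribʳ-*; -0#≈0#; -‿involutive)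
  open Algebra.Properties.AbelianGroup +-abelianGroup using (⁻¹-∙-comm)
  open Relation.Binary.Reasoning.Setoid setoid

  -- The numeral 1 denotes 1# itself (not 1# + 0#), so that `con (+ 1)` matches 1# on the nose.
  fromℕ : ℕ → Carrier
  fromℕ zero          = 0#
  fromℕ (suc zero)    = 1#
  fromℕ (suc (suc n)) = 1# + fromℕ (suc n)

  fromℤ : ℤ → Carrier
  fromℤ (+ n)    = fromℕ n
  fromℤ -[1+ n ] = - fromℕ (suc n)

  fromℕ-suc : ∀ n → fromℕ (suc n) ≈ 1# + fromℕ n
  fromℕ-suc zero    = sym (+-identityʳ 1#)
  fromℕ-suc (suc n) = refl

  fromℕ-+ : ∀ m n → fromℕ (m ℕ.+ n) ≈ fromℕ m + fromℕ n
  fromℕ-+ zero    n = sym (+-identityˡ _)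
  fromℕ-+ (suc m) n = begin
    fromℕ (suc (m ℕ.+ n))    ≈⟨ fromℕ-suc (m ℕ.+ n) ⟩
    1# + fromℕ (m ℕ.+ n)     ≈⟨ +-congˡ (fromℕ-+ m n) ⟩
    1# + (fromℕ m + fromℕ n) ≈⟨ sym (+-assoc _ _ _) ⟩
    1# + fromℕ m + fromℕ n   ≈⟨ +-congʳ (sym (fromℕ-suc m)) ⟩
    fromℕ (suc m) + fromℕ n  ∎

  fromℕ-* : ∀ m n → fromℕ (m ℕ.* n) ≈ fromℕ m * fromℕ n
  fromℕ-* zero    n = sym (zeroˡ _)
  fromℕ-* (suc m) n = begin
    fromℕ (n ℕ.+ m ℕ.* n)              ≈⟨ fromℕ-+ n (m ℕ.* n) ⟩
    fromℕ n + fromℕ (m ℕ.* n)          ≈⟨ +-cong (sym (*-identityˡ _)) (fromℕ-* m n) ⟩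
    1# * fromℕ n + fromℕ m * fromℕ n   ≈⟨ sym (distribʳ _ _ _) ⟩
    (1# + fromℕ m) * fromℕ n           ≈⟨ *-congʳ (sym (fromℕ-suc m)) ⟩
    fromℕ (suc m) * fromℕ n            ∎

  fromℤ-⊖ : ∀ m n → fromℤ (m ℤ.⊖ n) ≈ fromℕ m - fromℕ n
  fromℤ-⊖ zero zero = trans (sym (+-identityˡ _)) (+-congˡ (sym -0#≈0#))
  fromℤ-⊖ zero (suc n) = sym (+-identityˡ _)
  fromℤ-⊖ (suc m) zero = trans (sym (+-identityʳ _)) (+-congˡ (sym -0#≈0#))
  fromℤ-⊖ (suc m) (suc n) = begin
    fromℤ (suc m ℤ.⊖ suc n)              ≡⟨ ≡.cong fromℤ (ℤ.[1+m]⊖[1+n]≡m⊖n m n) ⟩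
    fromℤ (m ℤ.⊖ n)                      ≈⟨ fromℤ-⊖ m n ⟩
    fromℕ m - fromℕ n                    ≈⟨ +-congʳ (sym (+-identityʳ _)) ⟩
    fromℕ m + 0# - fromℕ n               ≈⟨ +-congʳ (+-congˡ (sym (-‿inverseʳ 1#))) ⟩
    fromℕ m + (1# - 1#) - fromℕ n        ≈⟨ +-congʳ (sym (+-assoc _ _ _)) ⟩
    fromℕ m + 1# - 1# - fromℕ n          ≈⟨ +-assoc _ _ _ ⟩
    fromℕ m + 1# + (- 1# - fromℕ n)      ≈⟨ +-cong (+-comm _ _) (⁻¹-∙-comm _ _) ⟩
    1# + fromℕ m - (1# + fromℕ n)        ≈⟨ +-cong (sym (fromℕ-suc m)) (-‿cong (sym (fromℕ-suc n))) ⟩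
    fromℕ (suc m) - fromℕ (suc n)        ∎

  fromℤ-neg : ∀ i → fromℤ (ℤ.- i) ≈ - fromℤ i
  fromℤ-neg (+ zero)  = sym -0#≈0#
  fromℤ-neg (+ suc n) = refl
  fromℤ-neg -[1+ n ]  = sym (-‿involutive _)

  fromℤ-+ : ∀ i j → fromℤ (i ℤ.+ j) ≈ fromℤ i + fromℤ j
  fromℤ-+ (+ m)    (+ n)    = fromℕ-+ m n
  fromℤ-+ (+ m)    -[1+ n ] = fromℤ-⊖ m (suc n)
  fromℤ-+ -[1+ m ] (+ n)    = trans (fromℤ-⊖ n (suc m)) (+-comm _ _)
  fromℤ-+ -[1+ m ] -[1+ n ] = begin
    - fromℕ (suc (suc (m ℕ.+ n)))      ≡⟨ ≡.cong (λ k → - fromℕ (suc k)) (≡.sym (ℕ.+-suc m n)) ⟩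
    - fromℕ (suc m ℕ.+ suc n)          ≈⟨ -‿cong (fromℕ-+ (suc m) (suc n)) ⟩
    - (fromℕ (suc m) + fromℕ (suc n))  ≈⟨ sym (⁻¹-∙-comm _ _) ⟩
    - fromℕ (suc m) - fromℕ (suc n)    ∎

  fromℤ-* : ∀ i j → fromℤ (i ℤ.* j) ≈ fromℤ i * fromℤ j
  fromℤ-* (+ m)    (+ n)    = trans (reflexive (≡.cong fromℤ (≡.sym (ℤ.pos-* m n)))) (fromℕ-* m n)
  fromℤ-* (+ m)    -[1+ n ] = begin
    fromℤ (+ m ℤ.* -[1+ n ])           ≡⟨ ≡.cong fromℤ (≡.sym (ℤ.neg-distribʳ-* (+ m) (+ suc n))) ⟩
    fromℤ (ℤ.- (+ m ℤ.* + suc n))      ≈⟨ fromℤ-neg (+ m ℤ.* + suc n) ⟩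
    - fromℤ (+ m ℤ.* + suc n)          ≈⟨ -‿cong (fromℤ-* (+ m) (+ suc n)) ⟩
    - (fromℕ m * fromℕ (suc n))        ≈⟨ -‿distribʳ-* _ _ ⟩
    fromℕ m * - fromℕ (suc n)          ∎
  fromℤ-* -[1+ m ] (+ n)    = begin
    fromℤ (-[1+ m ] ℤ.* + n)           ≡⟨ ≡.cong fromℤ (≡.sym (ℤ.neg-distribˡ-* (+ suc m) (+ n))) ⟩
    fromℤ (ℤ.- (+ suc m ℤ.* + n))      ≈⟨ fromℤ-neg (+ suc m ℤ.* + n) ⟩
    - fromℤ (+ suc m ℤ.* + n)          ≈⟨ -‿cong (fromℤ-* (+ suc m) (+ n)) ⟩
    - (fromℕ (suc m) * fromℕ n)        ≈⟨ -‿distribˡ-* _ _ ⟩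
    - fromℕ (suc m) * fromℕ n          ∎
  fromℤ-* -[1+ m ] -[1+ n ] = begin
    fromℕ (suc m ℕ.* suc n)                ≈⟨ fromℕ-* (suc m) (suc n) ⟩
    fromℕ (suc m) * fromℕ (suc n)          ≈⟨ sym (-‿involutive _) ⟩
    - - (fromℕ (suc m) * fromℕ (suc n))    ≈⟨ -‿cong (-‿distribʳ-* _ _) ⟩
    - (fromℕ (suc m) * - fromℕ (suc n))    ≈⟨ -‿distribˡ-* _ _ ⟩
    - fromℕ (suc m) * - fromℕ (suc n)      ∎

  -- Integer coefficients have decidable equality, so like terms can be collected even in an
  -- abstract ring.
  morphism : ℤ.+-*-rawRing -Raw-AlmostCommutative⟶ fromCommutativeRing R
  morphism = record
    { ⟦_⟧    = fromℤ
    ; +-homo = fromℤ-+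
    ; *-homo = fromℤ-*
    ; -‿homo = fromℤ-neg
    ; 0-homo = refl
    ; 1-homo = refl
    }

  _≟c_ : ∀ i j → Maybe (fromℤ i ≈ fromℤ j)
  i ≟c j with i ℤ.≟ j
  ... | yes i≡j = just (reflexive (≡.cong fromℤ i≡j))
  ... | no  _   = nothing

  module S = Algebra.Solver.Ring ℤ.+-*-rawRing (fromCommutativeRing R) morphism _≟c_
  open S public using (Polynomial; var; con; _:+_; _:*_; _:-_; :-_; _:^_; _:=_; solve)

  -- Comparing normal forms before evaluation is far cheaper than `solve` on large identities.
  byNormalForm : ∀ {n} (l r : Polynomial n) (ρ : Vec Carrier n) → S.normalise l ≡ S.normalise r →
                 S.⟦ l ⟧ ρ ≈ S.⟦ r ⟧ ρ
  byNormalForm l r ρ eq = trans (sym (S.correct l ρ))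
    (trans (reflexive (≡.cong (λ p → S.⟦ p ⟧N ρ) eq)) (S.correct r ρ))

-- q-shifted products and the telescoping relation

triangle : ℕ → ℕ
triangle zero    = 0
triangle (suc k) = triangle k ℕ.+ suc k

module QSeries {c ℓ} (K : CommutativeRing c ℓ) where
  open CommutativeRing K hiding (zero)
  open Relation.Binary.Reasoning.Setoid setoid

  -- With f = `o` this is (q^a;q^b)_k; with f = `io` it is the reciprocal, provided that no exponent
  -- is 0.
  Π : (ℤ → Carrier) → ℤ → ℤ → ℕ → Carrier
  Π f a b zero    = 1#
  Π f a b (suc k) = Π f a b k * f (a ℤ.+ b ℤ.* + k)

  Σ : (ℕ → Carrier) → ℕ → Carrier
  Σ f zero    = 0#
  Σ f (suc k) = Σ f k + f k

  Π-base : ∀ f {a a′} → a ≡ a′ → ∀ b k → Π f a b k ≈ Π f a′ b k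
  Π-base f ≡.refl b k = refl

  Π-head : ∀ f a b k → Π f a b (suc k) ≈ f a * Π f (a ℤ.+ b) b k
  Π-head f a b zero = begin
    1# * f (a ℤ.+ b ℤ.* + 0)   ≡⟨ ≡.cong (λ e → 1# * f e) (lem a b) ⟩
    1# * f a                   ≈⟨ *-comm _ _ ⟩
    f a * 1#                   ∎
    where
    lem : ∀ a b → a ℤ.+ b ℤ.* + 0 ≡ a
    lem = solve-∀
  Π-head f a b (suc k) = begin
    Π f a b (suc k) * f (a ℤ.+ b ℤ.* + suc k)              ≈⟨ *-congʳ (Π-head f a b k) ⟩
    f a * Π f (a ℤ.+ b) b k * f (a ℤ.+ b ℤ.* + suc k)      ≡⟨ ≡.cong (λ e → f a * Π f (a ℤ.+ b) b k * f e) (lem a b (+ k)) ⟩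
    f a * Π f (a ℤ.+ b) b k * f (a ℤ.+ b ℤ.+ b ℤ.* + k)    ≈⟨ *-assoc _ _ _ ⟩
    f a * Π f (a ℤ.+ b) b (suc k)                          ∎
    where
    lem : ∀ a b k → a ℤ.+ b ℤ.* (+ 1 ℤ.+ k) ≡ a ℤ.+ b ℤ.+ b ℤ.* k
    lem = solve-∀

  Π-head₂ : ∀ f a b k → Π f a b (suc (suc k)) ≈ f a * f (a ℤ.+ b) * Π f (a ℤ.+ b ℤ.+ b) b k
  Π-head₂ f a b k = begin
    Π f a b (suc (suc k))                          ≈⟨ Π-head f a b (suc k) ⟩
    f a * Π f (a ℤ.+ b) b (suc k)                  ≈⟨ *-congˡ (Π-head f (a ℤ.+ b) b k) ⟩
    f a * (f (a ℤ.+ b) * Π f (a ℤ.+ b ℤ.+ b) b k)  ≈⟨ *-assoc _ _ _ ⟨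
    f a * f (a ℤ.+ b) * Π f (a ℤ.+ b ℤ.+ b) b k    ∎

  Π-+ : ∀ f a b j k → Π f a b (j ℕ.+ k) ≈ Π f a b j * Π f (a ℤ.+ b ℤ.* + j) b k
  Π-+ f a b zero    k = trans (Π-base f (lem a b) b k) (sym (*-identityˡ _))
    where
    lem : ∀ a b → a ≡ a ℤ.+ b ℤ.* + 0
    lem = solve-∀
  Π-+ f a b (suc j) k = begin
    Π f a b (suc (j ℕ.+ k))                                                   ≡⟨ ≡.cong (Π f a b) (≡.sym (ℕ.+-suc j k)) ⟩
    Π f a b (j ℕ.+ suc k)                                                     ≈⟨ Π-+ f a b j (suc k) ⟩
    Π f a b j * Π f (a ℤ.+ b ℤ.* + j) b (suc k)                               ≈⟨ *-congˡ (Π-head f (a ℤ.+ b ℤ.* + j) b k) ⟩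
    Π f a b j * (f (a ℤ.+ b ℤ.* + j) * Π f (a ℤ.+ b ℤ.* + j ℤ.+ b) b k)       ≈⟨ *-assoc _ _ _ ⟨
    Π f a b (suc j) * Π f (a ℤ.+ b ℤ.* + j ℤ.+ b) b k                         ≈⟨ *-congˡ (Π-base f (lem a b (+ j)) b k) ⟩
    Π f a b (suc j) * Π f (a ℤ.+ b ℤ.* + suc j) b k                           ∎
    where
    lem : ∀ a b j → a ℤ.+ b ℤ.* j ℤ.+ b ≡ a ℤ.+ b ℤ.* (+ 1 ℤ.+ j)
    lem = solve-∀

-- Integer powers E e of q, and the inverses io e of 1 - q^e for e ≠ 0.
record PowersOfQ {c ℓ} (K : CommutativeRing c ℓ) : Set (c Level.⊔ ℓ) where
  open CommutativeRing K
  field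
    E    : ℤ → Carrier
    E-0  : E (+ 0) ≈ 1#
    E-+  : ∀ i j → E (i ℤ.+ j) ≈ E i * E j
    io   : ℤ → Carrier
    o-io : ∀ e → e ≢ + 0 → (1# - E e) * io e ≈ 1#

  o : ℤ → Carrier
  o e = 1# - E e

-- With x = E c and Q = E D, U c k is the k-th summand at base point x; the theorem has x = q, and
-- its summand is U (+ 1) k / (1 - q).
module Telescope {c ℓ} (K : CommutativeRing c ℓ) (𝒬 : PowersOfQ K) (D : ℤ) (D≢0 : ∀ k → D ℤ.* + suc k ≢ + 0) where
  open CommutativeRing K hiding (zero)
  open PowersOfQ 𝒬
  open Relation.Binary.Reasoning.Setoid setoid
  open QSeries K
  open IntegerSolver K

  2D : ℤ
  2D = + 2 ℤ.* D

  o-cong : ∀ {e e′} → e ≡ e′ → o e ≈ o e′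
  o-cong ≡.refl = refl

  o0 : o (+ 0) ≈ 0#
  o0 = trans (+-congˡ (-‿cong E-0)) (-‿inverseʳ 1#)

  o-neg : ∀ e → E e * o (ℤ.- e) ≈ - o e
  o-neg e = begin
    E e * (1# - E (ℤ.- e))        ≈⟨ solve 2 (λ a b → a :* (con (+ 1) :- b) := a :- a :* b) refl (E e) (E (ℤ.- e)) ⟩
    E e - E e * E (ℤ.- e)         ≈⟨ +-congˡ (-‿cong (E-+ e (ℤ.- e))) ⟨
    E e - E (e ℤ.+ ℤ.- e)         ≡⟨ ≡.cong (λ i → E e - E i) (ℤ.+-inverseʳ e) ⟩
    E e - E (+ 0)                 ≈⟨ +-congˡ (-‿cong E-0) ⟩
    E e - 1#                      ≈⟨ solve 1 (λ a → a :- con (+ 1) := :- (con (+ 1) :- a)) refl (E e) ⟩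
    - o e                         ∎

  U : ℤ → ℕ → Carrier
  U c k = o (c ℤ.+ + 3 ℤ.* D ℤ.* + k)
        * (Π o c D k * Π o c D k * Π o (D ℤ.- c) D k * Π o c 2D k)
        * E (D ℤ.* + triangle k)
        * (Π io 2D 2D k * Π io 2D 2D k * Π io (+ 2 ℤ.* c ℤ.+ D) 2D k * Π io D D k)

  r : ℤ → Carrier
  r c = - E c * (o (c ℤ.+ D) * o (c ℤ.+ D))
        * (io (+ 2 ℤ.* c ℤ.+ D) * io (+ 2 ℤ.* c ℤ.+ D ℤ.+ 2D))

  -- The part common to `U` at x and at xQ²: each is `B` times a fixed number of factors, once
  -- factors depending on x and Q alone are cleared. The base point xQ² turns (Q/x;Q)_k into
  -- (1/(xQ);Q)_k, and (x²Q;Q²)_{k+2} is a multiple of both denominators.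
  B : ℤ → ℕ → Carrier
  B c k = Π o c D k * Π o c D k * Π o (ℤ.- c ℤ.- D) D k * Π o c 2D k
        * E (D ℤ.* + triangle k)
        * (Π io 2D 2D k * Π io 2D 2D k * Π io (+ 2 ℤ.* c ℤ.+ D) 2D (suc (suc k)) * Π io D D k)

  -- The quadratic (in X = Q^k) polynomial part of the Gosper certificate.
  cert : ∀ {n} → Polynomial n → Polynomial n → Polynomial n → Polynomial n
  cert x Q X = (x :* Q :- con (+ 1)) :- x :* Q :* (con (+ 1) :- x) :* (con (+ 1) :- x)
    :- (con (+ 1) :+ Q) :* x :* x :* (x :* Q :- con (+ 1)) :* X
    :+ (x :* x :* Q :* (con (+ 1) :- x) :* (con (+ 1) :- x)
        :+ x :* x :* x :* x :* Q :* (x :* Q :- con (+ 1))) :* X :* X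

  P : Carrier → Carrier → Carrier → Carrier
  P x Q X = S.⟦ cert (var (# 0)) (var (# 1)) (var (# 2)) ⟧ (x ∷ Q ∷ X ∷ [])

  P-cong : ∀ {x Q X X′} → X ≈ X′ → P x Q X ≈ P x Q X′
  P-cong X≈X′ = +-cong (+-congˡ (-‿cong (*-congˡ X≈X′))) (*-cong (*-congˡ X≈X′) X≈X′)

  -- The `o` factors are the last factors of the denominators of `B c k`. They cancel in `G-suc`,
  -- and 1 - Q^k makes `G` vanish at k = 0.
  G : ℤ → ℕ → Carrier
  G c k = B c k * (o (+ 2 ℤ.* c ℤ.+ D ℤ.+ 2D ℤ.* + suc k)
                   * (o (2D ℤ.* + k) * o (2D ℤ.* + k)) * o (D ℤ.* + k))
          * P (E c) (E D) (E (D ℤ.* + k))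

  G-0 : ∀ c → G c 0 ≈ 0#
  G-0 c = begin
    B c 0 * (w * (v * v) * o (D ℤ.* + 0)) * p  ≈⟨ *-congʳ (*-congˡ (*-congˡ (trans (o-cong (ℤ.*-zeroʳ D)) o0))) ⟩
    B c 0 * (w * (v * v) * 0#) * p             ≈⟨ solve 4 (λ b w v p → b :* (w :* (v :* v) :* con (+ 0)) :* p := con (+ 0)) refl (B c 0) w v p ⟩
    0#                                         ∎
    where
    w = o (+ 2 ℤ.* c ℤ.+ D ℤ.+ 2D ℤ.* + 1)
    v = o (2D ℤ.* + 0)
    p = P (E c) (E D) (E (D ℤ.* + 0))

  2D≢0 : ∀ k → 2D ℤ.* + suc k ≢ + 0
  2D≢0 k eq with ℤ.i*j≡0⇒i≡0∨j≡0 (+ 2) (≡.trans (≡.sym (ℤ.*-assoc (+ 2) D (+ suc k))) eq)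
  ... | inj₂ p = D≢0 k p

  module _ (c : ℤ) (pole : ∀ l → + 2 ℤ.* c ℤ.+ D ℤ.+ 2D ℤ.* + l ≢ + 0) (k : ℕ) where
    private
      x Q Y X : Carrier
      x = E c
      Q = E D
      -- X = Q^k is written as x Q Y so that 1 - X/x and 1 - X/(xQ) become polynomials.
      Y = E (ℤ.- c ℤ.- D ℤ.+ D ℤ.* + k)
      X = E (D ℤ.* + k)
      p₁ p₂ p₂′ p₃ e a b b′ f : Carrier
      p₁ = Π o c D k
      p₂ = Π o (D ℤ.- c) D k
      p₂′ = Π o (ℤ.- c ℤ.- D) D k
      p₃ = Π o c 2D k
      e = E (D ℤ.* + triangle k)
      a = Π io 2D 2D k
      b = Π io (+ 2 ℤ.* c ℤ.+ D) 2D k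
      b′ = Π io (+ 2 ℤ.* c ℤ.+ D) 2D (suc (suc k))
      f = Π io D D k
      o₀ o₁ g h : Carrier
      o₀ = o (c ℤ.+ + 3 ℤ.* D ℤ.* + k)
      o₁ = o (c ℤ.+ 2D ℤ.+ + 3 ℤ.* D ℤ.* + k)
      g = o (+ 2 ℤ.* c ℤ.+ D ℤ.+ 2D ℤ.* + k)
      h = o (+ 2 ℤ.* c ℤ.+ D ℤ.+ 2D ℤ.* + suc k)
      s₁ s₂ u v : Carrier
      s₁ = o (ℤ.- c ℤ.- D)
      s₂ = o (ℤ.- c)
      u = o (ℤ.- c ℤ.- D ℤ.+ D ℤ.* + k)
      v = o (ℤ.- c ℤ.- D ℤ.+ D ℤ.* + suc k)
      w₁ w₂ w₃ : Carrier
      w₁ = o (c ℤ.+ D ℤ.* + k)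
      w₂ = o (c ℤ.+ D ℤ.* + suc k)
      w₃ = o (c ℤ.+ 2D ℤ.* + k)

    -- (1 - 1/(xQ))(1 - 1/x) completes (Q/x;Q)_k to (1/(xQ);Q)_{k+2}, whose first k factors belong
    -- to `B`.
    U-via-B : U c k * (s₁ * s₂) ≈ B c k * (o₀ * (u * v) * (g * h))
    U-via-B = begin
      o₀ * (p₁ * p₁ * p₂ * p₃) * e * (a * a * b * f) * (s₁ * s₂)
        ≈⟨ *-congʳ (*-congˡ (*-congʳ (*-congˡ b≈))) ⟩
      o₀ * (p₁ * p₁ * p₂ * p₃) * e * (a * a * (b′ * (g * h)) * f) * (s₁ * s₂)
        ≈⟨ solve 10 (λ o₀ p₁ p₂ p₃ e a b f s₁ s₂ → o₀ :* (p₁ :* p₁ :* p₂ :* p₃) :* e :* (a :* a :* b :* f) :* (s₁ :* s₂)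
             := p₁ :* p₁ :* (s₁ :* s₂ :* p₂) :* p₃ :* e :* (a :* a :* b :* f) :* o₀)
             refl o₀ p₁ p₂ p₃ e a (b′ * (g * h)) f s₁ s₂ ⟩
      p₁ * p₁ * (s₁ * s₂ * p₂) * p₃ * e * (a * a * (b′ * (g * h)) * f) * o₀
        ≈⟨ *-congʳ (*-congʳ (*-congʳ (*-congʳ (*-congˡ p₂≈)))) ⟩
      p₁ * p₁ * (p₂′ * u * v) * p₃ * e * (a * a * (b′ * (g * h)) * f) * o₀
        ≈⟨ solve 12 (λ o₀ p₁ p₂ p₃ e a b f u v g h → p₁ :* p₁ :* (p₂ :* u :* v) :* p₃ :* e :* (a :* a :* (b :* (g :* h)) :* f) :* o₀
             := p₁ :* p₁ :* p₂ :* p₃ :* e :* (a :* a :* b :* f) :* (o₀ :* (u :* v) :* (g :* h)))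
             refl o₀ p₁ p₂′ p₃ e a b′ f u v g h ⟩
      B c k * (o₀ * (u * v) * (g * h)) ∎
      where
      b≈ : b ≈ b′ * (g * h)
      b≈ = begin
        b              ≈⟨ *-identityʳ b ⟨
        b * 1#         ≈⟨ *-congˡ (*-identityʳ 1#) ⟨
        b * (1# * 1#)  ≈⟨ *-congˡ (*-cong (o-io _ (pole k)) (o-io _ (pole (suc k)))) ⟨
        b * (g * ig * (h * ih))  ≈⟨ solve 5 (λ b g i h j → b :* (g :* i :* (h :* j)) := b :* i :* j :* (g :* h)) refl b g ig h ih ⟩
        b′ * (g * h)   ∎
        where
        ig = io (+ 2 ℤ.* c ℤ.+ D ℤ.+ 2D ℤ.* + k)
        ih = io (+ 2 ℤ.* c ℤ.+ D ℤ.+ 2D ℤ.* + suc k)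
      lem₁ : ∀ c D → ℤ.- c ≡ ℤ.- c ℤ.- D ℤ.+ D
      lem₁ = solve-∀
      lem₂ : ∀ c D → D ℤ.- c ≡ ℤ.- c ℤ.- D ℤ.+ D ℤ.+ D
      lem₂ = solve-∀
      p₂≈ : s₁ * s₂ * p₂ ≈ p₂′ * u * v
      p₂≈ = begin
        s₁ * s₂ * p₂ ≈⟨ *-cong (*-congˡ (o-cong (lem₁ c D))) (Π-base o (lem₂ c D) D k) ⟩
        s₁ * o (ℤ.- c ℤ.- D ℤ.+ D) * Π o (ℤ.- c ℤ.- D ℤ.+ D ℤ.+ D) D k ≈⟨ Π-head₂ o (ℤ.- c ℤ.- D) D k ⟨
        p₂′ * u * v ∎

    -- The cube of 1 - x extends (xQ²;Q)_k, twice, and (xQ²;Q²)_k, once, back to products starting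
    -- at x. The factors 1 - xQ and the two denominators still missing are those of `r`.
    rU-via-B : r c * U (c ℤ.+ 2D) k * (o c * o c * o c)
             ≈ - x * (B c k * (o₁ * (w₁ * w₂ * (w₁ * w₂)) * w₃))
    rU-via-B = begin
      - x * (y * y) * (i₁ * i₂) * (o₁ * (π₁ * π₁ * π₂ * π₃) * e * (a * a * β * f)) * (z * z * z)
        ≈⟨ solve 13 (λ x y i₁ i₂ o₁ π₁ π₂ π₃ e a β f z →
              :- x :* (y :* y) :* (i₁ :* i₂) :* (o₁ :* (π₁ :* π₁ :* π₂ :* π₃) :* e :* (a :* a :* β :* f)) :* (z :* z :* z)
              := :- x :* (o₁ :* ((z :* y :* π₁) :* (z :* y :* π₁) :* π₂ :* (z :* π₃)) :* e :* (a :* a :* (i₁ :* i₂ :* β) :* f)))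
              refl x y i₁ i₂ o₁ π₁ π₂ π₃ e a β f z ⟩
      - x * (o₁ * ((z * y * π₁) * (z * y * π₁) * π₂ * (z * π₃)) * e * (a * a * (i₁ * i₂ * β) * f))
        ≈⟨ *-congˡ (*-cong (*-congʳ (*-congˡ (*-cong (*-cong (*-cong π₁≈ π₁≈) (Π-base o (lem₁ c D) D k)) π₃≈))) (*-congʳ (*-congˡ β≈))) ⟩
      - x * (o₁ * ((p₁ * w₁ * w₂) * (p₁ * w₁ * w₂) * p₂′ * (p₃ * w₃)) * e * (a * a * b′ * f))
        ≈⟨ solve 12 (λ x o₁ p₁ w₁ w₂ p₂ p₃ w₃ e a b f →
              :- x :* (o₁ :* ((p₁ :* w₁ :* w₂) :* (p₁ :* w₁ :* w₂) :* p₂ :* (p₃ :* w₃)) :* e :* (a :* a :* b :* f))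
              := :- x :* (p₁ :* p₁ :* p₂ :* p₃ :* e :* (a :* a :* b :* f) :* (o₁ :* (w₁ :* w₂ :* (w₁ :* w₂)) :* w₃)))
              refl x o₁ p₁ w₁ w₂ p₂′ p₃ w₃ e a b′ f ⟩
      - x * (B c k * (o₁ * (w₁ * w₂ * (w₁ * w₂)) * w₃)) ∎
      where
      z = o c
      y = o (c ℤ.+ D)
      i₁ = io (+ 2 ℤ.* c ℤ.+ D)
      i₂ = io (+ 2 ℤ.* c ℤ.+ D ℤ.+ 2D)
      π₁ = Π o (c ℤ.+ 2D) D k
      π₂ = Π o (D ℤ.- (c ℤ.+ 2D)) D k
      π₃ = Π o (c ℤ.+ 2D) 2D k
      β = Π io (+ 2 ℤ.* (c ℤ.+ 2D) ℤ.+ D) 2D k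
      lem₁ : ∀ c D → D ℤ.- (c ℤ.+ + 2 ℤ.* D) ≡ ℤ.- c ℤ.- D
      lem₁ = solve-∀
      lem₂ : ∀ c D → c ℤ.+ + 2 ℤ.* D ≡ c ℤ.+ D ℤ.+ D
      lem₂ = solve-∀
      lem₃ : ∀ c D → + 2 ℤ.* (c ℤ.+ + 2 ℤ.* D) ℤ.+ D ≡ + 2 ℤ.* c ℤ.+ D ℤ.+ + 2 ℤ.* D ℤ.+ + 2 ℤ.* D
      lem₃ = solve-∀
      π₁≈ : z * y * π₁ ≈ p₁ * w₁ * w₂
      π₁≈ = trans (*-congˡ (Π-base o (lem₂ c D) D k)) (sym (Π-head₂ o c D k))
      π₃≈ : z * π₃ ≈ p₃ * w₃
      π₃≈ = sym (Π-head o c 2D k)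
      β≈ : i₁ * i₂ * β ≈ b′
      β≈ = trans (*-congˡ (Π-base io (lem₃ c D) 2D k)) (sym (Π-head₂ io (+ 2 ℤ.* c ℤ.+ D) 2D k))

    G-suc : G c (suc k) ≈ B c k * (w₁ * w₁ * u * w₃) * E (D ℤ.* + suc k) * P x Q (E (D ℤ.* + suc k))
    G-suc = *-congʳ (begin
      p₁ * w₁ * (p₁ * w₁) * (p₂′ * u) * (p₃ * w₃) * E (D ℤ.* + (triangle k ℕ.+ suc k))
        * (a * ia * (a * ia) * (b′ * ih) * (f * jf)) * (h′ * (oa * oa) * of)
        ≈⟨ *-cong (*-cong (*-congˡ e≈) (*-congʳ (*-congʳ (*-cong (*-congˡ (reflexive (≡.cong io (lem₂ D (+ k))))) (*-congˡ (reflexive (≡.cong io (lem₂ D (+ k))))))))) refl ⟩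
      p₁ * w₁ * (p₁ * w₁) * (p₂′ * u) * (p₃ * w₃) * (e * E (D ℤ.* + suc k))
        * (a * ia′ * (a * ia′) * (b′ * ih) * (f * jf)) * (h′ * (oa * oa) * of)
        ≈⟨ solve 16 (λ p₁ w₁ p₂ u p₃ w₃ e e′ a ia b ih f jf oa of →
              p₁ :* w₁ :* (p₁ :* w₁) :* (p₂ :* u) :* (p₃ :* w₃) :* (e :* e′) :* (a :* ia :* (a :* ia) :* (b :* ih) :* (f :* jf)) :* (oa :* of)
              := p₁ :* p₁ :* p₂ :* p₃ :* e :* (a :* a :* b :* f) :* (w₁ :* w₁ :* u :* w₃) :* e′ :* (ih :* oa :* (ia :* ia) :* (jf :* of)))
              refl p₁ w₁ p₂′ u p₃ w₃ e (E (D ℤ.* + suc k)) a ia′ b′ ih f jf (h′ * (oa * oa)) of ⟩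
      bw * (ih * (h′ * (oa * oa)) * (ia′ * ia′) * (jf * of))
        ≈⟨ *-congˡ (solve 6 (λ ih h oa ia jf of → ih :* (h :* (oa :* oa)) :* (ia :* ia) :* (jf :* of)
              := h :* ih :* (oa :* ia :* (oa :* ia)) :* (of :* jf)) refl ih h′ oa ia′ jf of) ⟩
      bw * (h′ * ih * (oa * ia′ * (oa * ia′)) * (of * jf))
        ≈⟨ *-congˡ (*-cong (*-cong (o-io _ (pole (suc (suc k)))) (*-cong (o-io _ (2D≢0 k)) (o-io _ (2D≢0 k)))) of≈) ⟩
      bw * (1# * (1# * 1#) * 1#)
        ≈⟨ solve 1 (λ b → b :* (con (+ 1) :* (con (+ 1) :* con (+ 1)) :* con (+ 1)) := b) refl bw ⟩
      bw ∎)
      where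
      ia = io (2D ℤ.+ 2D ℤ.* + k)
      ia′ = io (2D ℤ.* + suc k)
      ih = io (+ 2 ℤ.* c ℤ.+ D ℤ.+ 2D ℤ.* + suc (suc k))
      jf = io (D ℤ.+ D ℤ.* + k)
      h′ = o (+ 2 ℤ.* c ℤ.+ D ℤ.+ 2D ℤ.* + suc (suc k))
      oa = o (2D ℤ.* + suc k)
      of = o (D ℤ.* + suc k)
      bw = B c k * (w₁ * w₁ * u * w₃) * E (D ℤ.* + suc k)
      lem₁ : ∀ D k → D ℤ.+ D ℤ.* k ≡ D ℤ.* (+ 1 ℤ.+ k)
      lem₁ = solve-∀
      lem₂ : ∀ D k → + 2 ℤ.* D ℤ.+ + 2 ℤ.* D ℤ.* k ≡ + 2 ℤ.* D ℤ.* (+ 1 ℤ.+ k)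
      lem₂ = solve-∀
      of≈ : of * jf ≈ 1#
      of≈ = trans (*-congˡ (reflexive (≡.cong io (lem₁ D (+ k))))) (o-io _ (D≢0 k))
      e≈ : E (D ℤ.* + (triangle k ℕ.+ suc k)) ≈ e * E (D ℤ.* + suc k)
      e≈ = trans (reflexive (≡.cong E (≡.trans (≡.cong (D ℤ.*_) (ℤ.pos-+ (triangle k) (suc k))) (ℤ.*-distribˡ-+ D (+ triangle k) (+ suc k))))) (E-+ _ _)

    private
      mono : ℕ → ℕ → ℕ → ℤ
      mono i j l = + i ℤ.* c ℤ.+ + j ℤ.* D ℤ.+ + l ℤ.* (ℤ.- c ℤ.- D ℤ.+ D ℤ.* + k)

      open import Algebra.Properties.Semiring.Exp semiring using (_^_)

      E-pow : ∀ i e → E (+ i ℤ.* e) ≈ E e ^ i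
      E-pow zero    e = E-0
      E-pow (suc i) e = trans (reflexive (≡.cong E (lem (+ i) e))) (trans (E-+ e (+ i ℤ.* e)) (*-congˡ (E-pow i e)))
        where
        lem : ∀ i e → (+ 1 ℤ.+ i) ℤ.* e ≡ e ℤ.+ i ℤ.* e
        lem = solve-∀

      E-mono : ∀ i j l {e} → e ≡ mono i j l → E e ≈ x ^ i * Q ^ j * Y ^ l
      E-mono i j l ≡.refl = trans (E-+ _ _) (*-cong (trans (E-+ _ _) (*-cong (E-pow i c) (E-pow j D))) (E-pow l _))

      o-mono : ∀ i j l {e} → e ≡ mono i j l → o e ≈ 1# - x ^ i * Q ^ j * Y ^ l
      o-mono i j l eq = +-congˡ (-‿cong (E-mono i j l eq))

    -- The telescoping relation with `B c k` divided out. All exponents are integer combinations of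
    -- c, D and the exponent of Y, so it is a polynomial identity in x, Q and Y.
    certificate : x * Q * (o c * o c) * (o₀ * (u * v) * (g * h)) + o (c ℤ.+ D) * (o₁ * (w₁ * w₂ * (w₁ * w₂)) * w₃)
                ≈ w₁ * w₁ * u * w₃ * E (D ℤ.* + suc k) * P x Q (E (D ℤ.* + suc k))
                  - h * (o (2D ℤ.* + k) * o (2D ℤ.* + k)) * o (D ℤ.* + k) * P x Q X
    certificate = begin
      x * Q * (o c * o c) * (o₀ * (u * v) * (g * h)) + o (c ℤ.+ D) * (o₁ * (w₁ * w₂ * (w₁ * w₂)) * w₃)
        ≈⟨ +-cong (*-congˡ (*-cong (*-cong o₀≈ (*-congˡ v≈)) (*-cong g≈ h≈)))
                  (*-cong cD≈ (*-cong (*-cong o₁≈ (*-cong (*-cong w₁≈ w₂≈) (*-cong w₁≈ w₂≈))) w₃≈)) ⟩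
      S.⟦ L ⟧ ρ ≈⟨ byNormalForm L R ρ ≡.refl ⟩
      S.⟦ R ⟧ ρ
        ≈⟨ +-cong (*-cong (*-cong (*-cong (*-congʳ (*-cong w₁≈ w₁≈)) w₃≈) QX≈) (P-cong QX≈))
                  (-‿cong (*-cong (*-cong (*-cong h≈ (*-cong X²≈ X²≈)) oX≈) (P-cong X≈))) ⟨
      w₁ * w₁ * u * w₃ * E (D ℤ.* + suc k) * P x Q (E (D ℤ.* + suc k))
        - h * (o (2D ℤ.* + k) * o (2D ℤ.* + k)) * o (D ℤ.* + k) * P x Q X ∎
      where
      ρ : Vec Carrier 3
      ρ = x ∷ Q ∷ Y ∷ []
      :x :Q :Y :X :QX : Polynomial 3
      :x = var (# 0)
      :Q = var (# 1)
      :Y = var (# 2)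
      :m :o : ℕ → ℕ → ℕ → Polynomial 3
      :m i j l = :x :^ i :* :Q :^ j :* :Y :^ l
      :o i j l = con (+ 1) :- :m i j l
      :X = :m 1 1 1
      :QX = :m 1 2 1
      :1-x = con (+ 1) :- :x
      L R : Polynomial 3
      L = :x :* :Q :* (:1-x :* :1-x) :* (:o 4 3 3 :* ((con (+ 1) :- :Y) :* :o 0 1 1) :* (:o 4 3 2 :* :o 4 5 2))
          :+ :o 1 1 0 :* (:o 4 5 3 :* (:o 2 1 1 :* :o 2 2 1 :* (:o 2 1 1 :* :o 2 2 1)) :* :o 3 2 2)
      R = :o 2 1 1 :* :o 2 1 1 :* (con (+ 1) :- :Y) :* :o 3 2 2 :* :QX :* cert :x :Q :QX
          :- :o 4 5 2 :* (:o 2 2 2 :* :o 2 2 2) :* :o 1 1 1 :* cert :x :Q :X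
      e₀ : ∀ c D k → c ℤ.+ + 3 ℤ.* D ℤ.* k ≡ + 4 ℤ.* c ℤ.+ + 3 ℤ.* D ℤ.+ + 3 ℤ.* (ℤ.- c ℤ.- D ℤ.+ D ℤ.* k)
      e₀ = solve-∀
      e₁ : ∀ c D k → c ℤ.+ + 2 ℤ.* D ℤ.+ + 3 ℤ.* D ℤ.* k ≡ + 4 ℤ.* c ℤ.+ + 5 ℤ.* D ℤ.+ + 3 ℤ.* (ℤ.- c ℤ.- D ℤ.+ D ℤ.* k)
      e₁ = solve-∀
      e₂ : ∀ c D k → ℤ.- c ℤ.- D ℤ.+ D ℤ.* (+ 1 ℤ.+ k) ≡ + 0 ℤ.* c ℤ.+ + 1 ℤ.* D ℤ.+ + 1 ℤ.* (ℤ.- c ℤ.- D ℤ.+ D ℤ.* k)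
      e₂ = solve-∀
      e₃ : ∀ c D k → + 2 ℤ.* c ℤ.+ D ℤ.+ + 2 ℤ.* D ℤ.* k ≡ + 4 ℤ.* c ℤ.+ + 3 ℤ.* D ℤ.+ + 2 ℤ.* (ℤ.- c ℤ.- D ℤ.+ D ℤ.* k)
      e₃ = solve-∀
      e₄ : ∀ c D k → + 2 ℤ.* c ℤ.+ D ℤ.+ + 2 ℤ.* D ℤ.* (+ 1 ℤ.+ k) ≡ + 4 ℤ.* c ℤ.+ + 5 ℤ.* D ℤ.+ + 2 ℤ.* (ℤ.- c ℤ.- D ℤ.+ D ℤ.* k)
      e₄ = solve-∀
      e₅ : ∀ c D k → c ℤ.+ D ≡ + 1 ℤ.* c ℤ.+ + 1 ℤ.* D ℤ.+ + 0 ℤ.* (ℤ.- c ℤ.- D ℤ.+ D ℤ.* k)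
      e₅ = solve-∀
      e₆ : ∀ c D k → c ℤ.+ D ℤ.* k ≡ + 2 ℤ.* c ℤ.+ + 1 ℤ.* D ℤ.+ + 1 ℤ.* (ℤ.- c ℤ.- D ℤ.+ D ℤ.* k)
      e₆ = solve-∀
      e₇ : ∀ c D k → c ℤ.+ D ℤ.* (+ 1 ℤ.+ k) ≡ + 2 ℤ.* c ℤ.+ + 2 ℤ.* D ℤ.+ + 1 ℤ.* (ℤ.- c ℤ.- D ℤ.+ D ℤ.* k)
      e₇ = solve-∀
      e₈ : ∀ c D k → c ℤ.+ + 2 ℤ.* D ℤ.* k ≡ + 3 ℤ.* c ℤ.+ + 2 ℤ.* D ℤ.+ + 2 ℤ.* (ℤ.- c ℤ.- D ℤ.+ D ℤ.* k)
      e₈ = solve-∀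
      e₉ : ∀ c D k → + 2 ℤ.* D ℤ.* k ≡ + 2 ℤ.* c ℤ.+ + 2 ℤ.* D ℤ.+ + 2 ℤ.* (ℤ.- c ℤ.- D ℤ.+ D ℤ.* k)
      e₉ = solve-∀
      eX : ∀ c D k → D ℤ.* k ≡ + 1 ℤ.* c ℤ.+ + 1 ℤ.* D ℤ.+ + 1 ℤ.* (ℤ.- c ℤ.- D ℤ.+ D ℤ.* k)
      eX = solve-∀
      eQX : ∀ c D k → D ℤ.* (+ 1 ℤ.+ k) ≡ + 1 ℤ.* c ℤ.+ + 2 ℤ.* D ℤ.+ + 1 ℤ.* (ℤ.- c ℤ.- D ℤ.+ D ℤ.* k)
      eQX = solve-∀
      o₀≈ = o-mono 4 3 3 (e₀ c D (+ k))
      o₁≈ = o-mono 4 5 3 (e₁ c D (+ k))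
      v≈ = o-mono 0 1 1 (e₂ c D (+ k))
      g≈ = o-mono 4 3 2 (e₃ c D (+ k))
      h≈ = o-mono 4 5 2 (e₄ c D (+ k))
      cD≈ = o-mono 1 1 0 (e₅ c D (+ k))
      w₁≈ = o-mono 2 1 1 (e₆ c D (+ k))
      w₂≈ = o-mono 2 2 1 (e₇ c D (+ k))
      w₃≈ = o-mono 3 2 2 (e₈ c D (+ k))
      X²≈ = o-mono 2 2 2 (e₉ c D (+ k))
      oX≈ = o-mono 1 1 1 (eX c D (+ k))
      X≈ = E-mono 1 1 1 (eX c D (+ k))
      QX≈ = E-mono 1 2 1 (eQX c D (+ k))

  -- Equal to (1 - x)⁴ (1 - xQ) / x: the factors that clear both summands in `U-via-B` and
  -- `rU-via-B`. It is a unit at the base points where the relation is applied; see `κ-cancel`.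
  κ : ℤ → Carrier
  κ c = E (c ℤ.+ D) * o (ℤ.- c ℤ.- D) * o (ℤ.- c) * (o c * o c * o c)

  telescope : ∀ c (pole : ∀ l → + 2 ℤ.* c ℤ.+ D ℤ.+ 2D ℤ.* + l ≢ + 0) k →
    κ c * (U c k - r c * U (c ℤ.+ 2D) k) ≈ o c * (G c (suc k) - G c k)
  telescope c pole k = begin
    qx * s₁ * s₂ * (z * z * z) * (U₀ - rU)
      ≈⟨ solve 6 (λ qx s₁ s₂ z U rU → qx :* s₁ :* s₂ :* (z :* z :* z) :* (U :- rU)
           := qx :* (z :* z :* z) :* (U :* (s₁ :* s₂)) :- qx :* s₁ :* s₂ :* (rU :* (z :* z :* z))) refl qx s₁ s₂ z U₀ rU ⟩
    qx * (z * z * z) * (U₀ * (s₁ * s₂)) - qx * s₁ * s₂ * (rU * (z * z * z))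
      ≈⟨ +-cong (*-cong (*-congʳ (E-+ c D)) (U-via-B c pole k)) (-‿cong (*-cong (*-congʳ qs≈) (rU-via-B c pole k))) ⟩
    x * Q * (z * z * z) * (b * N₁) - - y * s₂ * (- x * (b * N₂))
      ≈⟨ solve 8 (λ x Q z b N₁ y s₂ N₂ → x :* Q :* (z :* z :* z) :* (b :* N₁) :- :- y :* s₂ :* (:- x :* (b :* N₂))
           := x :* Q :* (z :* z :* z) :* (b :* N₁) :- x :* s₂ :* y :* (b :* N₂)) refl x Q z b N₁ y s₂ N₂ ⟩
    x * Q * (z * z * z) * (b * N₁) - x * s₂ * y * (b * N₂)
      ≈⟨ +-congˡ (-‿cong (*-congʳ (*-congʳ (o-neg c)))) ⟩
    x * Q * (z * z * z) * (b * N₁) - - z * y * (b * N₂)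
      ≈⟨ solve 7 (λ x Q z b N₁ y N₂ → x :* Q :* (z :* z :* z) :* (b :* N₁) :- :- z :* y :* (b :* N₂)
           := z :* (b :* (x :* Q :* (z :* z) :* N₁ :+ y :* N₂))) refl x Q z b N₁ y N₂ ⟩
    z * (b * (x * Q * (z * z) * N₁ + y * N₂))
      ≈⟨ *-congˡ (*-congˡ (certificate c pole k)) ⟩
    z * (b * (N₃ * X′ * p′ - N₄ * p))
      ≈⟨ *-congˡ (solve 6 (λ b N₃ X p′ N₄ p → b :* (N₃ :* X :* p′ :- N₄ :* p) := b :* N₃ :* X :* p′ :- b :* N₄ :* p) refl b N₃ X′ p′ N₄ p) ⟩
    z * (b * N₃ * X′ * p′ - b * N₄ * p)
      ≈⟨ *-congˡ (+-congʳ (G-suc c pole k)) ⟨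
    z * (G c (suc k) - G c k) ∎
    where
    x = E c
    Q = E D
    z = o c
    y = o (c ℤ.+ D)
    qx = E (c ℤ.+ D)
    s₁ = o (ℤ.- c ℤ.- D)
    s₂ = o (ℤ.- c)
    U₀ = U c k
    rU = r c * U (c ℤ.+ 2D) k
    b = B c k
    X′ = E (D ℤ.* + suc k)
    p′ = P x Q X′
    p = P x Q (E (D ℤ.* + k))
    w₁ = o (c ℤ.+ D ℤ.* + k)
    w₂ = o (c ℤ.+ D ℤ.* + suc k)
    w₃ = o (c ℤ.+ 2D ℤ.* + k)
    u = o (ℤ.- c ℤ.- D ℤ.+ D ℤ.* + k)
    v = o (ℤ.- c ℤ.- D ℤ.+ D ℤ.* + suc k)
    g = o (+ 2 ℤ.* c ℤ.+ D ℤ.+ 2D ℤ.* + k)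
    h = o (+ 2 ℤ.* c ℤ.+ D ℤ.+ 2D ℤ.* + suc k)
    N₁ = o (c ℤ.+ + 3 ℤ.* D ℤ.* + k) * (u * v) * (g * h)
    N₂ = o (c ℤ.+ 2D ℤ.+ + 3 ℤ.* D ℤ.* + k) * (w₁ * w₂ * (w₁ * w₂)) * w₃
    N₃ = w₁ * w₁ * u * w₃
    N₄ = h * (o (2D ℤ.* + k) * o (2D ℤ.* + k)) * o (D ℤ.* + k)
    qs≈ : qx * s₁ ≈ - y
    qs≈ = trans (*-congˡ (o-cong (lem c D))) (o-neg (c ℤ.+ D))
      where
      lem : ∀ c D → ℤ.- c ℤ.- D ≡ ℤ.- (c ℤ.+ D)
      lem = solve-∀

  Σ-telescope : ∀ c (pole : ∀ l → + 2 ℤ.* c ℤ.+ D ℤ.+ 2D ℤ.* + l ≢ + 0) n →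
    κ c * (Σ (U c) n - r c * Σ (U (c ℤ.+ 2D)) n) ≈ o c * G c n
  Σ-telescope c pole zero = begin
    κ c * (0# - r c * 0#)  ≈⟨ solve 2 (λ k r → k :* (con (+ 0) :- r :* con (+ 0)) := con (+ 0)) refl (κ c) (r c) ⟩
    0#                     ≈⟨ zeroʳ _ ⟨
    o c * 0#               ≈⟨ *-congˡ (G-0 c) ⟨
    o c * G c 0            ∎
  Σ-telescope c pole (suc n) = begin
    κ c * (s + U c n - r c * (s′ + u′))
      ≈⟨ solve 6 (λ k s u r s′ u′ → k :* (s :+ u :- r :* (s′ :+ u′)) := k :* (s :- r :* s′) :+ k :* (u :- r :* u′)) refl (κ c) s (U c n) (r c) s′ u′ ⟩
    κ c * (s - r c * s′) + κ c * (U c n - r c * u′)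
      ≈⟨ +-cong (Σ-telescope c pole n) (telescope c pole n) ⟩
    o c * G c n + o c * (G c (suc n) - G c n)
      ≈⟨ solve 3 (λ z g g′ → z :* g :+ z :* (g′ :- g) := z :* g′) refl (o c) (G c n) (G c (suc n)) ⟩
    o c * G c (suc n) ∎
    where
    s = Σ (U c) n
    s′ = Σ (U (c ℤ.+ 2D)) n
    u′ = U (c ℤ.+ 2D) n

-- Zeros and poles modulo n

module Modulus (d m : ℕ) where
  open Signed using (_∣_; divides; ∣-refl; ∣⇒∣ᵤ; ∣m∣n⇒∣m-n; ∣m⇒∣-m)

  n : ℕ
  n = suc (d ℕ.* m ℕ.+ d ℕ.* m)

  D M N : ℤ
  D = + d
  M = + m
  N = + n

  N≡ : N ≡ + 1 ℤ.+ + 2 ℤ.* D ℤ.* M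
  N≡ = ≡.trans (≡.cong (λ i → + 1 ℤ.+ (i ℤ.+ i)) (ℤ.pos-* d m)) (lem D M)
    where
    lem : ∀ D M → + 1 ℤ.+ (D ℤ.* M ℤ.+ D ℤ.* M) ≡ + 1 ℤ.+ + 2 ℤ.* D ℤ.* M
    lem = solve-∀

  -- N = 1 + 2DM makes -M an inverse of 2D modulo N.
  cancel-2D : ∀ y → N ∣ + 2 ℤ.* D ℤ.* y → N ∣ y
  cancel-2D y (divides q eq) = divides (y ℤ.- M ℤ.* q)
    (≡.trans (lem D M y) (≡.trans (≡.cong₂ (λ i j → i ℤ.* y ℤ.- M ℤ.* j) (≡.sym N≡) eq) (lem′ N y M q)))
    where
    lem : ∀ D M y → y ≡ (+ 1 ℤ.+ + 2 ℤ.* D ℤ.* M) ℤ.* y ℤ.- M ℤ.* (+ 2 ℤ.* D ℤ.* y)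
    lem = solve-∀
    lem′ : ∀ N y M q → N ℤ.* y ℤ.- M ℤ.* (q ℤ.* N) ≡ (y ℤ.- M ℤ.* q) ℤ.* N
    lem′ = solve-∀

  cancel-D : ∀ y → N ∣ D ℤ.* y → N ∣ y
  cancel-D y (divides q eq) = cancel-2D y (divides (+ 2 ℤ.* q)
    (≡.trans (lem D y) (≡.trans (≡.cong (+ 2 ℤ.*_) eq) (lem′ q N))))
    where
    lem : ∀ D y → + 2 ℤ.* D ℤ.* y ≡ + 2 ℤ.* (D ℤ.* y)
    lem = solve-∀
    lem′ : ∀ q N → + 2 ℤ.* (q ℤ.* N) ≡ + 2 ℤ.* q ℤ.* N
    lem′ = solve-∀

  ∤-small : ∀ {k} → 0 ℕ.< k → k ℕ.< n → ¬ N ∣ + k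
  ∤-small {suc k} _ k<n N∣k = ℕ.<⇒≱ k<n (ℕ.∣⇒≤ (∣⇒∣ᵤ N∣k))

  private
    ∤-sub : ∀ k l → l ℕ.< k → k ℕ.< l ℕ.+ n → ¬ N ∣ + k ℤ.- + l
    ∤-sub k l l<k k<l+n N∣ = ∤-small (ℕ.m<n⇒0<n∸m l<k)
      (ℕ.m<n+o⇒m∸n<o k l k<l+n)
      (≡.subst (N ∣_) (≡.trans (ℤ.m-n≡m⊖n k l) (ℤ.⊖-≥ (ℕ.<⇒≤ l<k))) N∣)

  ∤-diff : ∀ k l → k ≢ l → k ℕ.< l ℕ.+ n → l ℕ.< k ℕ.+ n → ¬ N ∣ + k ℤ.- + l
  ∤-diff k l k≢l k<l+n l<k+n N∣ with ℕ.<-cmp k l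
  ... | tri< k<l _ _ = ∤-sub l k k<l l<k+n (≡.subst (N ∣_) (lem (+ k) (+ l)) (∣m⇒∣-m N∣))
    where
    lem : ∀ k l → ℤ.- (k ℤ.- l) ≡ l ℤ.- k
    lem = solve-∀
  ... | tri≈ _ k≡l _ = k≢l k≡l
  ... | tri> _ _ l<k = ∤-sub k l l<k k<l+n N∣

  -- The exponents of the base points q^n, q^n Q⁻², q^n Q⁻⁴, …; the m-th one is q itself.
  cᵢ : ℕ → ℤ
  cᵢ i = N ℤ.- + 2 ℤ.* D ℤ.* + i

  cᵢ-suc : ∀ i → cᵢ (suc i) ℤ.+ + 2 ℤ.* D ≡ cᵢ i
  cᵢ-suc i = lem N D (+ i)
    where
    lem : ∀ N D i → N ℤ.- + 2 ℤ.* D ℤ.* (+ 1 ℤ.+ i) ℤ.+ + 2 ℤ.* D ≡ N ℤ.- + 2 ℤ.* D ℤ.* i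
    lem = solve-∀

  cᵢ-m : cᵢ m ≡ + 1
  cᵢ-m = ≡.trans (≡.cong (ℤ._- + 2 ℤ.* D ℤ.* M) N≡) (lem D M)
    where
    lem : ∀ D M → + 1 ℤ.+ + 2 ℤ.* D ℤ.* M ℤ.- + 2 ℤ.* D ℤ.* M ≡ + 1
    lem = solve-∀

  zero-c-D : ∀ i → N ∣ cᵢ i ℤ.+ D ℤ.* + (i ℕ.+ i)
  zero-c-D i = divides (+ 1) (lem N D (+ i))
    where
    lem : ∀ N D i → N ℤ.- + 2 ℤ.* D ℤ.* i ℤ.+ D ℤ.* (i ℤ.+ i) ≡ + 1 ℤ.* N
    lem = solve-∀

  zero-c-2D : ∀ i → N ∣ cᵢ i ℤ.+ + 2 ℤ.* D ℤ.* + i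
  zero-c-2D i = divides (+ 1) (lem N D (+ i))
    where
    lem : ∀ N D i → N ℤ.- + 2 ℤ.* D ℤ.* i ℤ.+ + 2 ℤ.* D ℤ.* i ≡ + 1 ℤ.* N
    lem = solve-∀

  -- The index of the only factor of (x²Q;Q²)_∞ below n that vanishes modulo Φ n, for x = E (cᵢ i).
  poleIndex : ℕ → ℕ
  poleIndex i = d ℕ.* m ℕ.+ (i ℕ.+ i)

  zero-pole : ∀ i → N ∣ + 2 ℤ.* cᵢ i ℤ.+ D ℤ.+ + 2 ℤ.* D ℤ.* + poleIndex i
  zero-pole i = divides (+ 2 ℤ.+ D) (≡.trans
    (≡.cong (λ j → + 2 ℤ.* cᵢ i ℤ.+ D ℤ.+ + 2 ℤ.* D ℤ.* (j ℤ.+ (+ i ℤ.+ + i))) (ℤ.pos-* d m))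
    (≡.trans (lem N D M (+ i)) (≡.trans (≡.cong (λ j → + 2 ℤ.* N ℤ.+ D ℤ.* j) (≡.sym N≡)) (lem′ N D))))
    where
    lem : ∀ N D M i → + 2 ℤ.* (N ℤ.- + 2 ℤ.* D ℤ.* i) ℤ.+ D ℤ.+ + 2 ℤ.* D ℤ.* (D ℤ.* M ℤ.+ (i ℤ.+ i))
        ≡ + 2 ℤ.* N ℤ.+ D ℤ.* (+ 1 ℤ.+ + 2 ℤ.* D ℤ.* M)
    lem = solve-∀
    lem′ : ∀ N D → + 2 ℤ.* N ℤ.+ D ℤ.* N ≡ (+ 2 ℤ.+ D) ℤ.* N
    lem′ = solve-∀

  -- The exponent is D (1 + l + 2i) - N. The zero of (Q/x;Q) therefore sits at n - 1 - 2i and moves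
  -- down as i grows, while `poleIndex i` moves up.
  zero-D-c : ∀ i l → suc (l ℕ.+ (i ℕ.+ i)) ≡ n → N ∣ D ℤ.- cᵢ i ℤ.+ D ℤ.* + l
  zero-D-c i l eq = divides (D ℤ.- + 1) (≡.trans (lem N D (+ i) (+ l))
    (≡.trans (≡.cong (λ j → D ℤ.* j ℤ.- N) (≡.cong +_ eq)) (lem′ N D)))
    where
    lem : ∀ N D i l → D ℤ.- (N ℤ.- + 2 ℤ.* D ℤ.* i) ℤ.+ D ℤ.* l ≡ D ℤ.* (+ 1 ℤ.+ (l ℤ.+ (i ℤ.+ i))) ℤ.- N
    lem = solve-∀
    lem′ : ∀ N D → D ℤ.* N ℤ.- N ≡ (D ℤ.- + 1) ℤ.* N
    lem′ = solve-∀

  -- The same zero, counted in (1/(xQ);Q), which starts two factors earlier; hence the index n + 1 -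
  -- 2i.
  zero--c-D : ∀ i l → l ℕ.+ (i ℕ.+ i) ≡ suc n → N ∣ ℤ.- cᵢ i ℤ.- D ℤ.+ D ℤ.* + l
  zero--c-D i l eq = divides (D ℤ.- + 1) (≡.trans (lem N D (+ i) (+ l))
    (≡.trans (≡.cong (λ j → D ℤ.* (j ℤ.- + 1) ℤ.- N) (≡.cong +_ eq)) (lem′ N D)))
    where
    lem : ∀ N D i l → ℤ.- (N ℤ.- + 2 ℤ.* D ℤ.* i) ℤ.- D ℤ.+ D ℤ.* l ≡ D ℤ.* (l ℤ.+ (i ℤ.+ i) ℤ.- + 1) ℤ.- N
    lem = solve-∀
    lem′ : ∀ N D → D ℤ.* (+ 1 ℤ.+ N ℤ.- + 1) ℤ.- N ≡ (D ℤ.- + 1) ℤ.* N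
    lem′ = solve-∀

  -- 2D is invertible modulo N, so the vanishing indices form one class modulo n; the bounds keep l
  -- within less than a period of `poleIndex i`.
  ∤-pole : ∀ i l → l ≢ poleIndex i → l ℕ.< poleIndex i ℕ.+ n → poleIndex i ℕ.< l ℕ.+ n →
    ¬ N ∣ + 2 ℤ.* cᵢ i ℤ.+ D ℤ.+ + 2 ℤ.* D ℤ.* + l
  ∤-pole i l l≢ l< >l N∣ = ∤-diff l (poleIndex i) l≢ l< >l
    (cancel-2D _ (≡.subst (N ∣_) (lem (+ 2 ℤ.* cᵢ i ℤ.+ D) D (+ l) (+ poleIndex i)) (∣m∣n⇒∣m-n N∣ (zero-pole i))))
    where
    lem : ∀ a D l p → a ℤ.+ + 2 ℤ.* D ℤ.* l ℤ.- (a ℤ.+ + 2 ℤ.* D ℤ.* p) ≡ + 2 ℤ.* D ℤ.* (l ℤ.- p)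
    lem = solve-∀

  ∤-2D : ∀ l → suc l ℕ.< n → ¬ N ∣ + 2 ℤ.* D ℤ.+ + 2 ℤ.* D ℤ.* + l
  ∤-2D l l<n N∣ = ∤-small (s≤s z≤n) l<n (cancel-2D (+ suc l) (≡.subst (N ∣_) (lem D (+ l)) N∣))
    where
    lem : ∀ D l → + 2 ℤ.* D ℤ.+ + 2 ℤ.* D ℤ.* l ≡ + 2 ℤ.* D ℤ.* (+ 1 ℤ.+ l)
    lem = solve-∀

  ∤-D : ∀ l → suc l ℕ.< n → ¬ N ∣ D ℤ.+ D ℤ.* + l
  ∤-D l l<n N∣ = ∤-small (s≤s z≤n) l<n (cancel-D (+ suc l) (≡.subst (N ∣_) (lem D (+ l)) N∣))
    where
    lem : ∀ D l → D ℤ.+ D ℤ.* l ≡ D ℤ.* (+ 1 ℤ.+ l)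
    lem = solve-∀

  N∣N : N ∣ N
  N∣N = ∣-refl

  ∤-c : ∀ i → suc i ℕ.< n → ¬ N ∣ cᵢ (suc i)
  ∤-c i i<n N∣ = ∤-small (s≤s z≤n) i<n (cancel-2D (+ suc i) (≡.subst (N ∣_) (lem N (+ 2 ℤ.* D ℤ.* + suc i)) (∣m∣n⇒∣m-n N∣N N∣)))
    where
    lem : ∀ N y → N ℤ.- (N ℤ.- y) ≡ y
    lem = solve-∀

  -- Serves with a = N for 1 - xQ and with a = 2N for the denominators in `reflect`.
  ∤-odd : ∀ a i → N ∣ a → suc (i ℕ.+ i) ℕ.< n → ¬ N ∣ a ℤ.- D ℤ.* + suc (i ℕ.+ i)
  ∤-odd a i N∣a i<n N∣ = ∤-small (s≤s z≤n) i<n (cancel-D _ (≡.subst (N ∣_) (lem a _) (∣m∣n⇒∣m-n N∣a N∣)))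
    where
    lem : ∀ a y → a ℤ.- (a ℤ.- y) ≡ y
    lem = solve-∀

  c+D≡ : ∀ i → cᵢ (suc i) ℤ.+ D ≡ N ℤ.- D ℤ.* + suc (i ℕ.+ i)
  c+D≡ i = lem N D (+ i)
    where
    lem : ∀ N D i → N ℤ.- + 2 ℤ.* D ℤ.* (+ 1 ℤ.+ i) ℤ.+ D ≡ N ℤ.- D ℤ.* (+ 1 ℤ.+ (i ℤ.+ i))
    lem = solve-∀

  ∤-c+D : ∀ i → suc (i ℕ.+ i) ℕ.< n → ¬ N ∣ cᵢ (suc i) ℤ.+ D
  ∤-c+D i i<n N∣ = ∤-odd N i N∣N i<n (≡.subst (N ∣_) (c+D≡ i) N∣)

  ∤⇒∤- : ∀ {e} → ¬ N ∣ e → ¬ N ∣ ℤ.- e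
  ∤⇒∤- {e} N∤e N∣ = N∤e (≡.subst (N ∣_) (ℤ.neg-involutive e) (∣m⇒∣-m N∣))

  ∤⇒≢0 : ∀ {e} → ¬ N ∣ e → e ≢ + 0
  ∤⇒≢0 N∤e ≡.refl = N∤e (divides (+ 0) ≡.refl)

  -- If i > m the exponent may be negative, but it is 2 modulo d.
  pole≢0 : ∀ i → i ℕ.≤ m ⊎ 2 ℕ.< d → ∀ l → + 2 ℤ.* cᵢ i ℤ.+ D ℤ.+ + 2 ℤ.* D ℤ.* + l ≢ + 0
  pole≢0 i (inj₁ i≤m) l eq with m ℕ.∸ i | ℕ.m+[n∸m]≡n i≤m
  ... | j | ij≡m = contr (≡.trans (≡.sym (≡.trans (≡.cong (λ a → + 2 ℤ.* (a ℤ.- + 2 ℤ.* D ℤ.* + i) ℤ.+ D ℤ.+ + 2 ℤ.* D ℤ.* + l) N≡)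
       (≡.trans (≡.cong (λ a → + 2 ℤ.* (+ 1 ℤ.+ + 2 ℤ.* D ℤ.* a ℤ.- + 2 ℤ.* D ℤ.* + i) ℤ.+ D ℤ.+ + 2 ℤ.* D ℤ.* + l) (≡.cong +_ (≡.sym ij≡m)))
       (≡.trans (lem D (+ i) (+ j) (+ l)) (≡.cong (λ a → + 2 ℤ.+ a) (≡.sym (ℤ.pos-* d _))))))) eq)
    where
    lem : ∀ D i j l → + 2 ℤ.* (+ 1 ℤ.+ + 2 ℤ.* D ℤ.* (i ℤ.+ j) ℤ.- + 2 ℤ.* D ℤ.* i) ℤ.+ D ℤ.+ + 2 ℤ.* D ℤ.* l
        ≡ + 2 ℤ.+ D ℤ.* (j ℤ.+ (j ℤ.+ (j ℤ.+ j)) ℤ.+ (+ 1 ℤ.+ (l ℤ.+ l)))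
    lem = solve-∀
    contr : ∀ {k} → + suc k ≢ + 0
    contr ()
  pole≢0 i (inj₂ 2<d) l eq = ℕ.<⇒≱ 2<d (ℕ.∣⇒≤ (∣⇒∣ᵤ {D} {+ 2} (divides (ℤ.- y)
    (≡.trans (lem′ D y) (≡.trans (≡.cong (ℤ._- D ℤ.* y) 2+Dy≡0) (lem″ D y))))))
    where
    y = + 4 ℤ.* M ℤ.- + 4 ℤ.* + i ℤ.+ + 1 ℤ.+ + 2 ℤ.* + l
    lem : ∀ D M i l → + 2 ℤ.* (+ 1 ℤ.+ + 2 ℤ.* D ℤ.* M ℤ.- + 2 ℤ.* D ℤ.* i) ℤ.+ D ℤ.+ + 2 ℤ.* D ℤ.* l
        ≡ + 2 ℤ.+ D ℤ.* (+ 4 ℤ.* M ℤ.- + 4 ℤ.* i ℤ.+ + 1 ℤ.+ + 2 ℤ.* l)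
    lem = solve-∀
    lem′ : ∀ D y → + 2 ≡ (+ 2 ℤ.+ D ℤ.* y) ℤ.- D ℤ.* y
    lem′ = solve-∀
    lem″ : ∀ D y → + 0 ℤ.- D ℤ.* y ≡ ℤ.- y ℤ.* D
    lem″ = solve-∀
    2+Dy≡0 : + 2 ℤ.+ D ℤ.* y ≡ + 0
    2+Dy≡0 = ≡.trans (≡.sym (lem D M (+ i) (+ l)))
      (≡.trans (≡.cong (λ a → + 2 ℤ.* (a ℤ.- + 2 ℤ.* D ℤ.* + i) ℤ.+ D ℤ.+ + 2 ℤ.* D ℤ.* + l) (≡.sym N≡)) eq)

-- Divisibility by powers of t

record Subring {c ℓ} (K : CommutativeRing c ℓ) (p : Level) : Set (c Level.⊔ ℓ Level.⊔ Level.suc p) where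
  open CommutativeRing K
  field
    O      : Carrier → Set p
    O-resp : ∀ {x y} → x ≈ y → O x → O y
    O-1    : O 1#
    O-+    : ∀ {x y} → O x → O y → O (x + y)
    O-*    : ∀ {x y} → O x → O y → O (x * y)
    O-neg  : ∀ {x} → O x → O (- x)

module Valuation {c ℓ p} (K : CommutativeRing c ℓ) (S : Subring K p) (t : CommutativeRing.Carrier K) (O-t : Subring.O S t) where
  open CommutativeRing K hiding (zero)
  open Subring S
  open Relation.Binary.Reasoning.Setoid setoid
  open Algebra.Properties.Semiring.Exp semiring using (_^_; ^-homo-*)
  open QSeries K
  open IntegerSolver K hiding (module S)

  -- A lower bound v for the t-adic order: the cofactor lies in the local ring, while x is taken
  -- from K.
  record V (v : ℕ) (x : Carrier) : Set (c Level.⊔ ℓ Level.⊔ p) where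
    constructor val
    field
      cofactor   : Carrier
      O-cofactor : O cofactor
      equation   : x ≈ t ^ v * cofactor

  V-resp : ∀ {v x y} → x ≈ y → V v x → V v y
  V-resp x≈y (val w Ow eq) = val w Ow (trans (sym x≈y) eq)

  V-0 : ∀ {x} → O x → V 0 x
  V-0 {x} Ox = val x Ox (sym (*-identityˡ x))

  V-* : ∀ {a b x y} → V a x → V b y → V (a ℕ.+ b) (x * y)
  V-* {a} {b} {x} {y} (val w Ow eq) (val w′ Ow′ eq′) = val (w * w′) (O-* Ow Ow′) (begin
    x * y                      ≈⟨ *-cong eq eq′ ⟩
    t ^ a * w * (t ^ b * w′)   ≈⟨ solve 4 (λ a w b w′ → a :* w :* (b :* w′) := a :* b :* (w :* w′)) refl (t ^ a) w (t ^ b) w′ ⟩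
    t ^ a * t ^ b * (w * w′)   ≈⟨ *-congʳ (^-homo-* t a b) ⟨
    t ^ (a ℕ.+ b) * (w * w′)   ∎)

  V-+ : ∀ {v x y} → V v x → V v y → V v (x + y)
  V-+ {v} (val w Ow eq) (val w′ Ow′ eq′) = val (w + w′) (O-+ Ow Ow′) (trans (+-cong eq eq′) (sym (distribˡ (t ^ v) w w′)))

  V-neg : ∀ {v x} → V v x → V v (- x)
  V-neg {v} {x} (val w Ow eq) = val (- w) (O-neg Ow) (trans (-‿cong eq) (solve 2 (λ a w → :- (a :* w) := a :* :- w) refl (t ^ v) w))

  V-*ˡ : ∀ {v x y} → O x → V v y → V v (x * y)
  V-*ˡ Ox Vy = V-* (V-0 Ox) Vy

  V-*ʳ : ∀ {v x y} → V v x → O y → V v (x * y)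
  V-*ʳ {x = x} {y} Vx Oy = V-resp (*-comm y x) (V-*ˡ Oy Vx)

  -- One factor of t is spent on a simple pole of y.
  V-pole : ∀ {v x y} → V (suc v) x → O (t * y) → V v (x * y)
  V-pole {v} {x} {y} (val w Ow eq) Oty = val (w * (t * y)) (O-* Ow Oty) (trans (*-congʳ eq)
    (solve 4 (λ t a w y → t :* a :* w :* y := a :* (w :* (t :* y))) refl t (t ^ v) w y))

  V-cancel : ∀ {v x y y′} → y′ * y ≈ 1# → O y′ → V v (y * x) → V v x
  V-cancel {x = x} {y} {y′} inv Oy′ Vyx = V-resp
    (trans (sym (*-assoc y′ y x)) (trans (*-congʳ inv) (*-identityˡ x))) (V-*ˡ Oy′ Vyx)

  Σ-V : ∀ {v} f k l → (∀ j → k ℕ.≤ j → j ℕ.< l → V v (f j)) → k ℕ.≤ l → V v (Σ f l - Σ f k)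
  Σ-V {v} f k l Vf k≤l with ℕ.m≤n⇒m<n∨m≡n k≤l
  -- The empty difference is 0#, which lies in `O` as 1# - 1#.
  ... | inj₂ ≡.refl = val 0# (O-resp (-‿inverseʳ 1#) (O-+ O-1 (O-neg O-1))) (trans (-‿inverseʳ _) (sym (zeroʳ _)))
  Σ-V {v} f k (suc l) Vf k≤l | inj₁ (s≤s k≤l′) = V-resp
    (solve 3 (λ a b c → a :- b :+ c := a :+ c :- b) refl (Σ f l) (Σ f k) (f l))
    (V-+ (Σ-V f k l (λ j k≤j j<l → Vf j k≤j (ℕ.m≤n⇒m≤1+n j<l)) k≤l′) (Vf l k≤l′ ℕ.≤-refl))

  module _ (f : ℤ → Carrier) (a b : ℤ) where
    Π-O : ∀ k → (∀ l → l ℕ.< k → O (f (a ℤ.+ b ℤ.* + l))) → O (Π f a b k)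
    Π-O zero    Of = O-1
    Π-O (suc k) Of = O-* (Π-O k (λ l l<k → Of l (ℕ.m≤n⇒m≤1+n l<k))) (Of k ℕ.≤-refl)

    Π-V : ∀ k → (∀ l → O (f (a ℤ.+ b ℤ.* + l))) → ∀ l → l ℕ.< k → V 1 (f (a ℤ.+ b ℤ.* + l)) → V 1 (Π f a b k)
    Π-V (suc k) Of l (s≤s l≤k) Vf with ℕ.m≤n⇒m<n∨m≡n l≤k
    ... | inj₁ l<k    = V-*ʳ (Π-V k Of l l<k Vf) (Of k)
    ... | inj₂ ≡.refl = V-*ˡ (Π-O k (λ l _ → Of l)) Vf

    -- Only the p-th factor can leave `O`, so a single t clears the whole product.
    Π-pole : ∀ k p → (∀ l → l ≢ p → l ℕ.< k → O (f (a ℤ.+ b ℤ.* + l))) → O (t * f (a ℤ.+ b ℤ.* + p)) → O (t * Π f a b k)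
    Π-pole zero    p Of Op = O-* O-t O-1
    Π-pole (suc k) p Of Op with k ℕ.≟ p
    ... | yes ≡.refl = O-resp (solve 3 (λ t x y → x :* (t :* y) := t :* (x :* y)) refl t (Π f a b k) (f (a ℤ.+ b ℤ.* + k)))
                         (O-* (Π-O k (λ l l<k → Of l (ℕ.<⇒≢ l<k) (ℕ.m≤n⇒m≤1+n l<k))) Op)
    ... | no  k≢p    = O-resp (*-assoc _ _ _)
                         (O-* (Π-pole k p (λ l l≢p l<k → Of l l≢p (ℕ.m≤n⇒m≤1+n l<k)) Op) (Of k k≢p ℕ.≤-refl))

-- The congruences in an abstract local ring

-- The interface behind all order counts, with t = `o N`. `io-pole` says that every pole is at most
-- simple.
record LocalAt {c ℓ} {K : CommutativeRing c ℓ} (𝒬 : PowersOfQ K) (p : Level) (N : ℤ) : Set (c Level.⊔ ℓ Level.⊔ Level.suc p) where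
  open CommutativeRing K
  open PowersOfQ 𝒬
  open Signed using (_∣_)
  field
    subring : Subring K p
  open Subring subring public
  field
    O-E     : ∀ e → O (E e)
    o-∣     : ∀ e → N ∣ e → ∃ λ w → O w × o e ≈ o N * w
    io-O    : ∀ e → ¬ N ∣ e → O (io e)
    io-pole : ∀ e → O (o N * io e)

-- The bounds say h = ⌊d/2⌋. The tail is treated at i = hm: 2hm ≤ dm keeps the pole index dm + 2hm
-- below n, and dm ≤ 4hm places the zero 2dm - 2hm of (Q/x;Q) no later than that pole.
module Congruence {c ℓ p} (K : CommutativeRing c ℓ) (𝒬 : PowersOfQ K)
  (d m h : ℕ) (2≤d : 2 ℕ.≤ d) (1≤m : 1 ℕ.≤ m) (1≤h : 1 ℕ.≤ h) (2h≤d : h ℕ.+ h ℕ.≤ d) (d≤2h+1 : d ℕ.≤ suc (h ℕ.+ h))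
  (𝒪 : LocalAt 𝒬 p (Modulus.N d m))
  where
  open Signed using (_∣_; ∣n⇒∣m*n)
  open CommutativeRing K hiding (zero)
  open PowersOfQ 𝒬
  open LocalAt 𝒪
  open Modulus d m
  open Relation.Binary.Reasoning.Setoid setoid
  open QSeries K
  open IntegerSolver K hiding (module S)

  D≢0 : ∀ k → D ℤ.* + suc k ≢ + 0
  D≢0 k eq with ℤ.i*j≡0⇒i≡0∨j≡0 D eq
  ... | inj₁ D≡0 = ℕ.<⇒≢ (ℕ.≤-trans (s≤s z≤n) 2≤d) (≡.sym (ℤ.+-injective D≡0))

  open Telescope K 𝒬 D D≢0 public

  t : Carrier
  t = o N

  O-o : ∀ e → O (o e)
  O-o e = O-+ O-1 (O-neg (O-E e))

  open Valuation K subring t (O-o N) public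

  V-o : ∀ e → N ∣ e → V 1 (o e)
  V-o e N∣e with o-∣ e N∣e
  ... | w , Ow , eq = val w Ow (trans eq (*-congʳ (sym (*-identityʳ t))))

  O-P : ∀ {x Q X} → O x → O Q → O X → O (P x Q X)
  O-P {x} {Q} {X} Ox OQ OX =
    O-+ (O-+ (O-+ OxQ-1 (O-neg (O-* (O-* OxQ O1-x) O1-x)))
             (O-neg (O-* (O-* (O-* (O-* (O-+ O-1 OQ) Ox) Ox) OxQ-1) OX)))
        (O-* (O-* (O-+ (O-* (O-* (O-* (O-* Ox Ox) OQ) O1-x) O1-x) (O-* (O-* (O-* (O-* (O-* Ox Ox) Ox) Ox) OQ) OxQ-1)) OX) OX)
    where
    OxQ = O-* Ox OQ
    OxQ-1 = O-+ OxQ (O-neg O-1)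
    O1-x = O-+ O-1 (O-neg Ox)

  dm : ℕ
  dm = d ℕ.* m

  2m≤dm : m ℕ.+ m ℕ.≤ dm
  2m≤dm = ℕ.≤-trans (ℕ.≤-reflexive (≡.cong (m ℕ.+_) (≡.sym (ℕ.+-identityʳ m)))) (ℕ.*-monoˡ-≤ m 2≤d)

  pole<n : ∀ i → i ℕ.+ i ℕ.≤ dm → poleIndex i ℕ.< n
  pole<n i i≤ = s≤s (ℕ.+-monoʳ-≤ dm i≤)

  Π-denominator : ∀ i k → i ℕ.+ i ℕ.≤ dm → k ℕ.≤ poleIndex i → O (Π io (+ 2 ℤ.* cᵢ i ℤ.+ D) 2D k)
  Π-denominator i k i≤ k≤ = Π-O io _ 2D k λ l l<k → io-O _ (∤-pole i l
    (ℕ.<⇒≢ (ℕ.<-≤-trans l<k k≤)) (ℕ.<-≤-trans l<k (ℕ.≤-trans k≤ (ℕ.m≤m+n _ n))) (ℕ.<-≤-trans (pole<n i i≤) (ℕ.m≤n+m n l)))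

  -- The next pole would be at `poleIndex i` + n, beyond the last index n. The length n + 1 does
  -- occur: it is that of the denominator of `G` at index n, in the form given by `G-suc`.
  Π-denominator-pole : ∀ i k → i ℕ.+ i ℕ.≤ dm → k ℕ.≤ suc n → O (t * Π io (+ 2 ℤ.* cᵢ i ℤ.+ D) 2D k)
  Π-denominator-pole i k i≤ k≤ = Π-pole io _ 2D k (poleIndex i) (λ l l≢ l<k → io-O _ (∤-pole i l l≢
    (ℕ.≤-<-trans (ℕ.s≤s⁻¹ (ℕ.<-≤-trans l<k k≤)) (ℕ.+-monoˡ-≤ n 1≤pole)) (ℕ.<-≤-trans (pole<n i i≤) (ℕ.m≤n+m n l)))) (io-pole _)
    where
    1≤pole : 1 ℕ.≤ poleIndex i
    1≤pole = ℕ.≤-trans (ℕ.≤-trans 1≤m (ℕ.≤-trans (ℕ.m≤m+n m m) 2m≤dm)) (ℕ.m≤m+n dm _)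

  module _ (k : ℕ) (k<n : k ℕ.< n) where
    Π-O-2D : O (Π io 2D 2D k)
    Π-O-2D = Π-O io 2D 2D k λ l l<k → io-O _ (∤-2D l (ℕ.≤-<-trans l<k k<n))

    Π-O-D : O (Π io D D k)
    Π-O-D = Π-O io D D k λ l l<k → io-O _ (∤-D l (ℕ.≤-<-trans l<k k<n))

  V-Π-c-D : ∀ i k → i ℕ.+ i ℕ.< k → V 1 (Π o (cᵢ i) D k)
  V-Π-c-D i k i<k = Π-V o _ D k (λ l → O-o _) (i ℕ.+ i) i<k (V-o _ (zero-c-D i))

  V-Π-c-2D : ∀ i k → i ℕ.+ i ℕ.< k → V 1 (Π o (cᵢ i) 2D k)
  V-Π-c-2D i k i<k = Π-V o _ 2D k (λ l → O-o _) i (ℕ.≤-<-trans (ℕ.m≤m+n i i) i<k) (V-o _ (zero-c-2D i))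

  O-Π : ∀ a b k → O (Π o a b k)
  O-Π a b k = Π-O o a b k λ l _ → O-o _

  -- For k > 2i the two copies of (x;Q)_k and the one of (x;Q²)_k give a t each. In the first
  -- alternative the denominator has not reached its pole; in the second (Q/x;Q)_k contains its
  -- zero, which pays for the pole.
  V-U : ∀ i k → i ℕ.+ i ℕ.≤ dm → i ℕ.+ i ℕ.< k → k ℕ.< n →
    k ℕ.≤ poleIndex i ⊎ (∃ λ l → suc (l ℕ.+ (i ℕ.+ i)) ≡ n × l ℕ.< k) → V 3 (U (cᵢ i) k)
  V-U i k i≤ i<k k<n (inj₁ k≤) =
    V-*ʳ (V-*ʳ (V-*ˡ (O-o _) (V-* (V-*ʳ (V-* v v) (O-Π _ D k)) (V-Π-c-2D i k i<k))) (O-E _))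
         (O-* (O-* (O-* Oa Oa) (Π-denominator i k i≤ k≤)) (Π-O-D k k<n))
    where
    v = V-Π-c-D i k i<k
    Oa = Π-O-2D k k<n
  V-U i k i≤ i<k k<n (inj₂ (l , eq , l<k)) = V-resp
    (solve 5 (λ x e a b f → x :* e :* (a :* a :* f) :* b := x :* e :* (a :* a :* b :* f)) refl _ _ _ _ _)
    (V-pole (V-*ʳ (V-*ʳ (V-*ˡ (O-o (cᵢ i ℤ.+ + 3 ℤ.* D ℤ.* + k)) (V-* (V-* (V-* v v) v′) (V-Π-c-2D i k i<k))) (O-E _)) (O-* (O-* Oa Oa) (Π-O-D k k<n)))
      (Π-denominator-pole i k i≤ (ℕ.m≤n⇒m≤1+n (ℕ.<⇒≤ k<n))))
    where
    v = V-Π-c-D i k i<k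
    v′ : V 1 (Π o (D ℤ.- cᵢ i) D k)
    v′ = Π-V o _ D k (λ l → O-o _) l l<k (V-o _ (zero-D-c i l eq))
    Oa = Π-O-2D k k<n

  -- The count of `V-U` applied to the form in `G-suc`: (1/(xQ);Q)_{k+1} takes the role of
  -- (Q/x;Q)_k, and the denominator has k + 2 factors.
  V-G : ∀ i k → i ℕ.≤ m ⊎ 2 ℕ.< d → i ℕ.+ i ℕ.≤ dm → i ℕ.+ i ℕ.< suc k → k ℕ.< n →
    suc (suc k) ℕ.≤ poleIndex i ⊎ (∃ λ l → l ℕ.+ (i ℕ.+ i) ≡ suc n × l ℕ.< suc k) → V 3 (G (cᵢ i) (suc k))
  V-G i k nz i≤ i<k k<n side = V-resp (sym (trans (G-suc (cᵢ i) (pole≢0 i nz) k)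
    (solve 12 (λ p w q u r v e a b f X P →
        p :* p :* q :* r :* e :* (a :* a :* b :* f) :* (w :* w :* u :* v) :* X :* P
        := (p :* w) :* (p :* w) :* (q :* u) :* (r :* v) :* (e :* (a :* a :* f) :* X :* P) :* b) refl
        (Π o (cᵢ i) D k) (o (cᵢ i ℤ.+ D ℤ.* + k)) (Π o (ℤ.- cᵢ i ℤ.- D) D k) (o (ℤ.- cᵢ i ℤ.- D ℤ.+ D ℤ.* + k))
        (Π o (cᵢ i) 2D k) (o (cᵢ i ℤ.+ 2D ℤ.* + k)) (E (D ℤ.* + triangle k)) (Π io 2D 2D k)
        (Π io (+ 2 ℤ.* cᵢ i ℤ.+ D) 2D (suc (suc k))) (Π io D D k) (E (D ℤ.* + suc k)) (P (E (cᵢ i)) (E D) (E (D ℤ.* + suc k))))))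
    (go side)
    where
    v = V-Π-c-D i (suc k) i<k
    Oa = Π-O-2D k k<n
    Oz = O-* (O-* (O-* (O-E (D ℤ.* + triangle k)) (O-* (O-* Oa Oa) (Π-O-D k k<n))) (O-E (D ℤ.* + suc k)))
             (O-P (O-E (cᵢ i)) (O-E D) (O-E (D ℤ.* + suc k)))
    go : suc (suc k) ℕ.≤ poleIndex i ⊎ (∃ λ l → l ℕ.+ (i ℕ.+ i) ≡ suc n × l ℕ.< suc k) → V 3 _
    go (inj₁ k≤) = V-*ʳ (V-*ʳ (V-* (V-*ʳ (V-* v v) (O-Π _ D (suc k))) (V-Π-c-2D i (suc k) i<k)) Oz) (Π-denominator i (suc (suc k)) i≤ k≤)
    go (inj₂ (l , eq , l<k)) = V-pole (V-*ʳ (V-* (V-* (V-* v v) v′) (V-Π-c-2D i (suc k) i<k)) Oz) (Π-denominator-pole i (suc (suc k)) i≤ (s≤s k<n))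
      where
      v′ : V 1 (Π o (ℤ.- cᵢ i ℤ.- D) D (suc k))
      v′ = Π-V o _ D (suc k) (λ l → O-o _) l l<k (V-o _ (zero--c-D i l eq))

  module _ (i : ℕ) (i≤ : suc i ℕ.+ suc i ℕ.≤ dm) where
    private
      c′ = cᵢ (suc i)
      N∤c : ¬ N ∣ c′
      N∤c = ∤-c i (ℕ.<-≤-trans (s≤s (ℕ.m≤m+n (suc i) (suc i))) (s≤s (ℕ.≤-trans i≤ (ℕ.m≤m+n dm dm))))
      N∤c+D : ¬ N ∣ c′ ℤ.+ D
      N∤c+D = ∤-c+D i (s≤s (ℕ.≤-trans (s≤s (ℕ.+-monoʳ-≤ i (ℕ.n≤1+n i))) (ℕ.≤-trans i≤ (ℕ.m≤m+n dm dm))))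
      -c-D≡ : ∀ c D → ℤ.- (c ℤ.+ D) ≡ ℤ.- c ℤ.- D
      -c-D≡ = solve-∀
      N∤-c-D : ¬ N ∣ ℤ.- c′ ℤ.- D
      N∤-c-D = ≡.subst (λ e → ¬ N ∣ e) (-c-D≡ c′ D) (∤⇒∤- N∤c+D)
      i₁ i₂ i₃ ε : Carrier
      i₁ = io (ℤ.- c′ ℤ.- D)
      i₂ = io (ℤ.- c′)
      i₃ = io c′
      ε = E (ℤ.- (c′ ℤ.+ D))

    E-inverse : ∀ e → E e * E (ℤ.- e) ≈ 1#
    E-inverse e = trans (sym (E-+ e (ℤ.- e))) (trans (reflexive (≡.cong E (ℤ.+-inverseʳ e))) E-0)

    -- N divides neither the exponent of x nor that of xQ at `cᵢ (suc i)`, so `κ` is a unit of `O`.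
    -- At `cᵢ 0`, where x = q^n, it is a multiple of t⁴ instead.
    κ-cancel : ∀ {x} → V 3 (κ c′ * x) → V 3 x
    κ-cancel = V-cancel {y = κ c′} {ε * i₁ * i₂ * (i₃ * i₃ * i₃)} (begin
      ε * i₁ * i₂ * (i₃ * i₃ * i₃) * (E (c′ ℤ.+ D) * o (ℤ.- c′ ℤ.- D) * o (ℤ.- c′) * (o c′ * o c′ * o c′))
        ≈⟨ solve 8 (λ ε i₁ i₂ i₃ e o₁ o₂ o₃ → ε :* i₁ :* i₂ :* (i₃ :* i₃ :* i₃) :* (e :* o₁ :* o₂ :* (o₃ :* o₃ :* o₃))
             := e :* ε :* (o₁ :* i₁) :* (o₂ :* i₂) :* ((o₃ :* i₃) :* (o₃ :* i₃) :* (o₃ :* i₃)))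
             refl ε i₁ i₂ i₃ (E (c′ ℤ.+ D)) (o (ℤ.- c′ ℤ.- D)) (o (ℤ.- c′)) (o c′) ⟩
      E (c′ ℤ.+ D) * ε * (o (ℤ.- c′ ℤ.- D) * i₁) * (o (ℤ.- c′) * i₂) * ((o c′ * i₃) * (o c′ * i₃) * (o c′ * i₃))
        ≈⟨ *-cong (*-cong (*-cong (E-inverse _) (o-io _ (∤⇒≢0 N∤-c-D))) (o-io _ (∤⇒≢0 (∤⇒∤- N∤c)))) (*-cong (*-cong oi oi) oi) ⟩
      1# * 1# * 1# * (1# * 1# * 1#)
        ≈⟨ solve 0 (con (+ 1) :* con (+ 1) :* con (+ 1) :* (con (+ 1) :* con (+ 1) :* con (+ 1)) := con (+ 1)) refl ⟩
      1# ∎)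
      (O-* (O-* (O-* (O-E _) (io-O _ N∤-c-D)) (io-O _ (∤⇒∤- N∤c))) (O-* (O-* Oi Oi) Oi))
      where
      oi = o-io _ (∤⇒≢0 N∤c)
      Oi = io-O _ N∤c

    -- The reciprocal of `r` has only x and (1 - xQ)² as denominators, both units. The tail divides
    -- by `r`, whereas the short sum multiplies by it.
    r-cancel : (nz : suc i ℕ.≤ m ⊎ 2 ℕ.< d) → ∀ {x} → V 3 (r c′ * x) → V 3 x
    r-cancel nz = V-cancel {y = r c′} {(- E (ℤ.- c′)) * (j * j) * (g * g′)} (begin
      - E (ℤ.- c′) * (j * j) * (g * g′) * (- E c′ * (y * y) * (ig * ig′))
        ≈⟨ solve 8 (λ ε j g g′ e y ig ig′ → :- ε :* (j :* j) :* (g :* g′) :* (:- e :* (y :* y) :* (ig :* ig′))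
             := e :* ε :* ((y :* j) :* (y :* j)) :* ((g :* ig) :* (g′ :* ig′))) refl (E (ℤ.- c′)) j g g′ (E c′) y ig ig′ ⟩
      E c′ * E (ℤ.- c′) * ((y * j) * (y * j)) * ((g * ig) * (g′ * ig′))
        ≈⟨ *-cong (*-cong (E-inverse c′) (*-cong yj yj)) (*-cong (o-io _ nz₀) (o-io _ nz₁)) ⟩
      1# * (1# * 1#) * (1# * 1#)
        ≈⟨ solve 0 (con (+ 1) :* (con (+ 1) :* con (+ 1)) :* (con (+ 1) :* con (+ 1)) := con (+ 1)) refl ⟩
      1# ∎)
      (O-* (O-* (O-neg (O-E _)) (O-* (io-O _ N∤c+D) (io-O _ N∤c+D))) (O-* (O-o _) (O-o _)))
      where
      e₀ = + 2 ℤ.* c′ ℤ.+ D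
      y = o (c′ ℤ.+ D)
      j = io (c′ ℤ.+ D)
      g = o e₀
      g′ = o (e₀ ℤ.+ 2D)
      ig = io e₀
      ig′ = io (e₀ ℤ.+ 2D)
      yj = o-io _ (∤⇒≢0 N∤c+D)
      lem₀ : ∀ e D → e ℤ.+ + 2 ℤ.* D ℤ.* + 0 ≡ e
      lem₀ = solve-∀
      lem₁ : ∀ e D → e ℤ.+ + 2 ℤ.* D ℤ.* + 1 ≡ e ℤ.+ + 2 ℤ.* D
      lem₁ = solve-∀
      nz₀ : e₀ ≢ + 0
      nz₀ = ≡.subst (_≢ + 0) (lem₀ e₀ D) (pole≢0 (suc i) nz 0)
      nz₁ : e₀ ℤ.+ 2D ≢ + 0
      nz₁ = ≡.subst (_≢ + 0) (lem₁ e₀ D) (pole≢0 (suc i) nz 1)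

    -- The denominators of `r` are the first two factors of (x²Q;Q²), and `poleIndex (suc i)` is at
    -- least 2.
    O-r : O (r c′)
    O-r = O-* (O-* (O-neg (O-E _)) (O-* (O-o _) (O-o _))) (O-resp
      (trans (*-congʳ (trans (*-identityˡ _) (reflexive (≡.cong io (lem₀ (+ 2 ℤ.* c′ ℤ.+ D) D))))) (*-congˡ (reflexive (≡.cong io (lem₁ (+ 2 ℤ.* c′ ℤ.+ D) D)))))
      (Π-denominator (suc i) 2 i≤ (ℕ.≤-trans (ℕ.≤-trans (s≤s (s≤s z≤n)) (ℕ.≤-reflexive (≡.sym (≡.cong suc (ℕ.+-suc i i))))) (ℕ.m≤n+m _ dm))))
      where
      lem₀ : ∀ e D → e ℤ.+ + 2 ℤ.* D ℤ.* + 0 ≡ e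
      lem₀ = solve-∀
      lem₁ : ∀ e D → e ℤ.+ + 2 ℤ.* D ℤ.* + 1 ≡ e ℤ.+ + 2 ℤ.* D
      lem₁ = solve-∀

    Σ-step : (nz : suc i ℕ.≤ m ⊎ 2 ℕ.< d) → ∀ k →
      κ c′ * (Σ (U c′) k - r c′ * Σ (U (cᵢ i)) k) ≈ o c′ * G c′ k
    Σ-step nz k = ≡.subst (λ e → κ c′ * (Σ (U c′) k - r c′ * Σ (U e) k) ≈ o c′ * G c′ k) (cᵢ-suc i)
      (Σ-telescope c′ (pole≢0 (suc i) nz) k)

  -- The sum over k ≤ 2m

  R : ℕ → Carrier
  R zero    = 1#
  R (suc i) = r (cᵢ (suc i)) * R i

  -- In the step to i + 1 the boundary at 2m + 1 has passed the zeros, at 2i + 2 ≤ 2m and at i + 1.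
  -- Its 2m + 2 denominator factors stop before the pole at dm + 2i + 2, since 2m ≤ dm.
  head-chain : ∀ i → i ℕ.≤ m → V 3 (Σ (U (cᵢ i)) (suc (m ℕ.+ m)) - t * R i)
  head-chain zero _ = V-resp
    (+-congˡ (-‿cong (begin
      0# + U (cᵢ 0) 0                                              ≈⟨ +-congˡ (*-congʳ (*-cong (*-congʳ (o-cong (lem N D))) (trans (reflexive (≡.cong E (ℤ.*-zeroʳ D))) E-0))) ⟩
      0# + t * (1# * 1# * 1# * 1#) * 1# * (1# * 1# * 1# * 1#)      ≈⟨ solve 1 (λ t → let i = con (+ 1) in con (+ 0) :+ t :* (i :* i :* i :* i) :* i :* (i :* i :* i :* i) := t :* i) refl t ⟩
      t * 1#                                                       ∎)))
    (Σ-V (U (cᵢ 0)) 1 (suc (m ℕ.+ m)) (λ k 1≤k k<K → V-U 0 k z≤n 1≤k (ℕ.<-≤-trans k<K (s≤s (ℕ.≤-trans 2m≤dm (ℕ.m≤m+n dm dm))))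
      (inj₁ (ℕ.≤-trans (ℕ.s≤s⁻¹ k<K) (ℕ.≤-trans 2m≤dm (ℕ.m≤m+n dm 0))))) (s≤s z≤n))
    where
    lem : ∀ N D → N ℤ.- + 2 ℤ.* D ℤ.* + 0 ℤ.+ + 3 ℤ.* D ℤ.* + 0 ≡ N
    lem = solve-∀
  head-chain (suc i) i<m = V-resp
    (solve 5 (λ s r s′ t R → s :- r :* s′ :+ r :* (s′ :- t :* R) := s :- t :* (r :* R)) refl _ _ _ _ _)
    (V-+ (κ-cancel i 2i≤dm (V-resp (sym (Σ-step i 2i≤dm (inj₁ i<m) (suc (m ℕ.+ m)))) (V-*ˡ (O-o _)
           (V-G (suc i) (m ℕ.+ m) (inj₁ i<m) 2i≤dm (s≤s 2i≤2m) (s≤s (ℕ.≤-trans 2m≤dm (ℕ.m≤m+n dm dm)))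
             (inj₁ (ℕ.≤-trans (ℕ.≤-reflexive (ℕ.+-comm 2 (m ℕ.+ m))) (ℕ.+-mono-≤ 2m≤dm (ℕ.≤-trans (s≤s (s≤s z≤n)) (ℕ.≤-reflexive (≡.sym (≡.cong suc (ℕ.+-suc i i))))))))))))
         (V-*ˡ (O-r i 2i≤dm) (head-chain i (ℕ.<⇒≤ i<m))))
    where
    2i≤2m = ℕ.+-mono-≤ i<m i<m
    2i≤dm = ℕ.≤-trans 2i≤2m 2m≤dm

  T : ℕ → Carrier
  T zero    = 1#
  T (suc i) = - E (cᵢ (suc i)) * (o (cᵢ (suc i) ℤ.+ D) * o (cᵢ (suc i) ℤ.+ D)) * T i

  -- Each `r` contributes two consecutive factors of (x²Q;Q²), and one step in i moves x² by Q⁴, so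
  -- the denominators join into one product of length 2i.
  R≈ : ∀ i → R i ≈ T i * Π io (+ 2 ℤ.* cᵢ i ℤ.+ D) 2D (i ℕ.+ i)
  R≈ zero    = sym (*-identityʳ 1#)
  R≈ (suc i) = begin
    τ * (i₁ * i₂) * R i                                            ≈⟨ *-congˡ (R≈ i) ⟩
    τ * (i₁ * i₂) * (T i * Π io (+ 2 ℤ.* cᵢ i ℤ.+ D) 2D (i ℕ.+ i))  ≈⟨ *-congˡ (*-congˡ (Π-base io (lem N D (+ i)) 2D (i ℕ.+ i))) ⟩
    τ * (i₁ * i₂) * (T i * Π io (e₀ ℤ.+ 2D ℤ.+ 2D) 2D (i ℕ.+ i))    ≈⟨ solve 5 (λ τ i₁ i₂ T π → τ :* (i₁ :* i₂) :* (T :* π) := τ :* T :* (i₁ :* i₂ :* π)) refl τ i₁ i₂ (T i) _ ⟩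
    τ * T i * (i₁ * i₂ * Π io (e₀ ℤ.+ 2D ℤ.+ 2D) 2D (i ℕ.+ i))      ≈⟨ *-congˡ (Π-head₂ io e₀ 2D (i ℕ.+ i)) ⟨
    τ * T i * Π io e₀ 2D (suc (suc (i ℕ.+ i)))                      ≡⟨ ≡.cong (λ k → τ * T i * Π io e₀ 2D (suc k)) (≡.sym (ℕ.+-suc i i)) ⟩
    τ * T i * Π io e₀ 2D (suc i ℕ.+ suc i)                          ∎
    where
    e₀ = + 2 ℤ.* cᵢ (suc i) ℤ.+ D
    τ = - E (cᵢ (suc i)) * (o (cᵢ (suc i) ℤ.+ D) * o (cᵢ (suc i) ℤ.+ D))
    i₁ = io e₀
    i₂ = io (e₀ ℤ.+ 2D)
    lem : ∀ N D i → + 2 ℤ.* (N ℤ.- + 2 ℤ.* D ℤ.* i) ℤ.+ D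
        ≡ + 2 ℤ.* (N ℤ.- + 2 ℤ.* D ℤ.* (+ 1 ℤ.+ i)) ℤ.+ D ℤ.+ + 2 ℤ.* D ℤ.+ + 2 ℤ.* D
    lem = solve-∀

  -- Where the second half of the denominators in `R≈` starts: 2 cᵢ + D + 2Di. The first half
  -- survives in `closedForm`; the second is absorbed by `T` in `reflect`.
  aᵢ : ℕ → ℤ
  aᵢ i = + 2 ℤ.* N ℤ.+ D ℤ.- + 2 ℤ.* D ℤ.* + i

  F : ℕ → Carrier
  F i = E (+ i ℤ.* (N ℤ.+ D) ℤ.- + 2 ℤ.* D ℤ.* + i ℤ.* (+ i ℤ.+ + 1)) * Π o D 2D i

  -- With u = q^n and z = q^{-(2i+1)d}: (1 - uz)² + (z - 1)(1 - u²z) = z (1 - u)².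
  reflect : ∀ i → i ℕ.≤ m → V 2 (T i * Π io (aᵢ i) 2D i - F i)
  reflect zero _ = V-resp (sym (begin
    1# * 1# - E (+ 0 ℤ.* (N ℤ.+ D) ℤ.- + 2 ℤ.* D ℤ.* + 0 ℤ.* (+ 0 ℤ.+ + 1)) * 1#
      ≈⟨ +-congˡ (-‿cong (*-congʳ (trans (reflexive (≡.cong E (lem N D))) E-0))) ⟩
    1# * 1# - 1# * 1#  ≈⟨ -‿inverseʳ _ ⟩
    0#                 ≈⟨ zeroʳ _ ⟨
    t * (t * 1#) * 0#  ∎)) (val 0# (O-resp (-‿inverseʳ 1#) (O-+ O-1 (O-neg O-1))) refl)
    where
    lem : ∀ N D → + 0 ℤ.* (N ℤ.+ D) ℤ.- + 2 ℤ.* D ℤ.* + 0 ℤ.* (+ 0 ℤ.+ + 1) ≡ + 0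
    lem = solve-∀
  reflect (suc i) i<m = V-resp
    (sym (begin
      τ * T i * Π io a 2D (suc i) - E ex′ * (Π o D 2D i * w)
        ≈⟨ +-cong (*-congˡ (trans (Π-head io a 2D i) (*-congˡ (Π-base io (a≡ N D (+ i)) 2D i)))) (-‿cong (*-congʳ (trans (reflexive (≡.cong E (ex≡ N D (+ i)))) (E-+ ex (c′ ℤ.- b))))) ⟩
      τ * T i * (j * π) - E ex * E (c′ ℤ.- b) * (Π o D 2D i * w)
        ≈⟨ solve 8 (λ τ T j π e e′ p w → τ :* T :* (j :* π) :- e :* e′ :* (p :* w)
             := τ :* j :* (T :* π :- e :* p) :+ (τ :* j :- e′ :* w) :* (e :* p)) refl τ (T i) j π (E ex) (E (c′ ℤ.- b)) (Π o D 2D i) w ⟩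
      τ * j * (T i * π - F i) + (τ * j - E (c′ ℤ.- b) * w) * F i ∎))
    (V-+ (V-*ˡ (O-* (O-* (O-neg (O-E _)) (O-* (O-o _) (O-o _))) Oj) (reflect i (ℕ.<⇒≤ i<m)))
         (V-*ʳ (V-resp (sym diff) (V-*ˡ (O-neg (O-* (O-E c′) (O-E (ℤ.- b)))) (V-*ʳ (V-* Vt Vt) Oj))) (O-* (O-E _) (O-Π D 2D i))))
    where
    c′ = cᵢ (suc i)
    τ = - E c′ * (o (c′ ℤ.+ D) * o (c′ ℤ.+ D))
    a = aᵢ (suc i)
    b = D ℤ.+ 2D ℤ.* + i
    w = o b
    j = io a
    π = Π io (aᵢ i) 2D i
    ex = + i ℤ.* (N ℤ.+ D) ℤ.- + 2 ℤ.* D ℤ.* + i ℤ.* (+ i ℤ.+ + 1)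
    ex′ = + suc i ℤ.* (N ℤ.+ D) ℤ.- + 2 ℤ.* D ℤ.* + suc i ℤ.* (+ suc i ℤ.+ + 1)
    a≡ : ∀ N D i → + 2 ℤ.* N ℤ.+ D ℤ.- + 2 ℤ.* D ℤ.* (+ 1 ℤ.+ i) ℤ.+ + 2 ℤ.* D ≡ + 2 ℤ.* N ℤ.+ D ℤ.- + 2 ℤ.* D ℤ.* i
    a≡ = solve-∀
    ex≡ : ∀ N D i → (+ 1 ℤ.+ i) ℤ.* (N ℤ.+ D) ℤ.- + 2 ℤ.* D ℤ.* (+ 1 ℤ.+ i) ℤ.* (+ 1 ℤ.+ i ℤ.+ + 1)
        ≡ i ℤ.* (N ℤ.+ D) ℤ.- + 2 ℤ.* D ℤ.* i ℤ.* (i ℤ.+ + 1) ℤ.+ (N ℤ.- + 2 ℤ.* D ℤ.* (+ 1 ℤ.+ i) ℤ.- (D ℤ.+ + 2 ℤ.* D ℤ.* i))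
    ex≡ = solve-∀
    N∤a : ¬ N ∣ a
    N∤a N∣a = ∤-odd (+ 2 ℤ.* N) i (∣n⇒∣m*n (+ 2) N∣N)
      (s≤s (ℕ.≤-trans (s≤s (ℕ.+-monoʳ-≤ i (ℕ.n≤1+n i))) (ℕ.≤-trans (ℕ.+-mono-≤ i<m i<m) (ℕ.≤-trans 2m≤dm (ℕ.m≤m+n dm dm)))))
      (≡.subst (N ∣_) (lem N D (+ i)) N∣a)
      where
      lem : ∀ N D i → + 2 ℤ.* N ℤ.+ D ℤ.- + 2 ℤ.* D ℤ.* (+ 1 ℤ.+ i) ≡ + 2 ℤ.* N ℤ.- D ℤ.* (+ 1 ℤ.+ (i ℤ.+ i))
      lem = solve-∀
    Oj = io-O a N∤a
    Vt : V 1 t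
    Vt = V-o N N∣N
    u = E N
    z = E (ℤ.- b)
    y≡ : ∀ N D i → N ℤ.- + 2 ℤ.* D ℤ.* (+ 1 ℤ.+ i) ℤ.+ D ≡ N ℤ.+ ℤ.- (D ℤ.+ + 2 ℤ.* D ℤ.* i)
    y≡ = solve-∀
    a≡′ : ∀ N D i → + 2 ℤ.* N ℤ.+ D ℤ.- + 2 ℤ.* D ℤ.* (+ 1 ℤ.+ i) ≡ N ℤ.+ (N ℤ.+ ℤ.- (D ℤ.+ + 2 ℤ.* D ℤ.* i))
    a≡′ = solve-∀
    y≈ : o (c′ ℤ.+ D) ≈ 1# - u * z
    y≈ = +-congˡ (-‿cong (trans (reflexive (≡.cong E (y≡ N D (+ i)))) (E-+ _ _)))
    a≈ : o a ≈ 1# - u * (u * z)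
    a≈ = +-congˡ (-‿cong (trans (reflexive (≡.cong E (a≡′ N D (+ i)))) (trans (E-+ _ _) (*-congˡ (E-+ _ _)))))
    zw≈ : z * w ≈ z - 1#
    zw≈ = begin
      z * (1# - E b)   ≈⟨ solve 2 (λ z y → z :* (con (+ 1) :- y) := z :- z :* y) refl z (E b) ⟩
      z - z * E b      ≈⟨ +-congˡ (-‿cong (trans (sym (E-+ _ _)) (trans (reflexive (≡.cong E (ℤ.+-inverseˡ b))) E-0))) ⟩
      z - 1#           ∎
    diff : τ * j - E (c′ ℤ.- b) * w ≈ - (E c′ * z) * (t * t * j)
    diff = begin
      τ * j - E (c′ ℤ.- b) * w                       ≈⟨ +-congˡ (-‿cong (*-congʳ (E-+ c′ (ℤ.- b)))) ⟩
      τ * j - E c′ * z * w                           ≈⟨ +-congˡ (-‿cong (trans (*-assoc _ _ _) (*-congˡ zw≈))) ⟩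
      τ * j - E c′ * (z - 1#)                        ≈⟨ +-congˡ (-‿cong (*-identityʳ _)) ⟨
      τ * j - E c′ * (z - 1#) * 1#                   ≈⟨ +-congˡ (-‿cong (*-congˡ (o-io a (∤⇒≢0 N∤a)))) ⟨
      τ * j - E c′ * (z - 1#) * (o a * j)            ≈⟨ +-cong (*-congʳ (*-congˡ (*-cong y≈ y≈))) (-‿cong (*-congˡ (*-congʳ a≈))) ⟩
      - E c′ * ((1# - u * z) * (1# - u * z)) * j - E c′ * (z - 1#) * ((1# - u * (u * z)) * j)
        ≈⟨ solve 4 (λ e u z j → let i = con (+ 1) in
             :- e :* ((i :- u :* z) :* (i :- u :* z)) :* j :- e :* (z :- i) :* ((i :- u :* (u :* z)) :* j)
             := :- (e :* z) :* ((i :- u) :* (i :- u) :* j)) refl (E c′) u z j ⟩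
      - (E c′ * z) * (t * t * j) ∎

  -- 1 - q times the right-hand side of the theorem: at i = m the exponent in `F` collapses to m -
  -- dm = -(n - 1)(d - 1)/(2d).
  closedForm : Carrier
  closedForm = t * (Π io (+ 2 ℤ.+ D) 2D m * (E (M ℤ.- D ℤ.* M) * Π o D 2D m))

  short-sum : V 3 (Σ (U (+ 1)) (suc (m ℕ.+ m)) - closedForm)
  short-sum = ≡.subst (λ e → V 3 (Σ (U e) (suc (m ℕ.+ m)) - closedForm)) cᵢ-m (V-resp
    (solve 3 (λ s x y → s :- x :+ (x :- y) := s :- y) refl _ _ _)
    -- The explicit t lifts `reflect` from modulo t² to modulo t³.
    (V-+ (head-chain m ℕ.≤-refl) (V-resp (sym eq) (V-* (V-o N N∣N) (V-*ˡ OI (reflect m ℕ.≤-refl))))))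
    where
    I = Π io (+ 2 ℤ.* cᵢ m ℤ.+ D) 2D m
    OI : O I
    OI = Π-denominator m m 2m≤dm (ℕ.≤-trans (ℕ.m≤m+n m m) (ℕ.m≤n+m _ dm))
    base≡ : + 2 ℤ.* cᵢ m ℤ.+ D ≡ + 2 ℤ.+ D
    base≡ = ≡.cong (λ e → + 2 ℤ.* e ℤ.+ D) cᵢ-m
    a≡ : ∀ N D M → + 2 ℤ.* (N ℤ.- + 2 ℤ.* D ℤ.* M) ℤ.+ D ℤ.+ + 2 ℤ.* D ℤ.* M ≡ + 2 ℤ.* N ℤ.+ D ℤ.- + 2 ℤ.* D ℤ.* M
    a≡ = solve-∀
    ex≡ : ∀ D M → M ℤ.* (+ 1 ℤ.+ + 2 ℤ.* D ℤ.* M ℤ.+ D) ℤ.- + 2 ℤ.* D ℤ.* M ℤ.* (M ℤ.+ + 1) ≡ M ℤ.- D ℤ.* M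
    ex≡ = solve-∀
    F≈ : F m ≈ E (M ℤ.- D ℤ.* M) * Π o D 2D m
    F≈ = *-congʳ (reflexive (≡.cong E (≡.trans (≡.cong (λ e → M ℤ.* (e ℤ.+ D) ℤ.- + 2 ℤ.* D ℤ.* M ℤ.* (M ℤ.+ + 1)) N≡) (ex≡ D M))))
    eq : t * R m - closedForm ≈ t * (I * (T m * Π io (aᵢ m) 2D m - F m))
    eq = begin
      t * R m - closedForm
        ≈⟨ +-cong (*-congˡ (trans (R≈ m) (*-congˡ (trans (Π-+ io (+ 2 ℤ.* cᵢ m ℤ.+ D) 2D m m) (*-congˡ (Π-base io (a≡ N D M) 2D m))))))
                  (-‿cong (*-congˡ (*-cong (Π-base io (≡.sym base≡) 2D m) (sym F≈)))) ⟩
      t * (T m * (I * Π io (aᵢ m) 2D m)) - t * (I * F m)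
        ≈⟨ solve 5 (λ t T I π F → t :* (T :* (I :* π)) :- t :* (I :* F) := t :* (I :* (T :* π :- F))) refl t (T m) I (Π io (aᵢ m) 2D m) (F m) ⟩
      t * (I * (T m * Π io (aᵢ m) 2D m - F m)) ∎

  -- The tail of the full sum

  L : ℕ
  L = suc (dm ℕ.+ (m ℕ.+ m))

  -- The sum over L ≤ k < n. `L` is `poleIndex m` + 1, the first k for which the denominator at x =
  -- q contains its pole.
  W : ℕ → Carrier
  W i = Σ (U (cᵢ i)) n - Σ (U (cᵢ i)) L

  hm = h ℕ.* m

  2hm≤dm : hm ℕ.+ hm ℕ.≤ dm
  2hm≤dm = ℕ.≤-trans (ℕ.≤-reflexive (≡.sym (ℕ.*-distribʳ-+ m h h))) (ℕ.*-monoˡ-≤ m 2h≤d)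

  L≤n : L ℕ.≤ n
  L≤n = s≤s (ℕ.+-monoʳ-≤ dm 2m≤dm)

  dm<L : dm ℕ.< L
  dm<L = s≤s (ℕ.m≤m+n dm _)

  -- Lowering the base point x far enough moves the pole of the summand past its extra zero.
  tail-start : V 3 (W hm)
  tail-start = Σ-V (U (cᵢ hm)) L n (λ k L≤k k<n → V-U hm k 2hm≤dm (ℕ.≤-<-trans 2hm≤dm (ℕ.<-≤-trans dm<L L≤k)) k<n (side k)) L≤n
    where
    l = dm ℕ.+ dm ℕ.∸ (hm ℕ.+ hm)
    l≡ : suc (l ℕ.+ (hm ℕ.+ hm)) ≡ n
    l≡ = ≡.cong suc (ℕ.m∸n+n≡m (ℕ.≤-trans 2hm≤dm (ℕ.m≤m+n dm dm)))
    d≤4h : d ℕ.≤ (h ℕ.+ h) ℕ.+ (h ℕ.+ h)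
    d≤4h = ℕ.≤-trans d≤2h+1 (ℕ.≤-trans (ℕ.≤-reflexive (ℕ.+-comm 1 (h ℕ.+ h))) (ℕ.+-monoʳ-≤ (h ℕ.+ h) (ℕ.≤-trans 1≤h (ℕ.m≤m+n h h))))
    dm≤4hm : dm ℕ.≤ (hm ℕ.+ hm) ℕ.+ (hm ℕ.+ hm)
    dm≤4hm = ℕ.≤-trans (ℕ.*-monoˡ-≤ m d≤4h) (ℕ.≤-reflexive (≡.trans (ℕ.*-distribʳ-+ m (h ℕ.+ h) (h ℕ.+ h)) (≡.cong₂ ℕ._+_ (ℕ.*-distribʳ-+ m h h) (ℕ.*-distribʳ-+ m h h))))
    l≤pole : l ℕ.≤ poleIndex hm
    l≤pole = ℕ.≤-trans (ℕ.∸-monoˡ-≤ (hm ℕ.+ hm) (ℕ.+-monoʳ-≤ dm dm≤4hm))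
      (ℕ.≤-reflexive (≡.trans (≡.cong (ℕ._∸ (hm ℕ.+ hm)) (≡.sym (ℕ.+-assoc dm (hm ℕ.+ hm) (hm ℕ.+ hm)))) (ℕ.m+n∸n≡m (dm ℕ.+ (hm ℕ.+ hm)) (hm ℕ.+ hm))))
    side : ∀ k → k ℕ.≤ poleIndex hm ⊎ (∃ λ l → suc (l ℕ.+ (hm ℕ.+ hm)) ≡ n × l ℕ.< k)
    side k with k ℕ.≤? poleIndex hm
    ... | yes k≤ = inj₁ k≤
    ... | no  k≰ = inj₂ (l , l≡ , ℕ.≤-<-trans l≤pole (ℕ.≰⇒> k≰))

  -- W (i + 1) - r W i is the boundary at n minus that at `L`, up to a unit multiple. At `L` the
  -- order is three because i ≥ m keeps the pole out of the L + 1 denominator factors, at n because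
  -- the zero of (Q/x;Q) compensates the pole.
  tail-step : ∀ i → m ℕ.≤ i → i ℕ.< hm → V 3 (W (suc i)) → V 3 (W i)
  tail-step i m≤i i<hm Vw = r-cancel i 2i≤dm nz (V-resp
    (solve 5 (λ s s′ s₁ s₁′ r → (s :- s′) :- ((s :- r :* s₁) :- (s′ :- r :* s₁′)) := r :* (s₁ :- s₁′)) refl _ _ _ _ _)
    (V-+ Vw (V-neg (V-+ (sub n (V-G (suc i) (dm ℕ.+ dm) nz 2i≤dm (s≤s (ℕ.≤-trans 2i≤dm (ℕ.m≤m+n dm dm))) ℕ.≤-refl (inj₂ (l , l≡ , l<n))))
      (V-neg (sub L (V-G (suc i) (dm ℕ.+ (m ℕ.+ m)) nz 2i≤dm (ℕ.≤-<-trans 2i≤dm dm<L) L≤n (inj₁ L<pole))))))))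
    where
    2i≤dm : suc i ℕ.+ suc i ℕ.≤ dm
    2i≤dm = ℕ.≤-trans (ℕ.+-mono-≤ i<hm i<hm) 2hm≤dm
    1<h : 1 ℕ.< h
    1<h = ℕ.*-cancelʳ-< m 1 h (ℕ.≤-<-trans (ℕ.≤-trans (ℕ.≤-reflexive (ℕ.+-identityʳ m)) m≤i) i<hm)
    -- m ≤ i < hm forces h ≥ 2, hence d ≥ 4.
    nz : suc i ℕ.≤ m ⊎ 2 ℕ.< d
    nz = inj₂ (ℕ.≤-trans (ℕ.n≤1+n 3) (ℕ.≤-trans (ℕ.+-mono-≤ 1<h 1<h) 2h≤d))
    sub : ∀ k → V 3 (G (cᵢ (suc i)) k) → V 3 (Σ (U (cᵢ (suc i))) k - r (cᵢ (suc i)) * Σ (U (cᵢ i)) k)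
    sub k Vg = κ-cancel i 2i≤dm (V-resp (sym (Σ-step i 2i≤dm nz k)) (V-*ˡ (O-o _) Vg))
    l = suc n ℕ.∸ (suc i ℕ.+ suc i)
    l≡ : l ℕ.+ (suc i ℕ.+ suc i) ≡ suc n
    l≡ = ℕ.m∸n+n≡m (ℕ.≤-trans 2i≤dm (ℕ.≤-trans (ℕ.m≤m+n dm dm) (ℕ.≤-trans (ℕ.n≤1+n _) (ℕ.n≤1+n _))))
    l<n : l ℕ.< n
    l<n = ≡.subst (λ k → suc n ℕ.∸ suc k ℕ.< n) (≡.sym (ℕ.+-suc i i)) (s≤s (ℕ.m∸n≤m (dm ℕ.+ dm) (i ℕ.+ i)))
    L<pole : suc L ℕ.≤ poleIndex (suc i)
    L<pole = ℕ.≤-trans (ℕ.≤-reflexive (≡.sym (≡.trans (≡.cong (dm ℕ.+_) (≡.cong suc (ℕ.+-suc m m))) (≡.trans (ℕ.+-suc dm _) (≡.cong suc (ℕ.+-suc dm _))))))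
      (ℕ.+-monoʳ-≤ dm (ℕ.+-mono-≤ (s≤s m≤i) (s≤s m≤i)))

  tail : ∀ k i → k ℕ.+ i ≡ hm → m ℕ.≤ i → V 3 (W i)
  tail zero    i eq m≤i = ≡.subst (λ i → V 3 (W i)) (≡.sym eq) tail-start
  tail (suc k) i eq m≤i = tail-step i m≤i (ℕ.≤-trans (s≤s (ℕ.m≤n+m i k)) (ℕ.≤-reflexive eq))
    (tail k (suc i) (≡.trans (ℕ.+-suc k i) eq) (ℕ.m≤n⇒m≤1+n m≤i))

  -- For 2m < k < L the summand at x = q has its three zeros and no pole; from `L` on, `tail`
  -- applies.
  full-sum : V 3 (Σ (U (+ 1)) n - closedForm)
  full-sum = V-resp
    (solve 4 (λ s₁ s₂ s₃ c → (s₁ :- s₂) :+ ((s₂ :- s₃) :+ (s₃ :- c)) := s₁ :- c) refl _ _ _ _)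
    (V-+ (≡.subst (λ e → V 3 (Σ (U e) n - Σ (U e) L)) cᵢ-m (tail (hm ℕ.∸ m) m (ℕ.m∸n+n≡m m≤hm) ℕ.≤-refl))
      (V-+ (≡.subst (λ e → V 3 (Σ (U e) L - Σ (U e) (suc (m ℕ.+ m)))) cᵢ-m
             (Σ-V (U (cᵢ m)) (suc (m ℕ.+ m)) L (λ k K≤k k<L → V-U m k 2m≤dm K≤k (ℕ.<-≤-trans k<L L≤n) (inj₁ (ℕ.s≤s⁻¹ k<L))) (s≤s (ℕ.m≤n+m (m ℕ.+ m) dm))))
        short-sum))
    where
    m≤hm : m ℕ.≤ hm
    m≤hm = ℕ.≤-trans (ℕ.≤-reflexive (≡.sym (ℕ.+-identityʳ m))) (ℕ.*-monoˡ-≤ m 1≤h)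

-- The polynomial ring and its fractions

-- A record, unlike the Π-type _≈P_, lets the two sides be inferred from a proof.
infix 4 _≋_
record _≋_ (p r : Poly) : Set where
  constructor coeffwise
  field coeff≡ : p ≈P r
open _≋_ public

coeff-+ : ∀ p r i → coeff (p +P r) i ≡ coeff p i ℤ.+ coeff r i
coeff-+ []      r       i       = ≡.sym (ℤ.+-identityˡ _)
coeff-+ (a ∷ p) []      i       = ≡.sym (ℤ.+-identityʳ _)
coeff-+ (a ∷ p) (b ∷ r) zero    = ≡.refl
coeff-+ (a ∷ p) (b ∷ r) (suc i) = coeff-+ p r i

coeff-scale : ∀ c p i → coeff (scaleP c p) i ≡ c ℤ.* coeff p i
coeff-scale c []      i       = ≡.sym (ℤ.*-zeroʳ c)
coeff-scale c (a ∷ p) zero    = ≡.refl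
coeff-scale c (a ∷ p) (suc i) = coeff-scale c p i

coeff-neg : ∀ p i → coeff (negP p) i ≡ ℤ.- coeff p i
coeff-neg p i = ≡.trans (coeff-scale (ℤ.- (+ 1)) p i) (ℤ.-1*i≡-i (coeff p i))

coeff-∷-* : ∀ a p r i → coeff ((a ∷ p) *P r) i ≡ a ℤ.* coeff r i ℤ.+ coeff (+ 0 ∷ p *P r) i
coeff-∷-* a p r i = ≡.trans (coeff-+ (scaleP a r) (+ 0 ∷ p *P r) i) (≡.cong (ℤ._+ coeff (+ 0 ∷ p *P r) i) (coeff-scale a r i))

shift-cong : ∀ {p r} → p ≋ r → + 0 ∷ p ≋ + 0 ∷ r
shift-cong p≋r = coeffwise λ { zero → ≡.refl ; (suc i) → coeff≡ p≋r i }

≋-refl : ∀ {p} → p ≋ p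
≋-refl = coeffwise λ i → ≡.refl

≋-sym : ∀ {p r} → p ≋ r → r ≋ p
≋-sym e = coeffwise λ i → ≡.sym (coeff≡ e i)

≋-trans : ∀ {p r s} → p ≋ r → r ≋ s → p ≋ s
≋-trans e f = coeffwise λ i → ≡.trans (coeff≡ e i) (coeff≡ f i)

+P-cong : ∀ {p p′ r r′} → p ≋ p′ → r ≋ r′ → p +P r ≋ p′ +P r′
+P-cong {p} {p′} {r} {r′} e f = coeffwise λ i → ≡.trans (coeff-+ p r i)
  (≡.trans (≡.cong₂ ℤ._+_ (coeff≡ e i) (coeff≡ f i)) (≡.sym (coeff-+ p′ r′ i)))

scaleP-cong : ∀ c {p r} → p ≋ r → scaleP c p ≋ scaleP c r
scaleP-cong c {p} {r} e = coeffwise λ i → ≡.trans (coeff-scale c p i) (≡.trans (≡.cong (c ℤ.*_) (coeff≡ e i)) (≡.sym (coeff-scale c r i)))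

+P-comm : ∀ p r → p +P r ≋ r +P p
+P-comm p r = coeffwise λ i → ≡.trans (coeff-+ p r i) (≡.trans (ℤ.+-comm (coeff p i) (coeff r i)) (≡.sym (coeff-+ r p i)))

+P-assoc : ∀ p r s → (p +P r) +P s ≋ p +P (r +P s)
+P-assoc p r s = coeffwise λ i → ≡.trans (coeff-+ (p +P r) s i) (≡.trans (≡.cong (ℤ._+ coeff s i) (coeff-+ p r i))
  (≡.trans (ℤ.+-assoc (coeff p i) (coeff r i) (coeff s i)) (≡.sym (≡.trans (coeff-+ p (r +P s) i) (≡.cong (λ a → coeff p i ℤ.+ a) (coeff-+ r s i))))))

+P-inverseʳ : ∀ p → p -P p ≋ zeroP
+P-inverseʳ p = coeffwise λ i → ≡.trans (coeff-+ p (negP p) i) (≡.trans (≡.cong (λ a → coeff p i ℤ.+ a) (coeff-neg p i)) (ℤ.+-inverseʳ (coeff p i)))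

*P-zeroʳ : ∀ p → p *P [] ≋ []
*P-zeroʳ []      = ≋-refl
*P-zeroʳ (a ∷ p) = coeffwise λ { zero → ≡.refl ; (suc i) → coeff≡ (*P-zeroʳ p) i }

*P-congˡ : ∀ p {r r′} → r ≋ r′ → p *P r ≋ p *P r′
*P-congˡ []      e = ≋-refl
*P-congˡ (a ∷ p) e = +P-cong (scaleP-cong a e) (shift-cong (*P-congˡ p e))

*P-∷ : ∀ p b r → p *P (b ∷ r) ≋ scaleP b p +P (+ 0 ∷ p *P r)
*P-∷ []      b r = coeffwise λ { zero → ≡.refl ; (suc i) → ≡.refl }
*P-∷ (a ∷ p) b r = coeffwise go
  where
  swap : ∀ x y z → x ℤ.+ (y ℤ.+ z) ≡ y ℤ.+ (x ℤ.+ z)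
  swap = solve-∀
  go : (a ∷ p) *P (b ∷ r) ≈P scaleP b (a ∷ p) +P (+ 0 ∷ (a ∷ p) *P r)
  go zero    = ≡.cong (ℤ._+ + 0) (ℤ.*-comm a b)
  go (suc i) = ≡.trans (coeff-+ (scaleP a r) (p *P (b ∷ r)) i)
    (≡.trans (≡.cong₂ ℤ._+_ (coeff-scale a r i) (≡.trans (coeff≡ (*P-∷ p b r) i) (coeff-+ (scaleP b p) (+ 0 ∷ p *P r) i)))
    (≡.trans (swap (a ℤ.* coeff r i) (coeff (scaleP b p) i) (coeff (+ 0 ∷ p *P r) i))
    (≡.trans (≡.cong (λ x → coeff (scaleP b p) i ℤ.+ x) (≡.sym (coeff-∷-* a p r i))) (≡.sym (coeff-+ (scaleP b p) ((a ∷ p) *P r) i)))))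

*P-comm : ∀ p r → p *P r ≋ r *P p
*P-comm []      r = ≋-sym (*P-zeroʳ r)
*P-comm (a ∷ p) r = ≋-trans (+P-cong ≋-refl (shift-cong (*P-comm p r))) (≋-sym (*P-∷ r a p))

*P-cong : ∀ {p p′ r r′} → p ≋ p′ → r ≋ r′ → p *P r ≋ p′ *P r′
*P-cong {p} {p′} {r} {r′} e f = ≋-trans (*P-congˡ p f) (≋-trans (*P-comm p r′) (≋-trans (*P-congˡ r′ e) (*P-comm r′ p′)))

*P-distribˡ : ∀ p r s → p *P (r +P s) ≋ p *P r +P p *P s
*P-distribˡ []      r s = ≋-refl
*P-distribˡ (a ∷ p) r s = coeffwise λ i → ≡.trans (coeff-∷-* a p (r +P s) i)
  (≡.trans (≡.cong₂ ℤ._+_ (≡.cong (a ℤ.*_) (coeff-+ r s i)) (go i))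
  (≡.trans (lem a (coeff r i) (coeff s i) (coeff (+ 0 ∷ p *P r) i) (coeff (+ 0 ∷ p *P s) i))
  (≡.sym (≡.trans (coeff-+ ((a ∷ p) *P r) ((a ∷ p) *P s) i) (≡.cong₂ ℤ._+_ (coeff-∷-* a p r i) (coeff-∷-* a p s i))))))
  where
  lem : ∀ a x y u v → a ℤ.* (x ℤ.+ y) ℤ.+ (u ℤ.+ v) ≡ (a ℤ.* x ℤ.+ u) ℤ.+ (a ℤ.* y ℤ.+ v)
  lem = solve-∀
  go : ∀ i → coeff (+ 0 ∷ p *P (r +P s)) i ≡ coeff (+ 0 ∷ p *P r) i ℤ.+ coeff (+ 0 ∷ p *P s) i
  go zero    = ≡.refl
  go (suc i) = ≡.trans (coeff≡ (*P-distribˡ p r s) i) (coeff-+ (p *P r) (p *P s) i)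

*P-distribʳ : ∀ p r s → (r +P s) *P p ≋ r *P p +P s *P p
*P-distribʳ p r s = ≋-trans (*P-comm (r +P s) p) (≋-trans (*P-distribˡ p r s) (+P-cong (*P-comm p r) (*P-comm p s)))

shift-* : ∀ p r → (+ 0 ∷ p) *P r ≋ + 0 ∷ p *P r
shift-* p r = coeffwise λ i → ≡.trans (coeff-∷-* (+ 0) p r i) (≡.trans (≡.cong (ℤ._+ coeff (+ 0 ∷ p *P r) i) (ℤ.*-zeroˡ (coeff r i))) (ℤ.+-identityˡ (coeff (+ 0 ∷ p *P r) i)))

scaleP-* : ∀ c p r → scaleP c p *P r ≋ scaleP c (p *P r)
scaleP-* c []      r = ≋-refl
scaleP-* c (a ∷ p) r = coeffwise λ i → ≡.trans (coeff-∷-* (c ℤ.* a) (scaleP c p) r i)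
  (≡.trans (≡.cong₂ ℤ._+_ (ℤ.*-assoc c a (coeff r i)) (go i))
  (≡.trans (≡.sym (ℤ.*-distribˡ-+ c (a ℤ.* coeff r i) (coeff (+ 0 ∷ p *P r) i)))
  (≡.trans (≡.cong (c ℤ.*_) (≡.sym (coeff-∷-* a p r i))) (≡.sym (coeff-scale c ((a ∷ p) *P r) i)))))
  where
  go : ∀ i → coeff (+ 0 ∷ scaleP c p *P r) i ≡ c ℤ.* coeff (+ 0 ∷ p *P r) i
  go zero    = ≡.sym (ℤ.*-zeroʳ c)
  go (suc i) = ≡.trans (coeff≡ (scaleP-* c p r) i) (coeff-scale c (p *P r) i)

*P-assoc : ∀ p r s → (p *P r) *P s ≋ p *P (r *P s)
*P-assoc []      r s = ≋-refl
*P-assoc (a ∷ p) r s = ≋-trans (*P-distribʳ s (scaleP a r) (+ 0 ∷ p *P r))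
  (+P-cong (scaleP-* a r s) (≋-trans (shift-* (p *P r) s) (shift-cong (*P-assoc p r s))))

constP-* : ∀ c p → constP c *P p ≋ scaleP c p
constP-* c p = coeffwise λ i → ≡.trans (coeff-+ (scaleP c p) (+ 0 ∷ []) i)
  (≡.trans (≡.cong (λ a → coeff (scaleP c p) i ℤ.+ a) (lem i)) (ℤ.+-identityʳ _))
  where
  lem : ∀ i → coeff (+ 0 ∷ []) i ≡ + 0
  lem zero    = ≡.refl
  lem (suc i) = ≡.refl

*P-identityˡ : ∀ p → oneP *P p ≋ p
*P-identityˡ p = ≋-trans (constP-* (+ 1) p) (coeffwise λ i → ≡.trans (coeff-scale (+ 1) p i) (ℤ.*-identityˡ (coeff p i)))

polyRing : CommutativeRing 0ℓ 0ℓ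
polyRing = record
  { Carrier = Poly
  ; _≈_ = _≋_
  ; _+_ = _+P_
  ; _*_ = _*P_
  ; -_ = negP
  ; 0# = zeroP
  ; 1# = oneP
  ; isCommutativeRing = record
    { isRing = record
      { +-isAbelianGroup = record
        { isGroup = record
          { isMonoid = record
            { isSemigroup = record
              { isMagma = record
                { isEquivalence = record { refl = ≋-refl ; sym = ≋-sym ; trans = ≋-trans }
                ; ∙-cong = +P-cong
                }
              ; assoc = +P-assoc
              }
            ; identity = (λ p → ≋-refl) , λ p → +P-comm p zeroP
            }
          ; inverse = (λ p → ≋-trans (+P-comm (negP p) p) (+P-inverseʳ p)) , +P-inverseʳ
          ; ⁻¹-cong = scaleP-cong (ℤ.- (+ 1))
          }
        ; comm = +P-comm
        }
      ; *-cong = *P-cong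
      ; *-assoc = *P-assoc
      ; *-identity = *P-identityˡ , λ p → ≋-trans (*P-comm p oneP) (*P-identityˡ p)
      ; distrib = *P-distribˡ , *P-distribʳ
      }
    ; *-comm = *P-comm
    }
  }

qpow-+ : ∀ i j → qpow (i ℕ.+ j) ≋ qpow i *P qpow j
qpow-+ zero    j = ≋-sym (*P-identityˡ (qpow j))
qpow-+ (suc i) j = ≋-trans (shift-cong (qpow-+ i j)) (≋-sym (shift-* (qpow i) (qpow j)))

coeff-qpow-*-< : ∀ e p i → i ℕ.< e → coeff (qpow e *P p) i ≡ + 0
coeff-qpow-*-< (suc e) p zero    _         = coeff≡ (shift-* (qpow e) p) 0
coeff-qpow-*-< (suc e) p (suc i) (s≤s i<e) = ≡.trans (coeff≡ (shift-* (qpow e) p) (suc i)) (coeff-qpow-*-< e p i i<e)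

coeff-qpow-* : ∀ e p i → coeff (qpow e *P p) (e ℕ.+ i) ≡ coeff p i
coeff-qpow-* zero    p i = coeff≡ (*P-identityˡ p) i
coeff-qpow-* (suc e) p i = ≡.trans (coeff≡ (shift-* (qpow e) p) (suc (e ℕ.+ i))) (coeff-qpow-* e p i)

-- Fractions with regular denominators

module Localisation {c ℓ} (R : CommutativeRing c ℓ) where
  open CommutativeRing R
  open IntegerSolver R
  open Relation.Binary.Reasoning.Setoid setoid

  -- Cancelling the middle denominator is what makes `≃` transitive. For polynomials, regularity is
  -- established for the powers q^e and for the differences 1 - q^e with e ≥ 1.
  Regular : Carrier → Set _
  Regular s = ∀ x → x * s ≈ 0# → x ≈ 0#

  Regular-1 : Regular 1#
  Regular-1 x eq = trans (sym (*-identityʳ x)) eq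

  Regular-* : ∀ {s t} → Regular s → Regular t → Regular (s * t)
  Regular-* {s} {t} rs rt x eq = rs x (rt (x * s) (trans (*-assoc x s t) eq))

  Regular-cancel : ∀ {s x y} → Regular s → x * s ≈ y * s → x ≈ y
  Regular-cancel {s} {x} {y} rs eq = begin
    x            ≈⟨ solve 2 (λ x y → x := (x :- y) :+ y) refl x y ⟩
    (x - y) + y  ≈⟨ +-congʳ (rs (x - y) (begin
        (x - y) * s    ≈⟨ solve 3 (λ x y s → (x :- y) :* s := x :* s :- y :* s) refl x y s ⟩
        x * s - y * s  ≈⟨ +-congʳ eq ⟩
        y * s - y * s  ≈⟨ -‿inverseʳ _ ⟩
        0#             ∎)) ⟩
    0# + y       ≈⟨ +-identityˡ y ⟩
    y            ∎

  record Fraction : Set (c Level.⊔ ℓ) where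
    constructor frac
    field
      num den : Carrier
      regular : Regular den
  open Fraction

  infix 4 _≃_
  record _≃_ (x y : Fraction) : Set ℓ where
    constructor cross
    field crossed : num x * den y ≈ num y * den x
  open _≃_ public

  ≃-trans : ∀ {x y z} → x ≃ y → y ≃ z → x ≃ z
  ≃-trans {frac a s rs} {frac b t rt} {frac c u ru} (cross e) (cross f) = cross (Regular-cancel rt (begin
    a * u * t  ≈⟨ solve 3 (λ a u t → a :* u :* t := a :* t :* u) refl a u t ⟩
    a * t * u  ≈⟨ *-congʳ e ⟩
    b * s * u  ≈⟨ solve 3 (λ b s u → b :* s :* u := b :* u :* s) refl b s u ⟩
    b * u * s  ≈⟨ *-congʳ f ⟩
    c * t * s  ≈⟨ solve 3 (λ c t s → c :* t :* s := c :* s :* t) refl c t s ⟩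
    c * s * t  ∎))

  _⊕_ _⊗_ : Fraction → Fraction → Fraction
  frac a s rs ⊕ frac b t rt = frac (a * t + b * s) (s * t) (Regular-* rs rt)
  frac a s rs ⊗ frac b t rt = frac (a * b) (s * t) (Regular-* rs rt)

  ⊝_ : Fraction → Fraction
  ⊝ frac a s rs = frac (- a) s rs

  ι : Carrier → Fraction
  ι a = frac a 1# Regular-1

  ⊕-cong : ∀ {x y u v} → x ≃ y → u ≃ v → x ⊕ u ≃ y ⊕ v
  ⊕-cong {frac a s _} {frac b t _} {frac a′ s′ _} {frac b′ t′ _} (cross e) (cross f) = cross (begin
    (a * s′ + a′ * s) * (t * t′)             ≈⟨ solve 6 (λ a s a′ s′ t t′ → (a :* s′ :+ a′ :* s) :* (t :* t′) := a :* t :* (s′ :* t′) :+ a′ :* t′ :* (s :* t)) refl a s a′ s′ t t′ ⟩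
    a * t * (s′ * t′) + a′ * t′ * (s * t)    ≈⟨ +-cong (*-congʳ e) (*-congʳ f) ⟩
    b * s * (s′ * t′) + b′ * s′ * (s * t)    ≈⟨ solve 6 (λ b s b′ s′ t t′ → b :* s :* (s′ :* t′) :+ b′ :* s′ :* (s :* t) := (b :* t′ :+ b′ :* t) :* (s :* s′)) refl b s b′ s′ t t′ ⟩
    (b * t′ + b′ * t) * (s * s′)             ∎)

  ⊗-cong : ∀ {x y u v} → x ≃ y → u ≃ v → x ⊗ u ≃ y ⊗ v
  ⊗-cong {frac a s _} {frac b t _} {frac a′ s′ _} {frac b′ t′ _} (cross e) (cross f) = cross (begin
    a * a′ * (t * t′)    ≈⟨ solve 4 (λ a a′ t t′ → a :* a′ :* (t :* t′) := a :* t :* (a′ :* t′)) refl a a′ t t′ ⟩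
    a * t * (a′ * t′)    ≈⟨ *-cong e f ⟩
    b * s * (b′ * s′)    ≈⟨ solve 4 (λ b s b′ s′ → b :* s :* (b′ :* s′) := b :* b′ :* (s :* s′)) refl b s b′ s′ ⟩
    b * b′ * (s * s′)    ∎)

  fractionRing : CommutativeRing (c Level.⊔ ℓ) ℓ
  fractionRing = record
    { Carrier = Fraction
    ; _≈_ = _≃_
    ; _+_ = _⊕_
    ; _*_ = _⊗_
    ; -_ = ⊝_
    ; 0# = ι 0#
    ; 1# = ι 1#
    ; isCommutativeRing = record
      { isRing = record
        { +-isAbelianGroup = record
          { isGroup = record
            { isMonoid = record
              { isSemigroup = record
                { isMagma = record
                  { isEquivalence = record { refl = cross refl ; sym = λ (cross e) → cross (sym e) ; trans = ≃-trans }
                  ; ∙-cong = ⊕-cong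
                  }
                ; assoc = λ (frac a s _) (frac b t _) (frac c u _) → cross (solve 6 (λ a s b t c u →
                    ((a :* t :+ b :* s) :* u :+ c :* (s :* t)) :* (s :* (t :* u)) := (a :* (t :* u) :+ (b :* u :+ c :* t) :* s) :* (s :* t :* u)) refl a s b t c u)
                }
              ; identity = (λ (frac a s _) → cross (solve 2 (λ a s → (con (+ 0) :* s :+ a :* con (+ 1)) :* s := a :* (con (+ 1) :* s)) refl a s))
                         , (λ (frac a s _) → cross (solve 2 (λ a s → (a :* con (+ 1) :+ con (+ 0) :* s) :* s := a :* (s :* con (+ 1))) refl a s))
              }
            ; inverse = (λ (frac a s _) → cross (solve 2 (λ a s → (:- a :* s :+ a :* s) :* con (+ 1) := con (+ 0) :* (s :* s)) refl a s))
                      , (λ (frac a s _) → cross (solve 2 (λ a s → (a :* s :+ :- a :* s) :* con (+ 1) := con (+ 0) :* (s :* s)) refl a s))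
            ; ⁻¹-cong = λ { {frac a s _} {frac b t _} (cross e) → cross (trans (solve 2 (λ a t → :- a :* t := :- (a :* t)) refl a t)
                (trans (-‿cong e) (solve 2 (λ b s → :- (b :* s) := :- b :* s) refl b s))) }
            }
          ; comm = λ (frac a s _) (frac b t _) → cross (solve 4 (λ a s b t → (a :* t :+ b :* s) :* (t :* s) := (b :* s :+ a :* t) :* (s :* t)) refl a s b t)
          }
        ; *-cong = ⊗-cong
        ; *-assoc = λ (frac a s _) (frac b t _) (frac c u _) → cross (solve 6 (λ a s b t c u → a :* b :* c :* (s :* (t :* u)) := a :* (b :* c) :* (s :* t :* u)) refl a s b t c u)
        ; *-identity = (λ (frac a s _) → cross (solve 2 (λ a s → con (+ 1) :* a :* s := a :* (con (+ 1) :* s)) refl a s))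
                     , (λ (frac a s _) → cross (solve 2 (λ a s → a :* con (+ 1) :* s := a :* (s :* con (+ 1))) refl a s))
        ; distrib = (λ (frac a s _) (frac b t _) (frac c u _) → cross (solve 6 (λ a s b t c u →
                        a :* (b :* u :+ c :* t) :* (s :* t :* (s :* u)) := (a :* b :* (s :* u) :+ a :* c :* (s :* t)) :* (s :* (t :* u))) refl a s b t c u))
                  , (λ (frac a s _) (frac b t _) (frac c u _) → cross (solve 6 (λ a s b t c u →
                        (b :* u :+ c :* t) :* a :* (t :* s :* (u :* s)) := (b :* a :* (u :* s) :+ c :* a :* (t :* s)) :* (t :* u :* s)) refl a s b t c u))
        }
      ; *-comm = λ (frac a s _) (frac b t _) → cross (solve 4 (λ a s b t → a :* b :* (t :* s) := b :* a :* (s :* t)) refl a s b t)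
      }
    }

  ι-cong : ∀ {x y} → x ≈ y → ι x ≃ ι y
  ι-cong e = cross (*-congʳ e)

  ι-injective : ∀ {x y} → ι x ≃ ι y → x ≈ y
  ι-injective (cross e) = trans (sym (*-identityʳ _)) (trans e (*-identityʳ _))

  ι-+ : ∀ x y → ι (x + y) ≃ ι x ⊕ ι y
  ι-+ x y = cross (solve 2 (λ x y → (x :+ y) :* (con (+ 1) :* con (+ 1)) := (x :* con (+ 1) :+ y :* con (+ 1)) :* con (+ 1)) refl x y)

  ι-* : ∀ x y → ι (x * y) ≃ ι x ⊗ ι y
  ι-* x y = cross (solve 2 (λ x y → x :* y :* (con (+ 1) :* con (+ 1)) := x :* y :* con (+ 1)) refl x y)

  ι-inverse : ∀ s (rs : Regular s) → ι s ⊗ frac 1# s rs ≃ ι 1#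
  ι-inverse s rs = cross (solve 1 (λ s → s :* con (+ 1) :* con (+ 1) := con (+ 1) :* (con (+ 1) :* s)) refl s)

-- Long division and cyclotomic polynomials

module Division where
  open import Data.Bool.Base using (true; false; T)
  open CommutativeRing polyRing using (setoid; +-cong; +-congˡ; +-congʳ; *-congˡ; *-congʳ; *-cong; -‿cong; +-identityˡ; +-identityʳ)
  open IntegerSolver polyRing
  open Relation.Binary.Reasoning.Setoid setoid

  Deg≤ : Poly → ℕ → Set
  Deg≤ p D = ∀ i → D ℕ.< i → coeff p i ≡ + 0

  record Monic (p : Poly) (D : ℕ) : Set where
    constructor monic
    field
      leading : coeff p D ≡ + 1
      bounded : Deg≤ p D

  coeff-≥length : ∀ p i → length p ℕ.≤ i → coeff p i ≡ + 0
  coeff-≥length []      i       _       = ≡.refl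
  coeff-≥length (a ∷ p) (suc i) (s≤s l) = coeff-≥length p i l

  lastC≡coeff : ∀ a p → lastC (a ∷ p) ≡ coeff (a ∷ p) (length p)
  lastC≡coeff a []      = ≡.refl
  lastC≡coeff a (b ∷ p) = lastC≡coeff b p

  norm-≋ : ∀ p → norm p ≋ p
  norm-≋ []      = ≋-refl
  norm-≋ (a ∷ p) with norm p | norm-≋ p
  ... | b ∷ r | ih = coeffwise λ { zero → ≡.refl ; (suc i) → coeff≡ ih i }
  ... | []    | ih with a ℤ.≟ + 0
  ...   | yes a≡0 = coeffwise λ { zero → ≡.sym a≡0 ; (suc i) → coeff≡ ih i }
  ...   | no  _   = coeffwise λ { zero → ≡.refl ; (suc i) → coeff≡ ih i }

  norm-length : ∀ p → length (norm p) ℕ.≤ length p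
  norm-length []      = z≤n
  norm-length (a ∷ p) with norm p | norm-length p
  ... | b ∷ r | ih = s≤s ih
  ... | []    | ih with a ℤ.≟ + 0
  ...   | yes _ = z≤n
  ...   | no  _ = s≤s z≤n

  norm-view : ∀ p → norm p ≡ [] ⊎ (∃ λ L → length (norm p) ≡ suc L × coeff p L ≢ + 0)
  norm-view []      = inj₁ ≡.refl
  norm-view (a ∷ p) with norm p | norm-view p
  ... | b ∷ r | inj₂ (L , len , ≢0) = inj₂ (suc L , ≡.cong suc len , ≢0)
  ... | []    | _ with a ℤ.≟ + 0
  ...   | yes _   = inj₁ ≡.refl
  ...   | no  a≢0 = inj₂ (0 , ≡.refl , a≢0)

  degree-view : ∀ p → p ≋ zeroP ⊎ (∃ λ L → coeff p L ≢ + 0 × Deg≤ p L)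
  degree-view p with norm-view p
  ... | inj₁ eq = inj₁ (≋-trans (≋-sym (norm-≋ p)) (≡.subst (_≋ zeroP) (≡.sym eq) ≋-refl))
  ... | inj₂ (L , len , ≢0) = inj₂ (L , ≢0 , λ i L<i → ≡.trans (≡.sym (coeff≡ (norm-≋ p) i))
          (coeff-≥length (norm p) i (≡.subst (ℕ._≤ i) (≡.sym len) L<i)))

  norm-length≤ : ∀ p L → (∀ i → L ℕ.≤ i → coeff p i ≡ + 0) → length (norm p) ℕ.≤ L
  norm-length≤ p L zero≥ with norm-view p
  ... | inj₁ eq = ≡.subst (λ r → length r ℕ.≤ L) (≡.sym eq) z≤n
  ... | inj₂ (L′ , len , ≢0) with ℕ.<-cmp L′ L
  ...   | tri< L′<L _ _ = ≡.subst (ℕ._≤ L) (≡.sym len) L′<L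
  ...   | tri≈ _ e _    = contradiction (zero≥ L′ (ℕ.≤-reflexive (≡.sym e))) ≢0
  ...   | tri> _ _ L<L′ = contradiction (zero≥ L′ (ℕ.<⇒≤ L<L′)) ≢0

  Monic-length : ∀ {p D} → Monic p D → length (norm p) ≡ suc D
  Monic-length {p} {D} (monic lead deg) with norm-view p
  ... | inj₁ eq = contradiction (≡.trans (≡.sym lead) (≡.trans (≡.sym (coeff≡ (norm-≋ p) D)) (≡.cong (λ r → coeff r D) eq))) λ ()
  ... | inj₂ (L , len , ≢0) with ℕ.<-cmp L D
  ...   | tri< L<D _ _ = contradiction (≡.trans (≡.sym lead) (≡.trans (≡.sym (coeff≡ (norm-≋ p) D)) (coeff-≥length (norm p) D (≡.subst (ℕ._≤ D) (≡.sym len) L<D)))) λ ()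
  ...   | tri≈ _ ≡.refl _ = len
  ...   | tri> _ _ D<L = contradiction (deg L D<L) ≢0

  Monic-resp : ∀ {p r D} → p ≋ r → Monic p D → Monic r D
  Monic-resp e (monic lead deg) = monic (≡.trans (≡.sym (coeff≡ e _)) lead) λ i D<i → ≡.trans (≡.sym (coeff≡ e i)) (deg i D<i)

  -- Degrees enter as upper bounds, so the induction on f goes through when top coefficients are
  -- zero.
  product-degree : ∀ f a g b → Deg≤ f a → Deg≤ g b → Deg≤ (f *P g) (a ℕ.+ b) × coeff (f *P g) (a ℕ.+ b) ≡ coeff f a ℤ.* coeff g b
  product-degree []      a       g b df dg = (λ i _ → ≡.refl) , ≡.refl
  product-degree (x ∷ f) zero    g b df dg = (λ i b<i → ≡.trans (eq i) (≡.trans (≡.cong (x ℤ.*_) (dg i b<i)) (ℤ.*-zeroʳ x))) , eq b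
    where
    f≋0 : f ≋ zeroP
    f≋0 = coeffwise λ i → df (suc i) (s≤s z≤n)
    tail≡0 : ∀ i → coeff (+ 0 ∷ f *P g) i ≡ + 0
    tail≡0 zero    = ≡.refl
    tail≡0 (suc i) = coeff≡ (*P-cong f≋0 (≋-refl {g})) i
    eq : ∀ i → coeff ((x ∷ f) *P g) i ≡ x ℤ.* coeff g i
    eq i = ≡.trans (coeff-∷-* x f g i) (≡.trans (≡.cong (λ y → x ℤ.* coeff g i ℤ.+ y) (tail≡0 i)) (ℤ.+-identityʳ _))
  product-degree (x ∷ f) (suc a) g b df dg with product-degree f a g b (λ i a<i → df (suc i) (s≤s a<i)) dg
  ... | deg , top = (λ { (suc i) (s≤s ab<i) → ≡.trans (step i (ℕ.≤-trans (ℕ.m≤n+m b a) (ℕ.<⇒≤ ab<i))) (deg i ab<i) }) ,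
                    ≡.trans (step (a ℕ.+ b) (ℕ.m≤n+m b a)) top
    where
    step : ∀ i → b ℕ.≤ i → coeff ((x ∷ f) *P g) (suc i) ≡ coeff (f *P g) i
    step i b≤i = ≡.trans (coeff-∷-* x f g (suc i)) (≡.trans (≡.cong (λ y → x ℤ.* y ℤ.+ coeff (f *P g) i) (dg (suc i) (s≤s b≤i)))
      (≡.trans (≡.cong (ℤ._+ coeff (f *P g) i) (ℤ.*-zeroʳ x)) (ℤ.+-identityˡ (coeff (f *P g) i))))

  Monic-* : ∀ {f g a b} → Monic f a → Monic g b → Monic (f *P g) (a ℕ.+ b)
  Monic-* {f} {g} {a} {b} (monic lf df) (monic lg dg) with product-degree f a g b df dg
  ... | deg , top = monic (≡.trans top (≡.cong₂ ℤ._*_ lf lg)) deg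

  Monic-1 : Monic oneP 0
  Monic-1 = monic ≡.refl λ { (suc i) _ → ≡.refl }

  qpow-Monic : ∀ e → Monic (qpow e) e
  qpow-Monic zero    = Monic-1
  qpow-Monic (suc e) with qpow-Monic e
  ... | monic l dg = monic l λ { (suc i) (s≤s e<i) → dg i e<i }

  -- A nonzero top coefficient of k, at L, would reappear in k g at L + D, where r is zero.
  monic-multiple : ∀ {g D} k r → Monic g D → (∀ i → D ℕ.≤ i → coeff r i ≡ + 0) → k *P g ≋ r → k ≋ zeroP
  monic-multiple {g} {D} k r (monic lg dg) dr eq with degree-view k
  ... | inj₁ k≋0 = k≋0
  ... | inj₂ (L , ≢0 , dk) = contradiction (≡.trans (≡.sym (≡.trans (proj₂ (product-degree k L g D dk dg)) (≡.trans (≡.cong (coeff k L ℤ.*_) lg) (ℤ.*-identityʳ _))))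
          (≡.trans (coeff≡ eq (L ℕ.+ D)) (dr (L ℕ.+ D) (ℕ.m≤n+m D L)))) ≢0

  monic-factor : ∀ {g D} f n → Monic g D → Monic (f *P g) n → ∃ (Monic f)
  monic-factor {g} {D} f n (monic lg dg) (monic lfg dfg) with degree-view f
  ... | inj₁ f≋0 = contradiction (≡.trans (≡.sym lfg) (coeff≡ (*P-cong f≋0 (≋-refl {g})) n)) λ ()
  ... | inj₂ (L , ≢0 , df) with product-degree f L g D df dg
  ...   | deg , top with ℕ.<-cmp (L ℕ.+ D) n
  ...     | tri< LD<n _ _ = contradiction (≡.trans (≡.sym lfg) (deg n LD<n)) λ ()
  ...     | tri≈ _ ≡.refl _ = L , monic (≡.trans (≡.sym (≡.trans (≡.cong (coeff f L ℤ.*_) lg) (ℤ.*-identityʳ _))) (≡.trans (≡.sym top) lfg)) df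
  ...     | tri> _ _ n<LD = contradiction (≡.trans (≡.sym (≡.trans (≡.cong (coeff f L ℤ.*_) lg) (ℤ.*-identityʳ _))) (≡.trans (≡.sym top) (dfg _ n<LD))) ≢0

  DivSpec : Poly → Poly → ℕ → Poly × Poly → Set
  DivSpec g p D (qu , r) = p ≋ qu *P g +P r × (∀ i → D ℕ.≤ i → coeff r i ≡ + 0)

  -- The fuel bounds the length of `norm p`, which drops in each step because the subtraction
  -- cancels the top coefficient.
  divMonicF-spec : ∀ f p g D → Monic g D → length (norm p) ℕ.≤ f → DivSpec g p D (divMonicF f p g)
  divMonicF-spec zero p g D mg len = ≋-refl , λ i _ → ≡.trans (≡.sym (coeff≡ (norm-≋ p) i)) (coeff-≥length (norm p) i (ℕ.≤-trans len z≤n))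
  divMonicF-spec (suc f) p g D mg len
    with norm p | norm-≋ p | len | norm g | norm-≋ g | Monic-length mg
  ... | p′ | p′≋p | len′ | g′ | g′≋g | lg with length p′ <ᵇ length g′ in lt
  ...   | true = ≋-sym p′≋p , λ i D≤i → coeff-≥length p′ i (ℕ.≤-trans (ℕ.s≤s⁻¹ (≡.subst (length p′ ℕ.<_) lg (ℕ.<ᵇ⇒< (length p′) (length g′) (≡.subst T (≡.sym lt) tt)))) D≤i)
  divMonicF-spec (suc f) p g D mg len | [] | p′≋p | len′ | g′ | g′≋g | lg | false
    = ⊥-elim (≡.subst T lt (ℕ.<⇒<ᵇ (≡.subst (0 ℕ.<_) (≡.sym lg) (s≤s z≤n))))
  divMonicF-spec (suc f) p g D mg len | a ∷ p₀ | p′≋p | s≤s len₀ | g′ | g′≋g | lg | false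
    with divMonicF f ((a ∷ p₀) -P (scaleP (lastC (a ∷ p₀)) (qpow (suc (length p₀) ℕ.∸ length g′)) *P g′)) g
       | divMonicF-spec f ((a ∷ p₀) -P (scaleP (lastC (a ∷ p₀)) (qpow (suc (length p₀) ℕ.∸ length g′)) *P g′)) g D mg shorter
    where
    L = length p₀
    lc = lastC (a ∷ p₀)
    s = suc L ℕ.∸ length g′
    t = scaleP lc (qpow s)
    g′≤p′ : length g′ ℕ.≤ suc L
    g′≤p′ = ℕ.≮⇒≥ λ p′<g′ → ≡.subst T lt (ℕ.<⇒<ᵇ p′<g′)
    s+D≡L : s ℕ.+ D ≡ L
    s+D≡L = ℕ.suc-injective (≡.trans (≡.sym (ℕ.+-suc s D)) (≡.trans (≡.cong (s ℕ.+_) (≡.sym lg)) (ℕ.m∸n+n≡m g′≤p′)))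
    mg′ : Monic g′ D
    mg′ = Monic-resp (≋-sym g′≋g) mg
    dt : Deg≤ t s
    dt i s<i = ≡.trans (coeff-scale lc (qpow s) i) (≡.trans (≡.cong (lc ℤ.*_) (Monic.bounded (qpow-Monic s) i s<i)) (ℤ.*-zeroʳ lc))
    tg = product-degree t s g′ D dt (Monic.bounded mg′)
    lead : coeff (t *P g′) L ≡ lc
    lead = ≡.trans (≡.cong (coeff (t *P g′)) (≡.sym s+D≡L)) (≡.trans (proj₂ tg)
      (≡.trans (≡.cong₂ ℤ._*_ (≡.trans (coeff-scale lc (qpow s) s) (≡.cong (lc ℤ.*_) (Monic.leading (qpow-Monic s)))) (Monic.leading mg′))
      (≡.trans (ℤ.*-identityʳ _) (ℤ.*-identityʳ lc))))
    coeffs : ∀ i → L ℕ.≤ i → coeff ((a ∷ p₀) -P (t *P g′)) i ≡ + 0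
    coeffs i L≤i = ≡.trans (coeff-+ (a ∷ p₀) (negP (t *P g′)) i) (≡.trans (≡.cong (λ y → coeff (a ∷ p₀) i ℤ.+ y) (coeff-neg (t *P g′) i)) (go (ℕ.m≤n⇒m<n∨m≡n L≤i)))
      where
      go : L ℕ.< i ⊎ L ≡ i → coeff (a ∷ p₀) i ℤ.- coeff (t *P g′) i ≡ + 0
      go (inj₁ L<i)    = ≡.cong₂ ℤ._-_ (coeff-≥length (a ∷ p₀) i L<i) (proj₁ tg i (≡.subst (ℕ._< i) (≡.sym s+D≡L) L<i))
      go (inj₂ ≡.refl) = ≡.trans (≡.cong₂ ℤ._-_ (≡.sym (lastC≡coeff a p₀)) lead) (ℤ.+-inverseʳ lc)
    shorter = ℕ.≤-trans (norm-length≤ ((a ∷ p₀) -P (t *P g′)) L coeffs) len₀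
  ... | qu , r | eq , dr = (begin
      p                          ≈⟨ p′≋p ⟨
      a ∷ p₀                     ≈⟨ solve 2 (λ p y → p := (p :- y) :+ y) ≋-refl (a ∷ p₀) (t *P g′) ⟩
      ((a ∷ p₀) -P (t *P g′)) +P t *P g′  ≈⟨ +-cong eq (*-congˡ {t} g′≋g) ⟩
      qu *P g +P r +P t *P g     ≈⟨ solve 4 (λ q g r t → q :* g :+ r :+ t :* g := (q :+ t) :* g :+ r) ≋-refl qu g r t ⟩
      (qu +P t) *P g +P r        ∎) , dr
    where
    t = scaleP (lastC (a ∷ p₀)) (qpow (suc (length p₀) ℕ.∸ length g′))

  -- Bézout identities over ℤ yield divisibility only up to a nonzero integer c. As c r = (h - c qu)
  -- g has degree below that of g, first h - c qu and then r must vanish.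
  quotMonic-exact : ∀ p g D c h → Monic g D → c ≢ + 0 → constP c *P p ≋ h *P g → p ≋ quotMonic p g *P g
  quotMonic-exact p g D c h mg c≢0 eq
    with divMonicF (suc (length p)) p g | divMonicF-spec (suc (length p)) p g D mg (ℕ.m≤n⇒m≤1+n (norm-length p))
  ... | qu , r | p≋ , dr = begin
    p               ≈⟨ p≋ ⟩
    qu *P g +P r    ≈⟨ +-congˡ r≋0 ⟩
    qu *P g +P zeroP ≈⟨ +-identityʳ _ ⟩
    qu *P g         ∎
    where
    C = constP c
    k = h -P C *P qu
    kg≋ : k *P g ≋ C *P r
    kg≋ = begin
      k *P g                            ≈⟨ solve 4 (λ h c q g → (h :- c :* q) :* g := h :* g :- c :* (q :* g)) ≋-refl h C qu g ⟩
      h *P g -P C *P (qu *P g)          ≈⟨ +-congʳ eq ⟨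
      C *P p -P C *P (qu *P g)          ≈⟨ +-congʳ {negP (C *P (qu *P g))} (*-congˡ {C} p≋) ⟩
      C *P (qu *P g +P r) -P C *P (qu *P g)  ≈⟨ solve 3 (λ c y r → c :* (y :+ r) :- c :* y := c :* r) ≋-refl C (qu *P g) r ⟩
      C *P r                            ∎
    coeff-C : ∀ i → coeff (C *P r) i ≡ c ℤ.* coeff r i
    coeff-C i = ≡.trans (coeff≡ (constP-* c r) i) (coeff-scale c r i)
    k≋0 : k ≋ zeroP
    k≋0 = monic-multiple k (C *P r) mg (λ i D≤i → ≡.trans (coeff-C i) (≡.trans (≡.cong (c ℤ.*_) (dr i D≤i)) (ℤ.*-zeroʳ c))) kg≋
    r≋0 : r ≋ zeroP
    r≋0 = coeffwise λ i → cancel i (≡.trans (≡.sym (coeff-C i)) (≡.trans (≡.sym (coeff≡ kg≋ i)) (coeff≡ (*P-cong k≋0 (≋-refl {g})) i)))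
      where
      cancel : ∀ i → c ℤ.* coeff r i ≡ + 0 → coeff r i ≡ + 0
      cancel i e with ℤ.i*j≡0⇒i≡0∨j≡0 c e
      ... | inj₁ c≡0 = contradiction c≡0 c≢0
      ... | inj₂ r≡0 = r≡0

-- Factorisation of q^n - 1 and coprimality to Φ_n

module CyclotomicPolynomials where
  open Division
  open CommutativeRing polyRing using (setoid; +-cong; +-congˡ; +-congʳ; *-congˡ; *-congʳ; *-cong; -‿cong; +-identityˡ; +-identityʳ; zeroˡ)
  open IntegerSolver polyRing
  open Localisation polyRing using (Regular; Regular-cancel)
  open Relation.Binary.Reasoning.Setoid setoid

  record Coprime (f g : Poly) : Set where
    constructor bezout
    field
      u v      : Poly
      constant : ℤ
      nonzero  : constant ≢ + 0
      identity : u *P f +P v *P g ≋ constP constant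

  Coprime⇒CoprimeP : ∀ {f g} → Coprime f g → CoprimeP f g
  Coprime⇒CoprimeP (bezout u v c c≢0 eq) = u , v , c , c≢0 , coeff≡ eq

  Coprime-sym : ∀ {f g} → Coprime f g → Coprime g f
  Coprime-sym {f} {g} (bezout u v c c≢0 eq) = bezout v u c c≢0 (≋-trans (+P-comm (v *P g) (u *P f)) eq)

  Coprime-1 : ∀ g → Coprime oneP g
  Coprime-1 g = bezout oneP zeroP (+ 1) (λ ()) (solve 1 (λ g → con (+ 1) :* con (+ 1) :+ con (+ 0) :* g := con (+ 1)) ≋-refl g)

  Coprime-* : ∀ {f f′ g} → Coprime f g → Coprime f′ g → Coprime (f *P f′) g
  Coprime-* {f} {f′} {g} (bezout u v c c≢0 eq) (bezout u′ v′ c′ c′≢0 eq′) =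
    bezout (u *P u′) (u *P f *P v′ +P v *P constP c′) (c ℤ.* c′) nonzero (begin
      u *P u′ *P (f *P f′) +P (u *P f *P v′ +P v *P constP c′) *P g
        ≈⟨ solve 8 (λ u f v g u′ f′ v′ c → u :* u′ :* (f :* f′) :+ (u :* f :* v′ :+ v :* c) :* g
             := u :* f :* (u′ :* f′ :+ v′ :* g) :+ v :* g :* c) ≋-refl u f v g u′ f′ v′ (constP c′) ⟩
      u *P f *P (u′ *P f′ +P v′ *P g) +P v *P g *P constP c′
        ≈⟨ +-congʳ (*-congˡ {u *P f} eq′) ⟩
      u *P f *P constP c′ +P v *P g *P constP c′
        ≈⟨ solve 3 (λ a b c → a :* c :+ b :* c := (a :+ b) :* c) ≋-refl (u *P f) (v *P g) (constP c′) ⟩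
      (u *P f +P v *P g) *P constP c′
        ≈⟨ *-congʳ {constP c′} eq ⟩
      constP c *P constP c′
        ≈⟨ constP-* c (constP c′) ⟩
      constP (c ℤ.* c′) ∎)
    where
    nonzero : c ℤ.* c′ ≢ + 0
    nonzero e with ℤ.i*j≡0⇒i≡0∨j≡0 c e
    ... | inj₁ c≡0  = c≢0 c≡0
    ... | inj₂ c′≡0 = c′≢0 c′≡0

  Coprime-factor : ∀ {f g} h k → Coprime h g → h ≋ k *P f → Coprime f g
  Coprime-factor {f} {g} h k (bezout u v c c≢0 eq) h≋ = bezout (u *P k) v c c≢0 (begin
    u *P k *P f +P v *P g     ≈⟨ +-congʳ (*P-assoc u k f) ⟩
    u *P (k *P f) +P v *P g   ≈⟨ +-congʳ (*-congˡ {u} h≋) ⟨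
    u *P h +P v *P g          ≈⟨ eq ⟩
    constP c                  ∎)

  Coprime-mod : ∀ {f g} c k → c ≢ + 0 → f ≋ constP c +P k *P g → Coprime f g
  Coprime-mod {f} {g} c k c≢0 eq = bezout oneP (negP k) c c≢0 (begin
    oneP *P f +P negP k *P g                      ≈⟨ +-congʳ (*-congˡ {oneP} eq) ⟩
    oneP *P (constP c +P k *P g) +P negP k *P g   ≈⟨ solve 3 (λ c k g → con (+ 1) :* (c :+ k :* g) :+ :- k :* g := c) ≋-refl (constP c) k g ⟩
    constP c                                      ∎)

  q^_−1 : ℕ → Poly
  q^ e −1 = qpow e -P oneP

  -- A vanishing product says p = q^e p, so each coefficient equals the one e places lower, and
  -- those below e are zero.
  regular-q^-1 : ∀ e → Regular (q^ suc e −1)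
  regular-q^-1 e p eq = coeffwise λ i → go i (ℕ.<-wellFounded i)
    where
    p≋ : p ≋ qpow (suc e) *P p
    p≋ = begin
      p                                           ≈⟨ +-identityˡ p ⟨
      zeroP +P p                                  ≈⟨ +-congʳ eq ⟨
      p *P q^ suc e −1 +P p                       ≈⟨ solve 2 (λ p x → p :* (x :- con (+ 1)) :+ p := x :* p) ≋-refl p (qpow (suc e)) ⟩
      qpow (suc e) *P p                           ∎
    go : ∀ i → Acc ℕ._<_ i → coeff p i ≡ + 0
    go i (acc rs) with i ℕ.<? suc e
    ... | yes i<e = ≡.trans (coeff≡ p≋ i) (coeff-qpow-*-< (suc e) p i i<e)
    ... | no  i≮e with i ℕ.∸ suc e | ℕ.m+[n∸m]≡n (ℕ.≮⇒≥ i≮e)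
    ...   | j | ≡.refl = ≡.trans (coeff≡ p≋ (suc e ℕ.+ j)) (≡.trans (coeff-qpow-* (suc e) p j) (go j (rs (s≤s (ℕ.m≤n+m j e)))))

  -- The quotient (q^{ka} - 1)/(q^a - 1).
  geo : ℕ → ℕ → Poly
  geo zero    a = zeroP
  geo (suc k) a = geo k a +P qpow (k ℕ.* a)

  geo-* : ∀ k a → q^ (k ℕ.* a) −1 ≋ geo k a *P q^ a −1
  geo-* zero    a = +P-inverseʳ oneP
  geo-* (suc k) a = begin
    qpow (a ℕ.+ k ℕ.* a) -P oneP        ≈⟨ +-congʳ (qpow-+ a (k ℕ.* a)) ⟩
    x *P y -P oneP                      ≈⟨ solve 2 (λ x y → x :* y :- con (+ 1) := (y :- con (+ 1)) :+ y :* (x :- con (+ 1))) ≋-refl x y ⟩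
    (y -P oneP) +P y *P q^ a −1         ≈⟨ +-congʳ (geo-* k a) ⟩
    geo k a *P q^ a −1 +P y *P q^ a −1  ≈⟨ *P-distribʳ (q^ a −1) (geo k a) y ⟨
    geo (suc k) a *P q^ a −1            ∎
    where
    x = qpow a
    y = qpow (k ℕ.* a)

  geo-mod : ∀ k a → ∃ λ y → geo k a ≋ constP (+ k) +P y *P q^ a −1
  geo-mod zero    a = zeroP , coeffwise λ { zero → ≡.refl ; (suc i) → ≡.refl }
  geo-mod (suc k) a with geo-mod k a
  ... | y , eq = y +P geo k a , (begin
    geo k a +P qpow (k ℕ.* a)
      ≈⟨ +-cong eq (solve 1 (λ x → x := con (+ 1) :+ (x :- con (+ 1))) ≋-refl (qpow (k ℕ.* a))) ⟩
    (constP (+ k) +P y *P q^ a −1) +P (oneP +P q^ (k ℕ.* a) −1)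
      ≈⟨ +-congˡ {constP (+ k) +P y *P q^ a −1} (+-congˡ {oneP} (geo-* k a)) ⟩
    (constP (+ k) +P y *P q^ a −1) +P (oneP +P geo k a *P q^ a −1)
      ≈⟨ solve 4 (λ c y x g → (c :+ y :* x) :+ (con (+ 1) :+ g :* x) := (con (+ 1) :+ c) :+ (y :+ g) :* x) ≋-refl (constP (+ k)) y (q^ a −1) (geo k a) ⟩
    constP (+ suc k) +P (y +P geo k a) *P q^ a −1 ∎)

  q^-1-∣ : ∀ {a n} → a ℕ.∣ n → ∃ λ k → q^ n −1 ≋ k *P q^ a −1
  q^-1-∣ {a} (ℕ.divides j ≡.refl) = geo j a , geo-* j a

  fac : ℕ → ℕ → Poly
  fac n i with i ∣? n
  ... | yes _ = Φ i
  ... | no  _ = oneP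

  -- The product of Φ_i over the divisors i < N of n. Recursion on N suits the inductions below;
  -- `prodP≋pr` links it to the filtered list in `cycloF`.
  pr : ℕ → ℕ → Poly
  pr n zero    = oneP
  pr n (suc N) = pr n N *P fac n N

  fac-∣ : ∀ n i → i ℕ.∣ n → fac n i ≡ Φ i
  fac-∣ n i i∣n with i ∣? n
  ... | yes _   = ≡.refl
  ... | no  i∤n = contradiction i∣n i∤n

  prodP-++ : ∀ ps rs → prodP (ps ++ rs) ≋ prodP ps *P prodP rs
  prodP-++ []       rs = ≋-sym (*P-identityˡ (prodP rs))
  prodP-++ (p ∷ ps) rs = ≋-trans (*-congˡ {p} (prodP-++ ps rs)) (≋-sym (*P-assoc p (prodP ps) (prodP rs)))

  prodP≋pr : ∀ n N → prodP (map Φ (filter (_∣? n) (upTo N))) ≋ pr n N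
  prodP≋pr n zero    = ≋-refl
  prodP≋pr n (suc N) = begin
    prodP (map Φ (filter (_∣? n) (upTo (suc N))))
      ≡⟨ ≡.cong (λ l → prodP (map Φ (filter (_∣? n) l))) (≡.sym (upTo-∷ʳ N)) ⟩
    prodP (map Φ (filter (_∣? n) (upTo N ++ N ∷ [])))
      ≡⟨ ≡.cong prodP (≡.trans (≡.cong (map Φ) (filter-++ (_∣? n) (upTo N) (N ∷ []))) (map-++ Φ (filter (_∣? n) (upTo N)) (filter (_∣? n) (N ∷ [])))) ⟩
    prodP (map Φ (filter (_∣? n) (upTo N)) ++ map Φ (filter (_∣? n) (N ∷ [])))
      ≈⟨ prodP-++ (map Φ (filter (_∣? n) (upTo N))) _ ⟩
    prodP (map Φ (filter (_∣? n) (upTo N))) *P prodP (map Φ (filter (_∣? n) (N ∷ [])))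
      ≈⟨ *-cong (prodP≋pr n N) last ⟩
    pr n N *P fac n N ∎
    where
    last : prodP (map Φ (filter (_∣? n) (N ∷ []))) ≋ fac n N
    last with N ∣? n
    ... | yes _ = ≋-trans (*P-comm (Φ N) oneP) (*P-identityˡ (Φ N))
    ... | no  _ = ≋-refl

  -- Recursive calls go to smaller indices, so fuel n is already enough at n. This lets `Φ-quot`
  -- replace the leftover fuel by that of `Φ i`.
  cycloF-fuel : ∀ f f′ n → 1 ℕ.≤ n → n ℕ.≤ f → n ℕ.≤ f′ → cycloF f n ≡ cycloF f′ n
  cycloF-fuel zero    f′       n 1≤n n≤0 _   = contradiction (ℕ.≤-trans 1≤n n≤0) λ ()
  cycloF-fuel (suc f) zero     n 1≤n _   n≤0 = contradiction (ℕ.≤-trans 1≤n n≤0) λ ()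
  cycloF-fuel (suc f) (suc f′) n 1≤n n≤f n≤f′ = ≡.cong (λ l → quotMonic (qpow n -P oneP) (prodP l))
    (map-cong-local (All.tabulate λ {i} i∈ → let i∈upTo , i∣n = ∈-filter⁻ (_∣? n) {xs = upTo n} i∈ in
      cycloF-fuel f f′ i (positive i∣n) (ℕ.s≤s⁻¹ (ℕ.<-≤-trans (∈-upTo⁻ i∈upTo) n≤f)) (ℕ.s≤s⁻¹ (ℕ.<-≤-trans (∈-upTo⁻ i∈upTo) n≤f′))))
    where
    positive : ∀ {i} → i ℕ.∣ n → 1 ℕ.≤ i
    positive {zero}  0∣n = contradiction (ℕ.0∣⇒≡0 0∣n) λ n≡0 → ℕ.<⇒≢ 1≤n (≡.sym n≡0)
    positive {suc i} _   = s≤s z≤n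

  Φ-quot : ∀ n → Φ (suc n) ≡ quotMonic (q^ suc n −1) (prodP (map Φ (filter (_∣? suc n) (upTo (suc n)))))
  Φ-quot n = ≡.cong (λ l → quotMonic (q^ suc n −1) (prodP l))
    (map-cong-local (All.tabulate λ {i} i∈ → let i∈upTo , i∣n = ∈-filter⁻ (_∣? suc n) {xs = upTo (suc n)} i∈ in
      cycloF-fuel n i i (ℕ.n≢0⇒n>0 λ { ≡.refl → contradiction (ℕ.0∣⇒≡0 i∣n) λ () }) (ℕ.s≤s⁻¹ (∈-upTo⁻ i∈upTo)) ℕ.≤-refl))

  -- The invariant of the strong induction: `factors` is the exactness of the division, and
  -- `isMonic` lets Φ_n enter later divisors.
  record Cyclotomic (n : ℕ) : Set where
    field
      degree  : ℕ
      isMonic : Monic (Φ n) degree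
      factors : q^ n −1 ≋ Φ n *P pr n n
  open Cyclotomic

  pr-∣ : ∀ {g n} → g ℕ.∣ n → ∀ N → ∃ λ k → pr n N ≋ k *P pr g N
  pr-∣ g∣n zero = oneP , ≋-sym (*P-identityˡ oneP)
  pr-∣ {g} {n} g∣n (suc N) with pr-∣ g∣n N | N ∣? g
  ... | k , eq | yes N∣g = k , (begin
      pr n N *P fac n N       ≈⟨ *-cong eq (≡.subst (_≋ Φ N) (≡.sym (fac-∣ n N (ℕ.∣-trans N∣g g∣n))) ≋-refl) ⟩
      k *P pr g N *P Φ N      ≈⟨ *P-assoc k (pr g N) (Φ N) ⟩
      k *P (pr g N *P Φ N)    ∎)
  ... | k , eq | no  _   = k *P fac n N , (begin
      pr n N *P fac n N              ≈⟨ *-congʳ {fac n N} eq ⟩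
      k *P pr g N *P fac n N         ≈⟨ solve 3 (λ k p f → k :* p :* f := k :* f :* (p :* con (+ 1))) ≋-refl k (pr g N) (fac n N) ⟩
      k *P fac n N *P (pr g N *P oneP) ∎)

  pr-extend : ∀ n {N N′} → N ℕ.≤′ N′ → ∃ λ k → pr n N′ ≋ k *P pr n N
  pr-extend n {N} ℕ.≤′-refl = oneP , ≋-sym (*P-identityˡ (pr n N))
  pr-extend n {N} (ℕ.≤′-step {N′} N≤N′) with pr-extend n N≤N′
  ... | k , eq = fac n N′ *P k , (begin
      pr n N′ *P fac n N′         ≈⟨ *-congʳ {fac n N′} eq ⟩
      k *P pr n N *P fac n N′     ≈⟨ solve 3 (λ k p f → k :* p :* f := f :* k :* p) ≋-refl k (pr n N) (fac n N′) ⟩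
      fac n N′ *P k *P pr n N     ∎)

  -- (q^n - 1)/(q^g - 1) is a multiple of Φ n and congruent to the integer n/g modulo q^g - 1.
  Coprime-proper : ∀ {n g} → Cyclotomic n → Cyclotomic g → 1 ℕ.≤ g → g ℕ.< n → g ℕ.∣ n → Coprime (q^ g −1) (Φ n)
  Coprime-proper {n} {suc g′} cn cg _ g<n g∣n@(ℕ.divides j n≡jg) =
    Coprime-sym (Coprime-factor (geo j g) k (Coprime-mod (+ j) y j≢0 geo≋) geo≋kΦ)
    where
    g = suc g′
    y = proj₁ (geo-mod j g)
    geo≋ = proj₂ (geo-mod j g)
    j≢0 : + j ≢ + 0
    j≢0 e = contradiction (≡.subst (g ℕ.<_) (≡.trans n≡jg (≡.cong (ℕ._* g) (ℤ.+-injective e))) g<n) λ ()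
    k₁ = proj₁ (pr-∣ g∣n (suc g))
    k₂ = proj₁ (pr-extend n (ℕ.≤⇒≤′ g<n))
    k = k₂ *P k₁
    geo≋kΦ : geo j g ≋ k *P Φ n
    geo≋kΦ = Regular-cancel {q^ g −1} {geo j g} {k *P Φ n} (regular-q^-1 g′) (begin
      geo j g *P q^ g −1                          ≈⟨ geo-* j g ⟨
      q^ (j ℕ.* g) −1                             ≡⟨ ≡.cong q^_−1 (≡.sym n≡jg) ⟩
      q^ n −1                                     ≈⟨ factors cn ⟩
      Φ n *P pr n n                               ≈⟨ *-congˡ {Φ n} (proj₂ (pr-extend n (ℕ.≤⇒≤′ g<n))) ⟩
      Φ n *P (k₂ *P pr n (suc g))                 ≈⟨ *-congˡ {Φ n} (*-congˡ {k₂} (proj₂ (pr-∣ g∣n (suc g)))) ⟩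
      Φ n *P (k₂ *P (k₁ *P (pr g g *P fac g g)))  ≈⟨ *-congˡ {Φ n} (*-congˡ {k₂} (*-congˡ {k₁} prg)) ⟩
      Φ n *P (k₂ *P (k₁ *P q^ g −1))              ≈⟨ solve 4 (λ Φ k₂ k₁ x → Φ :* (k₂ :* (k₁ :* x)) := k₂ :* k₁ :* Φ :* x) ≋-refl (Φ n) k₂ k₁ (q^ g −1) ⟩
      k *P Φ n *P q^ g −1                         ∎)
      where
      prg : pr g g *P fac g g ≋ q^ g −1
      prg = begin
        pr g g *P fac g g  ≡⟨ ≡.cong (pr g g *P_) (fac-∣ g g ℕ.∣-refl) ⟩
        pr g g *P Φ g      ≈⟨ *P-comm (pr g g) (Φ g) ⟩
        Φ g *P pr g g      ≈⟨ factors cg ⟨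
        q^ g −1            ∎

  -- q^g - 1 = (q^{xe} - 1) - q^g (q^{yn} - 1) when g + yn = xe.
  q^-1-combination : ∀ g a b x y → g ℕ.+ y ℕ.* b ≡ x ℕ.* a → q^ g −1 ≋ geo x a *P q^ a −1 -P qpow g *P (geo y b *P q^ b −1)
  q^-1-combination g a b x y eq = begin
    q^ g −1
      ≈⟨ solve 2 (λ u v → u :- con (+ 1) := (u :* v :- con (+ 1)) :- u :* (v :- con (+ 1))) ≋-refl (qpow g) (qpow (y ℕ.* b)) ⟩
    (qpow g *P qpow (y ℕ.* b) -P oneP) -P qpow g *P q^ (y ℕ.* b) −1
      ≈⟨ +-congʳ (+-congʳ (≋-trans (≋-sym (qpow-+ g (y ℕ.* b))) (≡.subst (λ e → qpow e ≋ qpow (x ℕ.* a)) (≡.sym eq) ≋-refl))) ⟩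
    q^ (x ℕ.* a) −1 -P qpow g *P q^ (y ℕ.* b) −1
      ≈⟨ +-cong (geo-* x a) (-‿cong (*-congˡ {qpow g} (geo-* y b))) ⟩
    geo x a *P q^ a −1 -P qpow g *P (geo y b *P q^ b −1) ∎

  Coprime-combination : ∀ {h f g} u v w → Coprime h g → h ≋ u *P f +P v *P (w *P g) → Coprime f g
  Coprime-combination {h} {f} {g} u v w (bezout a b c c≢0 eq) h≋ = bezout (a *P u) (a *P v *P w +P b) c c≢0 (begin
    a *P u *P f +P (a *P v *P w +P b) *P g       ≈⟨ solve 7 (λ a u f v w b g → a :* u :* f :+ (a :* v :* w :+ b) :* g := a :* (u :* f :+ v :* (w :* g)) :+ b :* g) ≋-refl a u f v w b g ⟩
    a *P (u *P f +P v *P (w *P g)) +P b *P g     ≈⟨ +-congʳ (*-congˡ {a} h≋) ⟨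
    a *P h +P b *P g                             ≈⟨ eq ⟩
    constP c                                     ∎)

  -- Since n ∤ e, g = gcd(e, n) is a proper divisor of n. Bézout expresses q^g - 1 through q^e - 1
  -- and q^n - 1, and the latter is a multiple of Φ_n.
  Coprime-q^-1 : ∀ {n} → 1 ℕ.≤ n → Cyclotomic n → (∀ g → 1 ℕ.≤ g → g ℕ.< n → Cyclotomic g) →
    ∀ e → ¬ n ℕ.∣ e → Coprime (q^ e −1) (Φ n)
  Coprime-q^-1 {n} 1≤n cn ih e n∤e = combine (Bézout.identity (gcd-GCD e n))
    where
    g = gcd e n
    g∣n : g ℕ.∣ n
    g∣n = gcd[m,n]∣n e n
    1≤g : 1 ℕ.≤ g
    1≤g = ℕ.n≢0⇒n>0 λ g≡0 → ℕ.<⇒≢ 1≤n (≡.sym (ℕ.0∣⇒≡0 (≡.subst (ℕ._∣ n) g≡0 g∣n)))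
    g<n : g ℕ.< n
    g<n = ℕ.≤∧≢⇒< (ℕ.∣⇒≤ ⦃ ℕ.>-nonZero 1≤n ⦄ g∣n) λ g≡n → n∤e (≡.subst (ℕ._∣ e) g≡n (gcd[m,n]∣m e n))
    base : Coprime (q^ g −1) (Φ n)
    base = Coprime-proper cn (ih g 1≤g g<n) 1≤g g<n g∣n
    combine : Bézout.Identity g e n → Coprime (q^ e −1) (Φ n)
    combine (Bézout.+- x y eq) = Coprime-combination (geo x e) (negP (qpow g) *P geo y n) (pr n n) base (begin
      q^ g −1                                                                     ≈⟨ q^-1-combination g e n x y eq ⟩
      geo x e *P q^ e −1 -P qpow g *P (geo y n *P q^ n −1)                        ≈⟨ +-congˡ {geo x e *P q^ e −1} (-‿cong (*-congˡ {qpow g} (*-congˡ {geo y n} (factors cn)))) ⟩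
      geo x e *P q^ e −1 -P qpow g *P (geo y n *P (Φ n *P pr n n))                ≈⟨ solve 6 (λ a b q y Φ p → a :* b :- q :* (y :* (Φ :* p)) := a :* b :+ :- q :* y :* (p :* Φ)) ≋-refl (geo x e) (q^ e −1) (qpow g) (geo y n) (Φ n) (pr n n) ⟩
      geo x e *P q^ e −1 +P negP (qpow g) *P geo y n *P (pr n n *P Φ n)           ∎)
    combine (Bézout.-+ x y eq) = Coprime-combination (negP (qpow g) *P geo x e) (geo y n) (pr n n) base (begin
      q^ g −1                                                                     ≈⟨ q^-1-combination g n e y x eq ⟩
      geo y n *P q^ n −1 -P qpow g *P (geo x e *P q^ e −1)                        ≈⟨ +-congʳ (*-congˡ {geo y n} (factors cn)) ⟩
      geo y n *P (Φ n *P pr n n) -P qpow g *P (geo x e *P q^ e −1)                ≈⟨ solve 6 (λ a b q y Φ p → y :* (Φ :* p) :- q :* (a :* b) := :- q :* a :* b :+ y :* (p :* Φ)) ≋-refl (geo x e) (q^ e −1) (qpow g) (geo y n) (Φ n) (pr n n) ⟩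
      negP (qpow g) *P geo x e *P q^ e −1 +P geo y n *P (pr n n *P Φ n)           ∎)

  module _ (n : ℕ) (ih : ∀ k → 1 ℕ.≤ k → k ℕ.< suc n → Cyclotomic k) where
    private
      n₊ : ℕ
      n₊ = suc n
      positive : ∀ {i} → i ℕ.∣ n₊ → 1 ℕ.≤ i
      positive {zero}  0∣n = contradiction (ℕ.0∣⇒≡0 0∣n) λ ()
      positive {suc i} _   = s≤s z≤n

    -- Φ_j divides q^j - 1, which is coprime to Φ_k because k ∤ j.
    Φ-Coprime : ∀ j k → 1 ℕ.≤ j → j ℕ.< k → k ℕ.< n₊ → Coprime (Φ j) (Φ k)
    Φ-Coprime j k 1≤j j<k k<n = Coprime-factor (q^ j −1) (pr j j)
      (Coprime-q^-1 1≤k (ih k 1≤k k<n) (λ g 1≤g g<k → ih g 1≤g (ℕ.<-trans g<k k<n)) j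
        (λ k∣j → ℕ.<⇒≱ j<k (ℕ.∣⇒≤ ⦃ ℕ.>-nonZero 1≤j ⦄ k∣j)))
      (≋-trans (factors (ih j 1≤j (ℕ.<-trans j<k k<n))) (*P-comm (Φ j) (pr j j)))
      where
      1≤k = ℕ.≤-trans 1≤j (ℕ.<⇒≤ j<k)

    pr-Coprime : ∀ N k → N ℕ.≤ k → k ℕ.< n₊ → Coprime (pr n₊ N) (Φ k)
    pr-Coprime zero    k _   _   = Coprime-1 (Φ k)
    pr-Coprime (suc N) k N<k k<n with N ∣? n₊
    ... | yes N∣n = Coprime-* (pr-Coprime N k (ℕ.<⇒≤ N<k) k<n) (Φ-Coprime N k (positive N∣n) N<k k<n)
    ... | no  _   = Coprime-* (pr-Coprime N k (ℕ.<⇒≤ N<k) k<n) (Coprime-1 (Φ k))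

    pr-Monic : ∀ N → N ℕ.≤ n₊ → ∃ (Monic (pr n₊ N))
    pr-Monic zero    _   = 0 , Monic-1
    pr-Monic (suc N) N<n with pr-Monic N (ℕ.<⇒≤ N<n) | N ∣? n₊
    ... | D , mp | yes N∣n = _ , Monic-* mp (isMonic (ih N (positive N∣n) N<n))
    ... | D , mp | no  _   = _ , Monic-* mp Monic-1

    -- Coprime divisors multiply: c X = h p, X = H φ and a p + b φ = e give e c X = (a c H + b h) p
    -- φ. The integer accumulates, and `quotMonic-exact` removes it at the end.
    pr-∣-q^-1 : ∀ N → N ℕ.≤ n₊ → ∃ λ c → ∃ λ h → c ≢ + 0 × constP c *P q^ n₊ −1 ≋ h *P pr n₊ N
    pr-∣-q^-1 zero    _   = + 1 , q^ n₊ −1 , (λ ()) , *P-comm oneP (q^ n₊ −1)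
    pr-∣-q^-1 (suc N) N<n with pr-∣-q^-1 N (ℕ.<⇒≤ N<n) | N ∣? n₊ | pr-Coprime N N ℕ.≤-refl N<n
    ... | c , h , c≢0 , eq | no  _   | _ = c , h , c≢0 , ≋-trans eq (*-congˡ {h} (≋-sym (≋-trans (*P-comm (pr n₊ N) oneP) (*P-identityˡ (pr n₊ N)))))
    ... | c , h , c≢0 , eq | yes N∣n | bezout a b e e≢0 bz = e ℤ.* c , a *P constP c *P H +P b *P h , nonzero , (begin
      constP (e ℤ.* c) *P X                  ≈⟨ *-congʳ {X} (constP-* e C) ⟨
      constP e *P C *P X                     ≈⟨ *-congʳ {X} (*-congʳ {C} bz) ⟨
      (a *P p +P b *P φ) *P C *P X           ≈⟨ solve 6 (λ a p b φ c x → (a :* p :+ b :* φ) :* c :* x := a :* p :* c :* x :+ b :* φ :* (c :* x)) ≋-refl a p b φ C X ⟩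
      a *P p *P C *P X +P b *P φ *P (C *P X) ≈⟨ +-cong (*-congˡ {a *P p *P C} X≋) (*-congˡ {b *P φ} eq) ⟩
      a *P p *P C *P (H *P φ) +P b *P φ *P (h *P p)
        ≈⟨ solve 7 (λ a p b φ c H h → a :* p :* c :* (H :* φ) :+ b :* φ :* (h :* p) := (a :* c :* H :+ b :* h) :* (p :* φ)) ≋-refl a p b φ C H h ⟩
      (a *P C *P H +P b *P h) *P (p *P φ) ∎)
      where
      C = constP c
      X = q^ n₊ −1
      p = pr n₊ N
      φ = Φ N
      k = proj₁ (q^-1-∣ N∣n)
      H = k *P pr N N
      X≋ : X ≋ H *P φ
      X≋ = begin
        X                     ≈⟨ proj₂ (q^-1-∣ N∣n) ⟩
        k *P q^ N −1          ≈⟨ *-congˡ {k} (factors (ih N (positive N∣n) N<n)) ⟩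
        k *P (φ *P pr N N)    ≈⟨ solve 3 (λ k φ p → k :* (φ :* p) := k :* p :* φ) ≋-refl k φ (pr N N) ⟩
        H *P φ                ∎
      nonzero : e ℤ.* c ≢ + 0
      nonzero z with ℤ.i*j≡0⇒i≡0∨j≡0 e z
      ... | inj₁ e≡0 = e≢0 e≡0
      ... | inj₂ c≡0 = c≢0 c≡0

    cyclotomic-step : Cyclotomic n₊
    cyclotomic-step with pr-Monic n₊ ℕ.≤-refl | pr-∣-q^-1 n₊ ℕ.≤-refl
    ... | D , mp | c , h , c≢0 , eq = record
      { degree  = proj₁ mΦ
      ; isMonic = proj₂ mΦ
      ; factors = fct
      }
      where
      Ψ = prodP (map Φ (filter (_∣? n₊) (upTo n₊)))
      Ψ≋ : Ψ ≋ pr n₊ n₊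
      Ψ≋ = prodP≋pr n₊ n₊
      fct : q^ n₊ −1 ≋ Φ n₊ *P pr n₊ n₊
      fct = begin
        q^ n₊ −1                       ≈⟨ quotMonic-exact (q^ n₊ −1) Ψ D c h (Monic-resp (≋-sym Ψ≋) mp) c≢0 (≋-trans eq (*-congˡ {h} (≋-sym Ψ≋))) ⟩
        quotMonic (q^ n₊ −1) Ψ *P Ψ    ≡⟨ ≡.cong (_*P Ψ) (≡.sym (Φ-quot n)) ⟩
        Φ n₊ *P Ψ                      ≈⟨ *-congˡ {Φ n₊} Ψ≋ ⟩
        Φ n₊ *P pr n₊ n₊               ∎
      q^-1-Monic : Monic (q^ n₊ −1) n₊
      q^-1-Monic = monic (≡.trans (coeff-+ (qpow n₊) (negP oneP) n₊) (≡.cong (ℤ._+ + 0) (Monic.leading (qpow-Monic n₊))))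
        λ { (suc i) n<i → ≡.trans (coeff-+ (qpow n₊) (negP oneP) (suc i)) (≡.cong (ℤ._+ + 0) (Monic.bounded (qpow-Monic n₊) (suc i) n<i)) }
      mΦ = monic-factor (Φ n₊) n₊ mp (Monic-resp fct q^-1-Monic)

  cyclotomic : ∀ n → 1 ℕ.≤ n → Cyclotomic n
  cyclotomic n 1≤n = go n 1≤n (ℕ.<-wellFounded n)
    where
    go : ∀ n → 1 ℕ.≤ n → Acc ℕ._<_ n → Cyclotomic n
    go (suc n) _ (acc rs) = cyclotomic-step n λ k 1≤k k<n → go k 1≤k (rs k<n)

  Φ-factors : ∀ {n} → 1 ℕ.≤ n → q^ n −1 ≋ Φ n *P pr n n
  Φ-factors 1≤n = factors (cyclotomic _ 1≤n)

  Φ-Coprime-q^-1 : ∀ {n} → 1 ℕ.≤ n → ∀ e → ¬ n ℕ.∣ e → Coprime (q^ e −1) (Φ n)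
  Φ-Coprime-q^-1 {n} 1≤n = Coprime-q^-1 1≤n (cyclotomic n 1≤n) λ g 1≤g _ → cyclotomic g 1≤g

  Φ-Coprime-geo : ∀ {n} → 1 ℕ.≤ n → ∀ k → 1 ℕ.≤ k → Coprime (geo k n) (Φ n)
  Φ-Coprime-geo {n} 1≤n k 1≤k = Coprime-mod (+ k) (y *P pr n n) (λ e → ℕ.<⇒≢ 1≤k (≡.sym (ℤ.+-injective e))) (begin
    geo k n                                    ≈⟨ proj₂ (geo-mod k n) ⟩
    constP (+ k) +P y *P q^ n −1               ≈⟨ +-congˡ {constP (+ k)} (*-congˡ {y} (Φ-factors 1≤n)) ⟩
    constP (+ k) +P y *P (Φ n *P pr n n)       ≈⟨ solve 4 (λ c y Φ p → c :+ y :* (Φ :* p) := c :+ y :* p :* Φ) ≋-refl (constP (+ k)) y (Φ n) (pr n n) ⟩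
    constP (+ k) +P y *P pr n n *P Φ n         ∎)
    where
    y = proj₁ (geo-mod k n)

  -- q^k divides q^{kn}, which is 1 modulo Φ n.
  Φ-Coprime-qpow : ∀ {n} → 1 ℕ.≤ n → ∀ k → Coprime (qpow k) (Φ n)
  Φ-Coprime-qpow {suc n} 1≤n k = Coprime-factor (qpow (k ℕ.* suc n)) (qpow (k ℕ.* n))
    (Coprime-mod (+ 1) (geo k (suc n) *P pr (suc n) (suc n)) (λ ()) (begin
      qpow (k ℕ.* suc n)                                      ≈⟨ solve 1 (λ x → x := con (+ 1) :+ (x :- con (+ 1))) ≋-refl (qpow (k ℕ.* suc n)) ⟩
      oneP +P q^ (k ℕ.* suc n) −1                             ≈⟨ +-congˡ {oneP} (≋-trans (geo-* k (suc n)) (*-congˡ {geo k (suc n)} (Φ-factors 1≤n))) ⟩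
      oneP +P geo k (suc n) *P (Φ (suc n) *P pr (suc n) (suc n)) ≈⟨ solve 3 (λ g Φ p → con (+ 1) :+ g :* (Φ :* p) := con (+ 1) :+ g :* p :* Φ) ≋-refl (geo k (suc n)) (Φ (suc n)) (pr (suc n) (suc n)) ⟩
      oneP +P geo k (suc n) *P pr (suc n) (suc n) *P Φ (suc n) ∎))
    (≋-trans (≡.subst (λ e → qpow (k ℕ.* suc n) ≋ qpow e) (≡.trans (ℕ.*-suc k n) (ℕ.+-comm k (k ℕ.* n))) ≋-refl) (qpow-+ (k ℕ.* n) k))

-- Transfer to rational functions in q

module A = CommutativeRing polyRing
module AS = IntegerSolver polyRing

open Localisation polyRing using (Regular)
open CyclotomicPolynomials

-- Abstract, so that these proofs are never unfolded inside the denominators they certify.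
abstract
  regular-qpow : ∀ e → Regular (qpow e)
  regular-qpow e p eq = coeffwise λ i → ≡.trans (≡.sym (coeff-qpow-* e p i)) (coeff≡ (≋-trans (*P-comm (qpow e) p) eq) (e ℕ.+ i))

  regular-1-q^ : ∀ e → Regular (oneP -P qpow (suc e))
  regular-1-q^ e p eq = regular-q^-1 e p (≋-trans
    (AS.solve 2 (λ p x → p AS.:* (x AS.:- AS.con (+ 1)) AS.:= AS.:- (p AS.:* (AS.con (+ 1) AS.:- x))) ≋-refl p (qpow (suc e)))
    (A.-‿cong eq))

qint-* : ∀ k → (oneP -P qpow 1) *P qint k ≋ oneP -P qpow k
qint-* zero    = ≋-trans (*P-zeroʳ (oneP -P qpow 1)) (≋-sym (+P-inverseʳ oneP))
qint-* (suc k) = ≋-trans (*P-distribˡ (oneP -P qpow 1) (qint k) (qpow k)) (≋-trans (A.+-congʳ (qint-* k))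
  (≋-trans (AS.solve 2 (λ x y → let i = AS.con (+ 1) in (i AS.:- y) AS.:+ (i AS.:- x) AS.:* y AS.:= i AS.:- x AS.:* y) ≋-refl (qpow 1) (qpow k))
    (A.+-congˡ {oneP} (A.-‿cong (≋-sym (qpow-+ 1 k))))))

Congruent : ℕ → ℕ → ℕ → Set
Congruent d n k = lhs d k ≡F rhs d n [mod Φ n *P Φ n *P Φ n ]

2*triangle : ∀ k → k ℕ.* k ℕ.+ k ≡ triangle k ℕ.* 2
2*triangle zero    = ≡.refl
2*triangle (suc k) = ≡.trans (lem k) (≡.trans (≡.cong (ℕ._+ suc k ℕ.* 2) (2*triangle k)) (≡.sym (ℕ.*-distribʳ-+ 2 (triangle k) (suc k))))
  where
  lem : ∀ k → suc k ℕ.* suc k ℕ.+ suc k ≡ k ℕ.* k ℕ.+ k ℕ.+ suc k ℕ.* 2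
  lem = ℕ.solve-∀

record Inverting {k ℓ} (K : CommutativeRing k ℓ) : Set (k Level.⊔ ℓ) where
  open CommutativeRing K
  field
    ι           : Poly → Carrier
    ι-cong      : ∀ {x y} → x ≋ y → ι x ≈ ι y
    ι-injective : ∀ {x y} → ι x ≈ ι y → x ≋ y
    ι-1         : ι oneP ≈ 1#
    ι-+         : ∀ x y → ι (x +P y) ≈ ι x + ι y
    ι-*         : ∀ x y → ι (x *P y) ≈ ι x * ι y
    inv         : ∀ s → Regular s → Carrier
    ι-inv       : ∀ s rs → ι s * inv s rs ≈ 1#

-- The ring K is a parameter because unfolding actual fractions makes the ring solver explode.
module Rational {k₀ ℓ} (K : CommutativeRing k₀ ℓ) (J : Inverting K) where
  open Signed using (_∣_; ∣⇒∣ᵤ; ∣ᵤ⇒∣)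
  open CommutativeRing K hiding (zero)
  open Inverting J
  open IntegerSolver K
  open QSeries K
  open Relation.Binary.Reasoning.Setoid setoid
  open import Algebra.Properties.AbelianGroup +-abelianGroup using (inverseʳ-unique)

  ι-0 : ι zeroP ≈ 0#
  ι-0 = begin
    ι zeroP                          ≈⟨ solve 1 (λ x → x := (x :+ x) :- x) refl (ι zeroP) ⟩
    (ι zeroP + ι zeroP) - ι zeroP    ≈⟨ +-congʳ (ι-+ zeroP zeroP) ⟨
    ι zeroP - ι zeroP                ≈⟨ -‿inverseʳ _ ⟩
    0#                               ∎

  ι-neg : ∀ x → ι (negP x) ≈ - ι x
  ι-neg x = inverseʳ-unique (ι x) (ι (negP x)) (trans (sym (ι-+ x (negP x))) (trans (ι-cong (+P-inverseʳ x)) ι-0))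

  ι-sub : ∀ x y → ι (x -P y) ≈ ι x - ι y
  ι-sub x y = trans (ι-+ x (negP y)) (+-congˡ (ι-neg y))

  q q⁻¹ : Carrier
  q = ι (qpow 1)
  q⁻¹ = inv (qpow 1) (regular-qpow 1)

  E⁻ : ℕ → Carrier
  E⁻ zero    = 1#
  E⁻ (suc k) = E⁻ k * q⁻¹

  E : ℤ → Carrier
  E (+ k)    = ι (qpow k)
  E -[1+ k ] = E⁻ (suc k)

  ι-qpow-suc : ∀ k → ι (qpow (suc k)) ≈ q * ι (qpow k)
  ι-qpow-suc k = trans (ι-cong (qpow-+ 1 k)) (ι-* (qpow 1) (qpow k))

  E⁻-cancel : ∀ i j → ι (qpow (suc i)) * E⁻ (suc j) ≈ ι (qpow i) * E⁻ j
  E⁻-cancel i j = begin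
    ι (qpow (suc i)) * (E⁻ j * q⁻¹)        ≈⟨ *-congʳ (ι-qpow-suc i) ⟩
    q * ι (qpow i) * (E⁻ j * q⁻¹)          ≈⟨ solve 4 (λ q x e r → q :* x :* (e :* r) := x :* e :* (q :* r)) refl q (ι (qpow i)) (E⁻ j) q⁻¹ ⟩
    ι (qpow i) * E⁻ j * (q * q⁻¹)          ≈⟨ *-congˡ (ι-inv (qpow 1) _) ⟩
    ι (qpow i) * E⁻ j * 1#                 ≈⟨ *-identityʳ _ ⟩
    ι (qpow i) * E⁻ j                      ∎

  E⁻-inverse : ∀ k → ι (qpow k) * E⁻ k ≈ 1#
  E⁻-inverse zero    = trans (*-identityʳ _) ι-1
  E⁻-inverse (suc k) = trans (E⁻-cancel k k) (E⁻-inverse k)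

  E⁻-+ : ∀ i j → E⁻ (i ℕ.+ j) ≈ E⁻ i * E⁻ j
  E⁻-+ zero    j = sym (*-identityˡ _)
  E⁻-+ (suc i) j = trans (*-congʳ (E⁻-+ i j)) (solve 3 (λ x y r → x :* y :* r := x :* r :* y) refl (E⁻ i) (E⁻ j) q⁻¹)

  E-⊖ : ∀ i j → E (i ℤ.⊖ j) ≈ ι (qpow i) * E⁻ j
  E-⊖ zero    zero    = sym (*-identityʳ _)
  E-⊖ zero    (suc j) = sym (trans (*-congʳ ι-1) (*-identityˡ _))
  E-⊖ (suc i) zero    = sym (*-identityʳ _)
  E-⊖ (suc i) (suc j) = trans (reflexive (≡.cong E (ℤ.[1+m]⊖[1+n]≡m⊖n i j))) (trans (E-⊖ i j) (sym (E⁻-cancel i j)))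

  E-+ : ∀ i j → E (i ℤ.+ j) ≈ E i * E j
  E-+ (+ i)    (+ j)    = trans (ι-cong (qpow-+ i j)) (ι-* (qpow i) (qpow j))
  E-+ (+ i)    -[1+ j ] = E-⊖ i (suc j)
  E-+ -[1+ i ] (+ j)    = trans (E-⊖ j (suc i)) (*-comm _ _)
  E-+ -[1+ i ] -[1+ j ] = trans (reflexive (≡.cong (λ k → E⁻ (suc k)) (≡.sym (ℕ.+-suc i j)))) (E⁻-+ (suc i) (suc j))

  o : ℤ → Carrier
  o e = 1# - E e

  o-ι : ∀ e → ι (oneP -P qpow e) ≈ o (+ e)
  o-ι e = trans (ι-sub oneP (qpow e)) (+-congʳ ι-1)

  -- Junk value 0 at e = 0.
  io : ℤ → Carrier
  io (+ zero)  = 0#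
  io (+ suc k) = inv (oneP -P qpow (suc k)) (regular-1-q^ k)
  io -[1+ k ]  = io (+ suc k) * - ι (qpow (suc k))

  o-neg : ∀ k → o -[1+ k ] ≈ - E -[1+ k ] * o (+ suc k)
  o-neg k = begin
    1# - e                 ≈⟨ +-congʳ (E⁻-inverse (suc k)) ⟨
    x * e - e              ≈⟨ solve 2 (λ x e → x :* e :- e := :- e :* (con (+ 1) :- x)) refl x e ⟩
    - e * (1# - x)         ∎
    where
    e = E⁻ (suc k)
    x = ι (qpow (suc k))

  o-io : ∀ e → e ≢ + 0 → (1# - E e) * io e ≈ 1#
  o-io (+ zero)  e≢0 = contradiction ≡.refl e≢0
  o-io (+ suc k) _   = trans (*-congʳ (sym (o-ι (suc k)))) (ι-inv (oneP -P qpow (suc k)) _)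
  o-io -[1+ k ]  _   = begin
    o -[1+ k ] * (i * - x)          ≈⟨ *-congʳ (o-neg k) ⟩
    - e * o (+ suc k) * (i * - x)   ≈⟨ solve 4 (λ e o i x → :- e :* o :* (i :* :- x) := x :* e :* (o :* i)) refl e (o (+ suc k)) i x ⟩
    x * e * (o (+ suc k) * i)       ≈⟨ *-cong (E⁻-inverse (suc k)) (o-io (+ suc k) λ ()) ⟩
    1# * 1#                         ≈⟨ *-identityʳ 1# ⟩
    1#                              ∎
    where
    e = E⁻ (suc k)
    x = ι (qpow (suc k))
    i = io (+ suc k)

  powersOfQ : PowersOfQ K
  powersOfQ = record { E = E ; E-0 = ι-1 ; E-+ = E-+ ; io = io ; o-io = o-io }

  -- The local ring at Φ_n

  module Local (n : ℕ) (1≤n : 1 ℕ.≤ n) where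
    -- Coprimality is Bézout up to a nonzero integer, as over ℚ. This admits the denominators
    -- `geo j n` in `pole-at`, which are only congruent to j modulo Φ_n.
    record O (x : Carrier) : Set ℓ where
      constructor integral
      field
        numerator denominator : Poly
        coprime  : Coprime denominator (Φ n)
        equation : x * ι denominator ≈ ι numerator

    O-resp : ∀ {x y} → x ≈ y → O x → O y
    O-resp x≈y (integral p s co eq) = integral p s co (trans (*-congʳ (sym x≈y)) eq)

    O-+ : ∀ {x y} → O x → O y → O (x + y)
    O-+ {x} {y} (integral p s co eq) (integral p′ s′ co′ eq′) = integral (p *P s′ +P p′ *P s) (s *P s′) (Coprime-* co co′) (begin
      (x + y) * ι (s *P s′)                  ≈⟨ *-congˡ {x + y} (ι-* s s′) ⟩
      (x + y) * (ι s * ι s′)                 ≈⟨ solve 4 (λ x y s s′ → (x :+ y) :* (s :* s′) := x :* s :* s′ :+ y :* s′ :* s) refl x y (ι s) (ι s′) ⟩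
      x * ι s * ι s′ + y * ι s′ * ι s        ≈⟨ +-cong (*-congʳ eq) (*-congʳ eq′) ⟩
      ι p * ι s′ + ι p′ * ι s                ≈⟨ +-cong (ι-* p s′) (ι-* p′ s) ⟨
      ι (p *P s′) + ι (p′ *P s)              ≈⟨ ι-+ _ _ ⟨
      ι (p *P s′ +P p′ *P s)                 ∎)

    O-* : ∀ {x y} → O x → O y → O (x * y)
    O-* {x} {y} (integral p s co eq) (integral p′ s′ co′ eq′) = integral (p *P p′) (s *P s′) (Coprime-* co co′) (begin
      x * y * ι (s *P s′)          ≈⟨ *-congˡ {x * y} (ι-* s s′) ⟩
      x * y * (ι s * ι s′)         ≈⟨ solve 4 (λ x y s s′ → x :* y :* (s :* s′) := x :* s :* (y :* s′)) refl x y (ι s) (ι s′) ⟩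
      x * ι s * (y * ι s′)         ≈⟨ *-cong eq eq′ ⟩
      ι p * ι p′                   ≈⟨ ι-* p p′ ⟨
      ι (p *P p′)                  ∎)

    O-neg : ∀ {x} → O x → O (- x)
    O-neg {x} (integral p s co eq) = integral (negP p) s co (trans (solve 2 (λ x s → :- x :* s := :- (x :* s)) refl x (ι s)) (trans (-‿cong eq) (sym (ι-neg p))))

    O-ι : ∀ p → O (ι p)
    O-ι p = integral p oneP (Coprime-1 (Φ n)) (trans (*-congˡ ι-1) (*-identityʳ (ι p)))

    O-1 : O 1#
    O-1 = O-resp ι-1 (O-ι oneP)

    O-0 : O 0#
    O-0 = O-resp ι-0 (O-ι zeroP)

    O-inverse : ∀ {x} s → Coprime s (Φ n) → ι s * x ≈ 1# → O x
    O-inverse s co eq = integral oneP s co (trans (*-comm _ (ι s)) (trans eq (sym ι-1)))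

    O-E : ∀ e → O (E e)
    O-E (+ k)    = O-ι (qpow k)
    O-E -[1+ k ] = O-inverse (qpow (suc k)) (Φ-Coprime-qpow 1≤n (suc k)) (E⁻-inverse (suc k))

    1-q^-Coprime : ∀ e → ¬ n ℕ.∣ e → Coprime (oneP -P qpow e) (Φ n)
    1-q^-Coprime e n∤e = Coprime-factor (q^ e −1) (negP oneP) (Φ-Coprime-q^-1 1≤n e n∤e)
      (AS.solve 1 (λ x → x AS.:- AS.con (+ 1) AS.:= AS.:- AS.con (+ 1) AS.:* (AS.con (+ 1) AS.:- x)) ≋-refl (qpow e))

    io-O-suc : ∀ k → ¬ + n ∣ + suc k → O (io (+ suc k))
    io-O-suc k n∤e = O-inverse (oneP -P qpow (suc k)) (1-q^-Coprime (suc k) (λ n∣ → n∤e (∣ᵤ⇒∣ n∣))) (ι-inv (oneP -P qpow (suc k)) _)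

    io-O : ∀ e → ¬ + n ∣ e → O (io e)
    io-O (+ zero)  _   = O-0
    io-O (+ suc k) n∤e = io-O-suc k n∤e
    io-O -[1+ k ]  n∤e = O-* (io-O-suc k (λ n∣ → n∤e (∣ᵤ⇒∣ (∣⇒∣ᵤ n∣)))) (O-neg (O-ι (qpow (suc k))))

    1-q^-geo : ∀ j → oneP -P qpow (j ℕ.* n) ≋ (oneP -P qpow n) *P geo j n
    1-q^-geo j = ≋-trans (AS.solve 1 (λ x → AS.con (+ 1) AS.:- x AS.:= AS.:- (x AS.:- AS.con (+ 1))) ≋-refl (qpow (j ℕ.* n)))
      (≋-trans (A.-‿cong (geo-* j n)) (AS.solve 2 (λ g x → AS.:- (g AS.:* (x AS.:- AS.con (+ 1))) AS.:= (AS.con (+ 1) AS.:- x) AS.:* g) ≋-refl (geo j n) (qpow n)))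

    o-* : ∀ j → o (+ (j ℕ.* n)) ≈ o (+ n) * ι (geo j n)
    o-* j = begin
      o (+ (j ℕ.* n))                       ≈⟨ o-ι (j ℕ.* n) ⟨
      ι (oneP -P qpow (j ℕ.* n))            ≈⟨ ι-cong (1-q^-geo j) ⟩
      ι ((oneP -P qpow n) *P geo j n)       ≈⟨ ι-* (oneP -P qpow n) (geo j n) ⟩
      ι (oneP -P qpow n) * ι (geo j n)      ≈⟨ *-congʳ (o-ι n) ⟩
      o (+ n) * ι (geo j n)                 ∎

    o-∣ : ∀ e → + n ∣ e → ∃ λ w → O w × o e ≈ o (+ n) * w
    o-∣ (+ k) n∣k with ∣⇒∣ᵤ n∣k
    ... | ℕ.divides j ≡.refl = ι (geo j n) , O-ι (geo j n) , o-* j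
    o-∣ -[1+ k ] n∣k with ∣⇒∣ᵤ n∣k
    ... | ℕ.divides j eq = - E -[1+ k ] * ι (geo j n) , O-* (O-neg (O-E -[1+ k ])) (O-ι (geo j n)) , (begin
      o -[1+ k ]                                ≈⟨ o-neg k ⟩
      - E -[1+ k ] * o (+ suc k)                ≡⟨ ≡.cong (λ e → - E -[1+ k ] * o (+ e)) eq ⟩
      - E -[1+ k ] * o (+ (j ℕ.* n))            ≈⟨ *-congˡ { - E -[1+ k ]} (o-* j) ⟩
      - E -[1+ k ] * (o (+ n) * ι (geo j n))    ≈⟨ solve 3 (λ e t g → e :* (t :* g) := t :* (e :* g)) refl (- E -[1+ k ]) (o (+ n)) (ι (geo j n)) ⟩
      o (+ n) * (- E -[1+ k ] * ι (geo j n))    ∎)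

    O-o : ∀ e → O (o e)
    O-o e = O-+ O-1 (O-neg (O-E e))

    -- t / (1 - q^{jn}) = 1 / (1 + q^n + ... + q^{(j-1)n}), whose denominator is j modulo Φ n.
    pole-at : ∀ k → O (o (+ n) * io (+ suc k))
    pole-at k with n ℕ.∣? suc k
    ... | no  n∤k = O-* (O-o (+ n)) (io-O (+ suc k) λ n∣ → n∤k (∣⇒∣ᵤ n∣))
    ... | yes (ℕ.divides j eq) = integral oneP (geo j n) (Φ-Coprime-geo 1≤n j (ℕ.n≢0⇒n>0 λ { ≡.refl → contradiction eq λ () })) (trans (begin
      o (+ n) * io (+ suc k) * ι (geo j n)     ≈⟨ solve 3 (λ t i g → t :* i :* g := t :* g :* i) refl (o (+ n)) (io (+ suc k)) (ι (geo j n)) ⟩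
      o (+ n) * ι (geo j n) * io (+ suc k)     ≈⟨ *-congʳ (o-* j) ⟨
      o (+ (j ℕ.* n)) * io (+ suc k)           ≡⟨ ≡.cong (λ e → o (+ e) * io (+ suc k)) (≡.sym eq) ⟩
      o (+ suc k) * io (+ suc k)               ≈⟨ o-io (+ suc k) (λ ()) ⟩
      1#                                       ∎) (sym ι-1))

    io-pole : ∀ e → O (o (+ n) * io e)
    io-pole (+ zero)  = O-resp (sym (zeroʳ (o (+ n)))) O-0
    io-pole (+ suc k) = pole-at k
    io-pole -[1+ k ]  = O-resp (*-assoc _ _ _) (O-* (pole-at k) (O-neg (O-ι (qpow (suc k)))))

    localAt : LocalAt powersOfQ ℓ (+ n)
    localAt = record
      { subring = record { O = O ; O-resp = O-resp ; O-1 = O-1 ; O-+ = O-+ ; O-* = O-* ; O-neg = O-neg }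
      ; O-E     = O-E
      ; o-∣     = o-∣
      ; io-O    = io-O
      ; io-pole = io-pole
      }

  -- Cross-multiplied, to match `≡F`, where both denominators have been multiplied out.
  record Represents (z : Carrier) (f : Frac) : Set ℓ where
    constructor represents
    field equation : z * ι (proj₂ f) ≈ ι (proj₁ f)

  Represents-sum : ∀ {f g} → (∀ k → Represents (f k) (g k)) → ∀ N → Represents (Σ f N) (sumF g N)
  Represents-sum rep zero = represents (trans (zeroˡ _) (sym ι-0))
  Represents-sum {f} {g} rep (suc N) with Represents-sum rep N | rep N
  ... | represents e | represents e′ = represents (begin
    (Σ f N + f N) * ι (s *P s′)                  ≈⟨ *-congˡ {Σ f N + f N} (ι-* s s′) ⟩
    (Σ f N + f N) * (ι s * ι s′)                 ≈⟨ solve 4 (λ x y s s′ → (x :+ y) :* (s :* s′) := x :* s :* s′ :+ y :* s′ :* s) refl (Σ f N) (f N) (ι s) (ι s′) ⟩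
    Σ f N * ι s * ι s′ + f N * ι s′ * ι s        ≈⟨ +-cong (*-congʳ e) (*-congʳ e′) ⟩
    ι p * ι s′ + ι p′ * ι s                      ≈⟨ +-cong (ι-* p s′) (ι-* p′ s) ⟨
    ι (p *P s′) + ι (p′ *P s)                    ≈⟨ ι-+ _ _ ⟨
    ι (p *P s′ +P p′ *P s)                       ∎)
    where
    p = proj₁ (sumF g N)
    s = proj₂ (sumF g N)
    p′ = proj₁ (g N)
    s′ = proj₂ (g N)

  poch-Π : ∀ a b {a′ b′} → + a ≡ a′ → + b ≡ b′ → ∀ k → ι (poch a b k) ≈ Π o a′ b′ k
  poch-Π a b ≡.refl ≡.refl zero    = ι-1
  poch-Π a b ≡.refl ≡.refl (suc k) = trans (ι-* (poch a b k) (oneP -P qpow (a ℕ.+ b ℕ.* k)))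
    (*-cong (poch-Π a b ≡.refl ≡.refl k) (trans (o-ι (a ℕ.+ b ℕ.* k)) (reflexive (≡.cong (λ e → o (+ a ℤ.+ e)) (ℤ.pos-* b k)))))

  Π-inverse : ∀ a b k → (∀ l → a ℤ.+ b ℤ.* + l ≢ + 0) → Π o a b k * Π io a b k ≈ 1#
  Π-inverse a b zero    ≢0 = *-identityʳ 1#
  Π-inverse a b (suc k) ≢0 = begin
    Π o a b k * x * (Π io a b k * y)    ≈⟨ solve 4 (λ p x i y → p :* x :* (i :* y) := p :* i :* (x :* y)) refl (Π o a b k) x (Π io a b k) y ⟩
    Π o a b k * Π io a b k * (x * y)    ≈⟨ *-cong (Π-inverse a b k ≢0) (o-io _ (≢0 k)) ⟩
    1# * 1#                             ≈⟨ *-identityʳ 1# ⟩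
    1#                                  ∎
    where
    x = o (a ℤ.+ b ℤ.* + k)
    y = io (a ℤ.+ b ℤ.* + k)

  io-qint : ∀ k → io (+ 1) * o (+ k) ≈ ι (qint k)
  io-qint k = begin
    io (+ 1) * o (+ k)                          ≈⟨ *-congˡ {io (+ 1)} (o-ι k) ⟨
    io (+ 1) * ι (oneP -P qpow k)               ≈⟨ *-congˡ {io (+ 1)} (ι-cong (qint-* k)) ⟨
    io (+ 1) * ι ((oneP -P qpow 1) *P qint k)   ≈⟨ *-congˡ {io (+ 1)} (trans (ι-* (oneP -P qpow 1) (qint k)) (*-congʳ (o-ι 1))) ⟩
    io (+ 1) * (o (+ 1) * ι (qint k))           ≈⟨ solve 3 (λ i o x → i :* (o :* x) := o :* i :* x) refl (io (+ 1)) (o (+ 1)) (ι (qint k)) ⟩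
    o (+ 1) * io (+ 1) * ι (qint k)             ≈⟨ *-congʳ (o-io (+ 1) (λ ())) ⟩
    1# * ι (qint k)                             ≈⟨ *-identityˡ _ ⟩
    ι (qint k)                                  ∎

  ι-*₃ : ∀ a b c → ι (a *P b *P c) ≈ ι a * ι b * ι c
  ι-*₃ a b c = trans (ι-* (a *P b) c) (*-congʳ (ι-* a b))

  ι-*₄ : ∀ a b c e → ι (a *P b *P c *P e) ≈ ι a * ι b * ι c * ι e
  ι-*₄ a b c e = trans (ι-* (a *P b *P c) e) (*-congʳ (ι-*₃ a b c))

  Σ-*ˡ : ∀ x f N → Σ (λ k → x * f k) N ≈ x * Σ f N
  Σ-*ˡ x f zero    = sym (zeroʳ x)
  Σ-*ˡ x f (suc N) = trans (+-congʳ (Σ-*ˡ x f N)) (sym (distribˡ x (Σ f N) (f N)))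

  ι-*₆ : ∀ a b c e f g → ι (a *P b *P c *P e *P f *P g) ≈ ι a * ι b * ι c * ι e * ι f * ι g
  ι-*₆ a b c e f g = trans (ι-* (a *P b *P c *P e *P f) g) (*-congʳ (trans (ι-* (a *P b *P c *P e) f) (*-congʳ (ι-*₄ a b c e))))

  module Main (d′ m : ℕ) (1≤d′ : 1 ℕ.≤ d′) (1≤m : 1 ℕ.≤ m) where
    d : ℕ
    d = suc d′
    open Modulus d m

    1≤n : 1 ℕ.≤ n
    1≤n = s≤s z≤n

    open Local n 1≤n

    h : ℕ
    h = ℕ.⌊ d /2⌋

    1≤h : 1 ℕ.≤ h
    1≤h = ℕ.⌊n/2⌋-mono (s≤s 1≤d′)

    2h≤d : h ℕ.+ h ℕ.≤ d
    2h≤d = ℕ.≤-trans (ℕ.+-monoʳ-≤ h (ℕ.⌊n/2⌋≤⌈n/2⌉ d)) (ℕ.≤-reflexive (ℕ.⌊n/2⌋+⌈n/2⌉≡n d))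

    d≤2h+1 : d ℕ.≤ suc (h ℕ.+ h)
    d≤2h+1 = ℕ.≤-trans (ℕ.≤-reflexive (≡.sym (ℕ.⌊n/2⌋+⌈n/2⌉≡n d))) (ℕ.≤-trans (ℕ.+-monoʳ-≤ h (⌈n/2⌉≤ d)) (ℕ.≤-reflexive (ℕ.+-suc h h)))
      where
      ⌈n/2⌉≤ : ∀ k → ℕ.⌈ k /2⌉ ℕ.≤ suc ℕ.⌊ k /2⌋
      ⌈n/2⌉≤ zero          = z≤n
      ⌈n/2⌉≤ (suc zero)    = s≤s z≤n
      ⌈n/2⌉≤ (suc (suc k)) = s≤s (⌈n/2⌉≤ k)

    open Congruence K powersOfQ d m h (s≤s 1≤d′) 1≤m 1≤h 2h≤d d≤2h+1 localAt
      using (D≢0; t; closedForm; short-sum; full-sum; U; 2D; 2D≢0; V; val; V-*ˡ; V-resp)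

    2D≡ : + (2 ℕ.* d) ≡ 2D
    2D≡ = ℤ.pos-* 2 d

    pole-base≡ : + (d ℕ.+ 2) ≡ + 2 ℤ.+ D
    pole-base≡ = ≡.cong +_ (ℕ.+-comm d 2)

    pole≢0′ : ∀ l → + 2 ℤ.+ D ℤ.+ 2D ℤ.* + l ≢ + 0
    pole≢0′ l e = contradiction (≡.trans (≡.cong (λ i → + 2 ℤ.+ D ℤ.+ i) (≡.trans (ℤ.pos-* (2 ℕ.* d) l) (≡.cong (ℤ._* + l) 2D≡))) e) λ ()

    -- 1/(1 - q) turns 1 - q^{3dk+1} into the q-integer, and each denominator cancels its product of
    -- `io`.
    Represents-term : ∀ k → Represents (io (+ 1) * U (+ 1) k) (term d k)
    Represents-term k = represents (begin
      io (+ 1) * (o₀ * (p₁ * p₁ * p₂ * p₃) * e * (a * a * b * f)) * ι (poch d d k *P poch (d ℕ.+ 2) (2 ℕ.* d) k *P poch (2 ℕ.* d) (2 ℕ.* d) k *P poch (2 ℕ.* d) (2 ℕ.* d) k)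
        ≈⟨ *-congˡ {io (+ 1) * U (+ 1) k} (trans (ι-*₄ (poch d d k) (poch (d ℕ.+ 2) (2 ℕ.* d) k) (poch (2 ℕ.* d) (2 ℕ.* d) k) (poch (2 ℕ.* d) (2 ℕ.* d) k))
             (*-cong (*-cong (*-cong (poch-Π d d ≡.refl ≡.refl k) (poch-Π (d ℕ.+ 2) (2 ℕ.* d) pole-base≡ 2D≡ k)) (poch-Π (2 ℕ.* d) (2 ℕ.* d) 2D≡ 2D≡ k)) (poch-Π (2 ℕ.* d) (2 ℕ.* d) 2D≡ 2D≡ k))) ⟩
      io (+ 1) * (o₀ * (p₁ * p₁ * p₂ * p₃) * e * (a * a * b * f)) * (F * B * A′ * A′)
        ≈⟨ solve 12 (λ i o p₁ p₂ p₃ e a b f F B A → i :* (o :* (p₁ :* p₁ :* p₂ :* p₃) :* e :* (a :* a :* b :* f)) :* (F :* B :* A :* A)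
             := i :* o :* p₃ :* p₂ :* p₁ :* p₁ :* e :* (A :* a :* (A :* a) :* (B :* b) :* (F :* f))) refl (io (+ 1)) o₀ p₁ p₂ p₃ e a b f F B A′ ⟩
      io (+ 1) * o₀ * p₃ * p₂ * p₁ * p₁ * e * (A′ * a * (A′ * a) * (B * b) * (F * f))
        ≈⟨ *-congˡ {io (+ 1) * o₀ * p₃ * p₂ * p₁ * p₁ * e} (*-cong (*-cong (*-cong Aa Aa) (Π-inverse (+ 2 ℤ.+ D) 2D k pole≢0′)) Ff) ⟩
      io (+ 1) * o₀ * p₃ * p₂ * p₁ * p₁ * e * (1# * 1# * 1# * 1#)
        ≈⟨ solve 1 (λ x → let i = con (+ 1) in x :* (i :* i :* i :* i) := x) refl (io (+ 1) * o₀ * p₃ * p₂ * p₁ * p₁ * e) ⟩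
      io (+ 1) * o₀ * p₃ * p₂ * p₁ * p₁ * e
        ≈⟨ *-cong (*-cong (*-cong (*-cong (*-cong q≈ (poch-Π 1 (2 ℕ.* d) ≡.refl 2D≡ k)) (poch-Π (d ℕ.∸ 1) d ≡.refl ≡.refl k)) (poch-Π 1 d ≡.refl ≡.refl k)) (poch-Π 1 d ≡.refl ≡.refl k)) e≈ ⟨
      ι (qint (3 ℕ.* d ℕ.* k ℕ.+ 1)) * ι (poch 1 (2 ℕ.* d) k) * ι (poch (d ℕ.∸ 1) d k) * ι (poch 1 d k) * ι (poch 1 d k) * ι (qpow ((d ℕ.* (k ℕ.* k ℕ.+ k)) div 2))
        ≈⟨ ι-*₆ (qint (3 ℕ.* d ℕ.* k ℕ.+ 1)) (poch 1 (2 ℕ.* d) k) (poch (d ℕ.∸ 1) d k) (poch 1 d k) (poch 1 d k) (qpow ((d ℕ.* (k ℕ.* k ℕ.+ k)) div 2)) ⟨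
      ι (proj₁ (term d k)) ∎)
      where
      o₀ = o (+ 1 ℤ.+ + 3 ℤ.* D ℤ.* + k)
      p₁ = Π o (+ 1) D k
      p₂ = Π o (D ℤ.- + 1) D k
      p₃ = Π o (+ 1) 2D k
      e = E (D ℤ.* + triangle k)
      a = Π io 2D 2D k
      b = Π io (+ 2 ℤ.+ D) 2D k
      f = Π io D D k
      F = Π o D D k
      B = Π o (+ 2 ℤ.+ D) 2D k
      A′ = Π o 2D 2D k
      lem : ∀ D l → D ℤ.+ D ℤ.* l ≡ D ℤ.* (+ 1 ℤ.+ l)
      lem = solve-∀
      Aa : A′ * a ≈ 1#
      Aa = Π-inverse 2D 2D k λ l eq → 2D≢0 l (≡.trans (≡.sym (lem 2D (+ l))) eq)
      Ff : F * f ≈ 1#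
      Ff = Π-inverse D D k λ l eq → D≢0 l (≡.trans (≡.sym (lem D (+ l))) eq)
      q≈ : ι (qint (3 ℕ.* d ℕ.* k ℕ.+ 1)) ≈ io (+ 1) * o₀
      q≈ = trans (sym (io-qint (3 ℕ.* d ℕ.* k ℕ.+ 1))) (*-congˡ {io (+ 1)} (reflexive (≡.cong o
        (≡.trans (≡.cong +_ (ℕ.+-comm (3 ℕ.* d ℕ.* k) 1)) (≡.cong (λ i → + 1 ℤ.+ i) (≡.trans (ℤ.pos-* (3 ℕ.* d) k) (≡.cong (ℤ._* + k) (ℤ.pos-* 3 d))))))))
      e≈ : ι (qpow ((d ℕ.* (k ℕ.* k ℕ.+ k)) div 2)) ≈ e
      e≈ = reflexive (≡.trans (≡.cong E (≡.cong +_ (≡.trans (≡.cong (ℕ._/ 2) (≡.trans (≡.cong (d ℕ.*_) (2*triangle k)) (≡.sym (ℕ.*-assoc d (triangle k) 2)))) (ℕ.m*n/n≡m (d ℕ.* triangle k) 2))))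
        (≡.cong E (ℤ.pos-* d (triangle k))))

    private
      n∸1≡ : n ℕ.∸ 1 ≡ m ℕ.* (2 ℕ.* d)
      n∸1≡ = lem d m
        where
        lem : ∀ d m → d ℕ.* m ℕ.+ d ℕ.* m ≡ m ℕ.* (2 ℕ.* d)
        lem = ℕ.solve-∀

    n∸1-div-2d : (n ℕ.∸ 1) div (2 ℕ.* d) ≡ m
    n∸1-div-2d = ≡.trans (≡.cong (ℕ._/ (2 ℕ.* d)) n∸1≡) (ℕ.m*n/n≡m m (2 ℕ.* d))

    n∸1-div-d : (n ℕ.∸ 1) div d ≡ m ℕ.+ m
    n∸1-div-d = ≡.trans (≡.cong (ℕ._/ d) (lem d m)) (ℕ.m*n/n≡m (m ℕ.+ m) d)
      where
      lem : ∀ d m → d ℕ.* m ℕ.+ d ℕ.* m ≡ (m ℕ.+ m) ℕ.* d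
      lem = ℕ.solve-∀

    exponent : ((n ℕ.∸ 1) ℕ.* (d ℕ.∸ 1)) div (2 ℕ.* d) ≡ m ℕ.* d′
    exponent = ≡.trans (≡.cong (λ k → (k ℕ.* d′) ℕ./ (2 ℕ.* d)) n∸1≡) (≡.trans (≡.cong (ℕ._/ (2 ℕ.* d)) (lem m (2 ℕ.* d) d′)) (ℕ.m*n/n≡m (m ℕ.* d′) (2 ℕ.* d)))
      where
      lem : ∀ m e d′ → m ℕ.* e ℕ.* d′ ≡ m ℕ.* d′ ℕ.* e
      lem = ℕ.solve-∀

    Represents-rhs : Represents (io (+ 1) * closedForm) (rhs d n)
    Represents-rhs = ≡.subst₂ (λ m′ ex → Represents (io (+ 1) * closedForm) (poch d (2 ℕ.* d) m′ *P qint n , poch (d ℕ.+ 2) (2 ℕ.* d) m′ *P qpow ex))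
      (≡.sym n∸1-div-2d) (≡.sym exponent) (represents (begin
      i * (t * (b * (e * p))) * ι (poch (d ℕ.+ 2) (2 ℕ.* d) m *P qpow (m ℕ.* d′))
        ≈⟨ *-congˡ {i * closedForm} (trans (ι-* (poch (d ℕ.+ 2) (2 ℕ.* d) m) (qpow (m ℕ.* d′))) (*-congʳ (poch-Π (d ℕ.+ 2) (2 ℕ.* d) pole-base≡ 2D≡ m))) ⟩
      i * (t * (b * (e * p))) * (B * e′)
        ≈⟨ solve 7 (λ i t b e p B e′ → i :* (t :* (b :* (e :* p))) :* (B :* e′) := p :* (i :* t) :* (B :* b :* (e :* e′))) refl i t b e p B e′ ⟩
      p * (i * t) * (B * b * (e * e′))
        ≈⟨ *-congˡ {p * (i * t)} (*-cong (Π-inverse (+ 2 ℤ.+ D) 2D m pole≢0′) ee′) ⟩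
      p * (i * t) * (1# * 1#)
        ≈⟨ solve 1 (λ x → x :* (con (+ 1) :* con (+ 1)) := x) refl (p * (i * t)) ⟩
      p * (i * t)
        ≈⟨ *-cong (poch-Π d (2 ℕ.* d) ≡.refl 2D≡ m) (sym (io-qint n)) ⟨
      ι (poch d (2 ℕ.* d) m) * ι (qint n)
        ≈⟨ ι-* (poch d (2 ℕ.* d) m) (qint n) ⟨
      ι (poch d (2 ℕ.* d) m *P qint n) ∎))
      where
      i = io (+ 1)
      b = Π io (+ 2 ℤ.+ D) 2D m
      B = Π o (+ 2 ℤ.+ D) 2D m
      e = E (M ℤ.- D ℤ.* M)
      e′ = ι (qpow (m ℕ.* d′))
      p = Π o D 2D m
      lem : ∀ d′ M → M ℤ.- (+ 1 ℤ.+ d′) ℤ.* M ℤ.+ M ℤ.* d′ ≡ + 0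
      lem = solve-∀
      ee′ : e * e′ ≈ 1#
      ee′ = trans (sym (E-+ (M ℤ.- D ℤ.* M) (+ (m ℕ.* d′)))) (trans (reflexive (≡.cong E
        (≡.trans (≡.cong (λ j → M ℤ.- D ℤ.* M ℤ.+ j) (ℤ.pos-* m d′)) (lem (+ d′) M)))) ι-1)

    t≈ : t ≈ - (ι (Φ n) * ι (pr n n))
    t≈ = begin
      t                         ≈⟨ o-ι n ⟨
      ι (oneP -P qpow n)        ≈⟨ ι-cong (AS.solve 1 (λ x → AS.con (+ 1) AS.:- x AS.:= AS.:- (x AS.:- AS.con (+ 1))) ≋-refl (qpow n)) ⟩
      ι (negP (q^ n −1))        ≈⟨ ι-neg (q^ n −1) ⟩
      - ι (q^ n −1)             ≈⟨ -‿cong (trans (ι-cong (Φ-factors 1≤n)) (ι-* (Φ n) (pr n n))) ⟩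
      - (ι (Φ n) * ι (pr n n))  ∎

    ≡F-intro : ∀ n₁ d₁ n₂ d₂ z₁ z₂ → Represents z₁ (n₁ , d₁) → Represents z₂ (n₂ , d₂) →
      V 3 (z₁ - z₂) → (n₁ , d₁) ≡F (n₂ , d₂) [mod Φ n *P Φ n *P Φ n ]
    ≡F-intro n₁ d₁ n₂ d₂ z₁ z₂ (represents e₁) (represents e₂) (val w (integral P Q Q⊥Φ eqw) eqv) =
      -- t = -Φ_n c, with c the product of Φ_i over the proper divisors i of n; hence t³ P/Q = Φ_n³
      -- (-c³ P)/Q.
      negP (c *P c *P c *P P) , Q , Coprime⇒CoprimeP (Coprime-sym (Coprime-* (Coprime-* co co) co)) , coeff≡ (ι-injective (begin
        ι ((n₁ *P d₂ -P n₂ *P d₁) *P Q)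
          ≈⟨ trans (ι-* (n₁ *P d₂ -P n₂ *P d₁) Q) (*-congʳ (trans (ι-sub (n₁ *P d₂) (n₂ *P d₁)) (+-cong (ι-* n₁ d₂) (-‿cong (ι-* n₂ d₁))))) ⟩
        (ι n₁ * ι d₂ - ι n₂ * ι d₁) * ι Q
          ≈⟨ *-congʳ (+-cong (*-congʳ e₁) (-‿cong (*-congʳ e₂))) ⟨
        (z₁ * ι d₁ * ι d₂ - z₂ * ι d₂ * ι d₁) * ι Q
          ≈⟨ solve 5 (λ z₁ z₂ d₁ d₂ Q → (z₁ :* d₁ :* d₂ :- z₂ :* d₂ :* d₁) :* Q := (z₁ :- z₂) :* Q :* d₁ :* d₂) refl z₁ z₂ (ι d₁) (ι d₂) (ι Q) ⟩
        (z₁ - z₂) * ι Q * ι d₁ * ι d₂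
          ≈⟨ *-congʳ (*-congʳ (*-congʳ eqv)) ⟩
        t * (t * (t * 1#)) * w * ι Q * ι d₁ * ι d₂
          ≈⟨ *-congʳ (*-congʳ (trans (*-assoc _ w (ι Q)) (*-cong (*-cong t≈ (*-cong t≈ (*-congʳ t≈))) eqw))) ⟩
        - (ι φ * ι c) * (- (ι φ * ι c) * (- (ι φ * ι c) * 1#)) * ι P * ι d₁ * ι d₂
          ≈⟨ solve 5 (λ φ c P d₁ d₂ → :- (φ :* c) :* (:- (φ :* c) :* (:- (φ :* c) :* con (+ 1))) :* P :* d₁ :* d₂
               := φ :* φ :* φ :* :- (c :* c :* c :* P) :* d₁ :* d₂) refl (ι φ) (ι c) (ι P) (ι d₁) (ι d₂) ⟩
        ι φ * ι φ * ι φ * - (ι c * ι c * ι c * ι P) * ι d₁ * ι d₂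
          ≈⟨ *-congʳ (*-congʳ (*-cong (ι-*₃ φ φ φ) (trans (ι-neg _) (-‿cong (ι-*₄ c c c P))))) ⟨
        ι (φ *P φ *P φ) * ι (negP (c *P c *P c *P P)) * ι d₁ * ι d₂
          ≈⟨ ι-*₄ (φ *P φ *P φ) (negP (c *P c *P c *P P)) d₁ d₂ ⟨
        ι (φ *P φ *P φ *P negP (c *P c *P c *P P) *P d₁ *P d₂) ∎))
      where
      φ = Φ n
      c = pr n n
      co = Coprime-sym Q⊥Φ

    n∤1 : ¬ + n ∣ + 1
    n∤1 = ∤-small (s≤s z≤n) (s≤s (ℕ.≤-trans (ℕ.≤-trans 1≤m (ℕ.m≤m+n m (d′ ℕ.* m))) (ℕ.m≤m+n (d ℕ.* m) (d ℕ.* m))))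

    -- Dividing by 1 - q keeps the order, because n > 1 makes 1 - q a unit of the local ring.
    conclude : ∀ k → V 3 (Σ (U (+ 1)) (suc k) - closedForm) → Congruent d n k
    conclude k v = ≡F-intro (proj₁ (lhs d k)) (proj₂ (lhs d k)) (proj₁ (rhs d n)) (proj₂ (rhs d n))
      (Σ (λ k → io (+ 1) * U (+ 1) k) (suc k)) (io (+ 1) * closedForm)
      (Represents-sum Represents-term (suc k)) Represents-rhs
      (V-resp (sym (trans (+-congʳ (Σ-*ˡ (io (+ 1)) (U (+ 1)) (suc k)))
        (solve 3 (λ i s c → i :* s :- i :* c := i :* (s :- c)) refl (io (+ 1)) (Σ (U (+ 1)) (suc k)) closedForm)))
        (V-*ˡ (io-O (+ 1) n∤1) v))

    theorem : Congruent d n ((n ℕ.∸ 1) div d) × Congruent d n (n ℕ.∸ 1)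
    theorem = ≡.subst (Congruent d n) (≡.sym n∸1-div-d) (conclude (m ℕ.+ m) short-sum) , conclude (n ℕ.∸ 1) full-sum

polyFractions : Inverting (Localisation.fractionRing polyRing)
polyFractions = record
  { ι           = ι
  ; ι-cong      = ι-cong
  ; ι-injective = ι-injective
  ; ι-1         = CommutativeRing.refl (Localisation.fractionRing polyRing)
  ; ι-+         = ι-+
  ; ι-*         = ι-*
  ; inv         = λ s rs → frac oneP s rs
  ; ι-inv       = ι-inverse
  }
  where open Localisation polyRing

open import Data.Nat using (_<_; _∸_; _*_)
open import Data.Nat.Divisibility using (_∣_)

theorem3 : (d n : ℕ) → 1 < d → 1 < n → 2 * d ∣ n ∸ 1 →
    (lhs d ((n ∸ 1) div d) ≡F rhs d n [mod Φ n *P Φ n *P Φ n ])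
    × (lhs d (n ∸ 1) ≡F rhs d n [mod Φ n *P Φ n *P Φ n ])
theorem3 (suc d′) (suc n′) (s≤s 1≤d′) (s≤s 1≤n′) (ℕ.divides m n′≡) =
  ≡.subst (λ k → Congruent d k ((k ∸ 1) div d) × Congruent d k (k ∸ 1))
    (≡.cong suc (≡.trans (lem d m) (≡.sym n′≡)))
    (Rational.Main.theorem (Localisation.fractionRing polyRing) polyFractions d′ m 1≤d′ 1≤m)
  where
  d = suc d′
  lem : ∀ d m → d ℕ.* m ℕ.+ d ℕ.* m ≡ m ℕ.* (2 ℕ.* d)
  lem = ℕ.solve-∀
  1≤m : 1 ℕ.≤ m
  1≤m = ℕ.n≢0⇒n>0 λ { ≡.refl → contradiction 1≤n′ (ℕ.<⇒≱ (ℕ.≤-reflexive (≡.cong suc n′≡))) }
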